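{- Let $G$ be a connected graph with $n$ vertices and $m$ edges having a (multiplicative) tree $t$-spanner. Then $G$ admits an additive $(2\lceil t/2\rceil\log_2 n)$-spanner with at most $n\log_2 n$ edges, constructible in $O(nm\log^2 n)$ time.
   Context: All graphs are finite, connected, unweighted, undirected, without loops or multiple edges; $d_G$ is the shortest-path distance. For $t\ge 1$, a spanning subgraph $H$ of $G$ is a (multiplicative) $t$-spanner if $d_H(u,v)\le t\cdot d_G(u,v)$ for all vertices $u,v$; a tree $t$-spanner is a spanning tree that is a $t$-spanner. A spanning subgraph $H$ is an additive $r$-spanner if $d_H(u,v)\le d_G(u,v)+r$ for all $u,v$. -}

module Defs where

open import Data.Bool.Base using (if_then_else_; _∧_)
open import Data.Fin.Base as Fin using (Fin; toℕ)
import Data.Fin.Properties as Fin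
open import Data.Integer.Base as ℤ using (+_)
open import Data.List.Base
  using (List; _∷_; _∷ʳ_; length; lookup; filter; allFin; cartesianProduct)
open import Data.List.Relation.Binary.Permutation.Propositional using (_↭_)
open import Data.List.Relation.Unary.Linked using (Linked)
open import Data.List.Relation.Unary.Unique.Propositional using (Unique)
open import Data.Nat.Base using (ℕ; suc; _+_; _*_; _∸_; _^_; _≤_)
open import Data.Nat.Logarithm using (⌊log₂_⌋)
import Data.Nat.Properties as ℕ
open import Data.Product.Base using (Σ-syntax; ∃-syntax; _×_; _,_; proj₁; proj₂)
open import Data.Rational.Base as ℚ using (ℚ; ½; ceiling)
open import Level using (0ℓ)
open import Relation.Binary.Core using (Rel)
open import Relation.Binary.Definitions
  using (Symmetric; Irreflexive; Decidable)
open import Relation.Binary.PropositionalEquality.Core using (_≡_; _≢_)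
open import Relation.Nullary.Decidable.Core using (does; _×-dec_)
open import Relation.Nullary.Negation.Core using (¬_)

------------------------------------------------------------------------
-- Finite simple graphs

record Graph (n : ℕ) : Set₁ where
  field
    _∼_      : Rel (Fin n) 0ℓ
    ∼-sym    : Symmetric _∼_
    ∼-irrefl : Irreflexive _≡_ _∼_
    _∼?_     : Decidable _∼_

  -- Each edge is listed once, smaller endpoint first.
  edges : List (Fin n × Fin n)
  edges = filter (λ (u , v) → (u Fin.<? v) ×-dec (u ∼? v))
                 (cartesianProduct (allFin n) (allFin n))

  ∣E∣ : ℕ
  ∣E∣ = length edges

  data Walk : Fin n → Fin n → ℕ → Set where
    []  : ∀ {u} → Walk u u 0
    _∷_ : ∀ {u v w k} → u ∼ v → Walk v w k → Walk u w (suc k)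

  -- Distance as a relation: no k satisfies it when v is unreachable from u.
  Dist : Fin n → Fin n → ℕ → Set
  Dist u v k = Walk u v k × (∀ {j} → Walk u v j → k ≤ j)

  Connected : Set
  Connected = ∀ u v → ∃[ k ] Walk u v k

  -- The list v ∷ vs with at least three distinct vertices is a cycle when
  -- consecutive vertices, and the last and the first, are adjacent.
  Acyclic : Set
  Acyclic = ∀ v vs → 2 ≤ length vs → Unique (v ∷ vs) →
            ¬ Linked _∼_ ((v ∷ vs) ∷ʳ v)

  IsTree : Set
  IsTree = Connected × Acyclic

open Graph public using (∣E∣; edges; Connected)

------------------------------------------------------------------------
-- Spanners

module _ {n : ℕ} (G H : Graph n) where
  private
    module G = Graph G
    module H = Graph H

  IsSpanningSubgraph : Set
  IsSpanningSubgraph = ∀ {u v} → u H.∼ v → u G.∼ v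

  -- In both notions of spanner, the distance in H is required to exist
  -- wherever the distance in G does.

  IsMultiplicativeSpanner : ℚ → Set
  IsMultiplicativeSpanner t = IsSpanningSubgraph ×
    (∀ {u v k} → G.Dist u v k →
       ∃[ j ] H.Dist u v j × (+ j ℚ./ 1) ℚ.≤ t ℚ.* (+ k ℚ./ 1))

  IsAdditiveSpanner : ℕ → Set
  IsAdditiveSpanner r = IsSpanningSubgraph ×
    (∀ {u v k} → G.Dist u v k → ∃[ j ] H.Dist u v j × j ≤ k + r)

HasTreeSpanner : ∀ {n} → Graph n → ℚ → Set₁
HasTreeSpanner {n} G t =
  Σ[ T ∈ Graph n ] Graph.IsTree T × IsMultiplicativeSpanner G T t

-- The absolute value only converts to ℕ: for t ≥ 1 the ceiling is positive.
⌈½_⌉ : ℚ → ℕ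
⌈½ t ⌉ = ℤ.∣ ceiling (t ℚ.* ½) ∣

-- The floor of the real number a · log₂ n = log₂ (nᵃ), for n ≥ 1.  A natural
-- number is at most a · log₂ n exactly when it is at most this floor, so
-- nothing is lost where distances and numbers of edges are bounded.
⌊_·log₂_⌋ : ℕ → ℕ → ℕ
⌊ a ·log₂ n ⌋ = ⌊log₂ (n ^ a) ⌋

------------------------------------------------------------------------
-- A unit-cost random access machine, programmed with while loops

-- Memory is a family of arrays of natural numbers; σ a i is cell i of
-- array a.  A program mentions only finitely many arrays, each by a fixed
-- name, so they can be interleaved in a single linear memory.
Memory : Set
Memory = ℕ → ℕ → ℕ

-- Successor and truncated subtraction are the only arithmetic, so, from an
-- initial memory with entries polynomial in n, the largest value grows by at
-- most one per unit of time, up to the literals of the program.  In polynomial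
-- time words thus stay O(log n) bits long, and charging one unit per operation
-- hides no work.
data Exp : Set where
  lit  : ℕ → Exp
  _[_] : (a : ℕ) → Exp → Exp
  inc  : Exp → Exp
  _⊖_  : Exp → Exp → Exp

data Program : Set where
  skip          : Program
  _[_]≔_        : (a : ℕ) → Exp → Exp → Program
  _⨾_           : Program → Program → Program
  if_run_else_  : Exp → Program → Program → Program
  while_run_    : Exp → Program → Program

infixr 5 _⨾_

⟦_⟧ : Exp → Memory → ℕ
⟦ lit k ⟧   σ = k
⟦ a [ e ] ⟧ σ = σ a (⟦ e ⟧ σ)
⟦ inc e ⟧   σ = suc (⟦ e ⟧ σ)
⟦ e ⊖ f ⟧   σ = ⟦ e ⟧ σ ∸ ⟦ f ⟧ σ

cost : Exp → ℕ
cost (lit k)   = 1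
cost (a [ e ]) = 1 + cost e
cost (inc e)   = 1 + cost e
cost (e ⊖ f)   = 1 + (cost e + cost f)

update : Memory → ℕ → ℕ → ℕ → Memory
update σ a i x b j =
  if does (b ℕ.≟ a) ∧ does (j ℕ.≟ i) then x else σ b j

-- ⟨ p , σ ⟩⇓⟨ τ , k ⟩: started in memory σ, the program p halts with memory τ
-- after k units of time.  A condition holds when its value is nonzero.
data ⟨_,_⟩⇓⟨_,_⟩ : Program → Memory → Memory → ℕ → Set where

  ⇓skip : ∀ {σ} → ⟨ skip , σ ⟩⇓⟨ σ , 1 ⟩

  ⇓assign : ∀ {a e f σ} →
    ⟨ a [ e ]≔ f , σ ⟩⇓⟨ update σ a (⟦ e ⟧ σ) (⟦ f ⟧ σ)
                       , 1 + (cost e + cost f) ⟩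

  ⇓seq : ∀ {p q σ τ υ k l} →
    ⟨ p , σ ⟩⇓⟨ τ , k ⟩ → ⟨ q , τ ⟩⇓⟨ υ , l ⟩ →
    ⟨ p ⨾ q , σ ⟩⇓⟨ υ , k + l ⟩

  ⇓then : ∀ {e p q σ τ k} → ⟦ e ⟧ σ ≢ 0 →
    ⟨ p , σ ⟩⇓⟨ τ , k ⟩ →
    ⟨ if e run p else q , σ ⟩⇓⟨ τ , 1 + (cost e + k) ⟩

  ⇓else : ∀ {e p q σ τ k} → ⟦ e ⟧ σ ≡ 0 →
    ⟨ q , σ ⟩⇓⟨ τ , k ⟩ →
    ⟨ if e run p else q , σ ⟩⇓⟨ τ , 1 + (cost e + k) ⟩

  ⇓stop : ∀ {e p σ} → ⟦ e ⟧ σ ≡ 0 →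
    ⟨ while e run p , σ ⟩⇓⟨ σ , 1 + cost e ⟩

  ⇓loop : ∀ {e p σ τ υ k l} → ⟦ e ⟧ σ ≢ 0 →
    ⟨ p , σ ⟩⇓⟨ τ , k ⟩ → ⟨ while e run p , τ ⟩⇓⟨ υ , l ⟩ →
    ⟨ while e run p , σ ⟩⇓⟨ υ , 1 + (cost e + (k + l)) ⟩

-- Graphs are read and written as edge lists, in any order: array 0 starts
-- with the numbers of vertices and edges, and arrays 1 and 2 hold the
-- endpoints.  All other cells are unconstrained, so a program cannot rely on
-- initial values there.
Stores : ∀ {n} → Memory → Graph n → Set
Stores {n} σ G = ∃[ es ] es ↭ edges G ×
  σ 0 0 ≡ n × σ 0 1 ≡ length es ×
  (∀ i → σ 1 (toℕ i) ≡ toℕ (proj₁ (lookup es i)) ×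
         σ 2 (toℕ i) ≡ toℕ (proj₂ (lookup es i)))

{-# OPTIONS --safe #-}

-- Let r = ⌈t/2⌉.  An edge of G with both ends further than r from a vertex v
-- stays within one branch of T at v, as its tree path is too short to pass v.
-- Hence, if v is a median in T of a set Z of vertices, the disk of radius r around
-- v splits Z into parts of at most half its size.  This property of G survives
-- the contraction of everything outside a component of the complement of a disk
-- to a single new vertex.  So G can be divided recursively: choose a smallest
-- balanced disk, keep the edges of a breadth-first tree from its center, and
-- continue with every component together with its contracted vertex.  A
-- shortest path that meets the disk is replaced by a detour of at most 2r
-- through the center, and undoing a contraction costs at most 2r more, which
-- makes 2r for each of the log n levels.
--
-- A division of a node with k vertices, s of them from G, keeps k - 1 edges, and
-- the vertices of all children other than the contracted ones number at most
-- k - 1.  Hence the sum of (k - 1) ⌊log₂ s⌋ over the waiting nodes drops by k - 1.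
-- This potential bounds the number of edges, of vertex names and, as a node is
-- divided with O(k) searches, the running time.
module Submission where

open import Defs
open import Data.Bool.Base using (Bool; true; false; if_then_else_; _∧_; _∨_; not; T)
open import Data.Empty using (⊥; ⊥-elim)
open import Data.Fin.Base as Fin using (Fin; zero; suc; toℕ; fromℕ<)
import Data.Fin.Properties as Fin
open import Data.Integer.Base as ℤ using (ℤ; -[1+_])
import Data.Integer.DivMod as ℤ
import Data.Integer.Properties as ℤ
open import Data.List.Base
  using (List; []; _∷_; _∷ʳ_; _++_; length; lookup; filter; map; concat; allFin; upTo; cartesianProduct)
open import Data.List.Membership.Propositional using (_∈_; _∉_)
import Data.List.Membership.Propositional.Properties as ∈
open import Data.List.Properties using (length-++; ++-assoc; ++-identityʳ; length-map; length-tabulate; map-++; length-filter; length-upTo; filter-++; filter-accept; filter-reject)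
open import Data.List.Relation.Binary.Permutation.Propositional as ↭ using (_↭_; ↭-sym; ↭-trans; ↭-refl; ↭-prep)
import Data.List.Relation.Binary.Permutation.Propositional.Properties as ↭
open import Data.List.Relation.Unary.All as All using (All; []; _∷_)
import Data.List.Relation.Unary.All.Properties as All
import Data.List.Relation.Unary.Any.Properties as Any
open import Data.List.Relation.Unary.AllPairs as AllPairs using (AllPairs; []; _∷_)
import Data.List.Relation.Unary.AllPairs.Properties as AllPairs
open import Data.List.Relation.Unary.Any as Any using (Any; here; there)
open import Data.List.Relation.Unary.Linked using (Linked; []; [-]; _∷_)
open import Data.List.Relation.Unary.Unique.Propositional using (Unique)
import Data.List.Relation.Unary.Unique.Propositional.Properties as Unique
open import Data.Nat.Base
open import Data.Nat.ListAction using (sum)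
open import Data.Nat.ListAction.Properties using (sum-↭)
open import Data.Nat.Logarithm
open import Data.Nat.Properties
open import Data.Nat.Solver using (module +-*-Solver)
open import Data.Product.Base using (Σ-syntax; ∃-syntax; _×_; _,_; proj₁; proj₂)
open import Data.Product.Properties using (≡-dec)
open import Data.Rational.Base as ℚ using (ℚ; 1ℚ; ½; ceiling)
import Data.Rational.Properties as ℚ
import Data.Rational.Unnormalised.Base as ℚᵘ
import Data.Rational.Unnormalised.Properties as ℚᵘ
open import Data.Sum.Base using (_⊎_; inj₁; inj₂)
open import Data.Unit.Base using (tt)
open import Function.Base using (_∘_; id; case_of_)
open import Level using (Level)
open import Relation.Binary.Definitions using (DecidableEquality; tri<; tri≈; tri>)
open import Relation.Binary.PropositionalEquality using (_≡_; _≢_; refl; sym; trans; cong; cong₂; subst; subst₂)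
open import Relation.Nullary.Decidable using (Dec; yes; no; does; _×-dec_; _⊎-dec_; map′; dec-true; dec-false)
open import Relation.Nullary.Negation using (¬_; contradiction)

-- The program is told neither `t` nor the tree. The tree spanner serves only to prove that some
-- disk of radius r is balanced; as the program takes the smallest radius that works, its radius is
-- at most r. Balance is demanded for every set Z of original vertices, not just for all of them: a
-- child inherits its disk from the parent for the same Z, which then fills only a part of the
-- parent.
--
-- The factor log² n has two sources. Names of contracted vertices are never reused, so up to n + (n
-- - 1) ⌊log₂ n⌋ names occur, and a trial of a disk, which clears its marks, takes O(n log n + m)
-- steps. Moreover, O(n log n) trials occur in all. As n ≤ 2m, the product is O(nm log² n). Trying
-- every center with every radius would be too slow; because balance is monotone in the radius, a
-- center that fails once is dropped for good.
--
-- All nodes share one table of arcs, which a contraction rewrites in place. Each arc carries the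
-- index of an edge of G as a label that no contraction changes, so marking labels selects the
-- spanner.

-- Walks of exact and of bounded length

data Path {a b} {A : Set a} (R : A → A → Set b) : A → A → ℕ → Set (a Level.⊔ b) where
  ε   : ∀ {x} → Path R x x 0
  _◅_ : ∀ {x y z k} → R x y → Path R y z k → Path R x z (suc k)

infixr 5 _◅_

Path≤ : ∀ {a b} {A : Set a} (R : A → A → Set b) → A → A → ℕ → Set (a Level.⊔ b)
Path≤ R x y k = ∃[ j ] j ≤ k × Path R x y j

module _ {a b} {A : Set a} {R : A → A → Set b} where

  infixr 5 _◅◅_ _◅◅≤_

  _◅◅_ : ∀ {x y z j k} → Path R x y j → Path R y z k → Path R x z (j + k)
  ε       ◅◅ q = q
  (e ◅ p) ◅◅ q = e ◅ (p ◅◅ q)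

  _◅◅≤_ : ∀ {x y z j k} → Path≤ R x y j → Path≤ R y z k → Path≤ R x z (j + k)
  (_ , i≤ , p) ◅◅≤ (_ , j≤ , q) = _ , +-mono-≤ i≤ j≤ , p ◅◅ q

  weaken : ∀ {x y j k} → j ≤ k → Path≤ R x y j → Path≤ R x y k
  weaken j≤k (_ , i≤ , p) = _ , ≤-trans i≤ j≤k , p

  exactly : ∀ {x y k} → Path R x y k → Path≤ R x y k
  exactly p = _ , ≤-refl , p

  _▻_ : ∀ {x y z k} → Path R x y k → R y z → Path R x z (suc k)
  ε       ▻ e = e ◅ ε
  (f ◅ p) ▻ e = f ◅ (p ▻ e)

module _ {a b c} {A : Set a} {R : A → A → Set b} {S : A → A → Set c} where

  mapPath : (∀ {x y} → R x y → S x y) → ∀ {x y k} → Path R x y k → Path S x y k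
  mapPath f ε       = ε
  mapPath f (e ◅ p) = f e ◅ mapPath f p

  mapPath≤ : (∀ {x y} → R x y → S x y) → ∀ {x y k} → Path≤ R x y k → Path≤ S x y k
  mapPath≤ f (_ , le , p) = _ , le , mapPath f p

  reversePath : (∀ {x y} → R x y → S y x) → ∀ {x y k} → Path R x y k → Path S y x k
  reversePath f ε       = ε
  reversePath f (e ◅ p) = reversePath f p ▻ f e

  reversePath≤ : (∀ {x y} → R x y → S y x) → ∀ {x y k} → Path≤ R x y k → Path≤ S y x k
  reversePath≤ f (_ , le , p) = _ , le , reversePath f p

-- Lists without repetitions

module _ {a} {A : Set a} where

  infix 4 _⊆_
  _⊆_ : List A → List A → Set a
  xs ⊆ ys = ∀ {x} → x ∈ xs → x ∈ ys

  extract : ∀ {x : A} {ys} → x ∈ ys → ∃[ zs ] ys ↭ x ∷ zs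
  extract {x} x∈ys with as , bs , refl ← ∈.∈-∃++ x∈ys = as ++ bs , ↭.shift x as bs

  complement : ∀ {xs ys : List A} → Unique xs → xs ⊆ ys → ∃[ zs ] ys ↭ xs ++ zs
  complement {[]}     []        sub = _ , ↭-refl
  complement {x ∷ xs} (x∉ ∷ un) sub with zs , p ← extract (sub (here refl)) =
    let ws , q = complement un rest in ws , ↭-trans p (↭-prep x q)
    where
    rest : xs ⊆ zs
    rest y∈ with ↭.∈-resp-↭ p (sub (there y∈))
    ... | here refl = contradiction refl (All.lookup x∉ y∈)
    ... | there y∈′ = y∈′

  length-mono-⊆ : ∀ {xs ys : List A} → Unique xs → xs ⊆ ys → length xs ≤ length ys
  length-mono-⊆ {xs} {ys} un sub with zs , p ← complement un sub = begin
    length xs             ≤⟨ m≤m+n _ _ ⟩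
    length xs + length zs ≡⟨ sym (length-++ xs) ⟩
    length (xs ++ zs)     ≡⟨ sym (↭.↭-length p) ⟩
    length ys             ∎
    where open ≤-Reasoning

  unique-∷ʳ : ∀ {xs : List A} {x} → Unique xs → x ∉ xs → Unique (xs ∷ʳ x)
  unique-∷ʳ un x∉ = AllPairs.++⁺ un ([] ∷ [])
    (All.tabulate λ y∈ → (λ { refl → x∉ y∈ }) ∷ [])

  ∈-∷ʳ⁻ : ∀ {xs : List A} {x y} → y ∈ xs ∷ʳ x → y ∈ xs ⊎ y ≡ x
  ∈-∷ʳ⁻ {xs} y∈ with ∈.∈-++⁻ xs y∈
  ... | inj₁ y∈xs        = inj₁ y∈xs
  ... | inj₂ (here refl) = inj₂ refl

  length-∷ʳ : ∀ (xs : List A) x → length (xs ∷ʳ x) ≡ suc (length xs)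
  length-∷ʳ xs x = trans (length-++ xs) (+-comm _ 1)

module _ {a b} {A : Set a} {R : A → A → Set b} where

  allPairs-∷ʳ : ∀ {xs x} → AllPairs R xs → All (λ y → R y x) xs → AllPairs R (xs ∷ʳ x)
  allPairs-∷ʳ ps qs = AllPairs.++⁺ ps ([] ∷ []) (All.map (_∷ []) qs)

length-below : ∀ {N vs} → Unique vs → All (_< N) vs → length vs ≤ N
length-below {N} un lt = ≤-trans (length-mono-⊆ un λ v∈ → ∈.∈-upTo⁺ (All.lookup lt v∈)) (≤-reflexive (length-upTo N))

nonmetas : ℕ → List ℕ → List ℕ
nonmetas n = filter (_<? n)

module _ {n : ℕ} where

  ∈-nonmetas⁺ : ∀ {v vs} → v ∈ vs → v < n → v ∈ nonmetas n vs
  ∈-nonmetas⁺ = ∈.∈-filter⁺ (_<? n)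

  ∈-nonmetas⁻ : ∀ {v vs} → v ∈ nonmetas n vs → v ∈ vs × v < n
  ∈-nonmetas⁻ = ∈.∈-filter⁻ (_<? n)

argmin : ∀ {n} .{{_ : NonZero n}} (f : Fin n → ℕ) → ∃[ i ] ∀ j → f i ≤ f j
argmin {suc zero}    f = zero , λ { zero → ≤-refl }
argmin {suc (suc n)} f with i , min ← argmin (f ∘ suc) | f zero ≤? f (suc i)
... | yes p = zero , λ { zero → ≤-refl ; (suc j) → ≤-trans p (min j) }
... | no ¬p = suc i , λ { zero → <⇒≤ (≰⇒> ¬p) ; (suc j) → min j }

-- Medians of a tree spanner

module _ {n : ℕ} {R : Fin n → Fin n → Set} (R? : ∀ u v → Dec (R u v)) where

  path? : ∀ u v k → Dec (Path R u v k)
  path? u v zero    = map′ (λ { refl → ε }) (λ { ε → refl }) (u Fin.≟ v)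
  path? u v (suc k) = map′ (λ { (_ , e , p) → e ◅ p }) (λ { (e ◅ p) → _ , e , p })
                           (Fin.any? λ w → R? u w ×-dec path? w v k)

  leastPath : ∀ {u v k} → Path R u v k →
              ∃[ j ] j ≤ k × Path R u v j × (∀ {i} → Path R u v i → j ≤ i)
  leastPath {u} {v} {k} p = search k 0 (+-identityʳ k) (λ _ ())
    where
    search : ∀ d j → d + j ≡ k → (∀ i → i < j → ¬ Path R u v i) →
             ∃[ j ] j ≤ k × Path R u v j × (∀ {i} → Path R u v i → j ≤ i)
    search d j eq none with path? u v j
    ... | yes q = j , ≤-trans (m≤n+m j d) (≤-reflexive eq) , q ,
                  λ {i} q′ → ≮⇒≥ λ i<j → none i i<j q′
    search zero    j refl none | no ¬q = contradiction p ¬q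
    search (suc d) j eq   none | no ¬q = search d (suc j) (trans (+-suc d j) eq)
      λ i i< q → case m≤n⇒m<n∨m≡n (s≤s⁻¹ i<) of
        λ { (inj₁ i<j) → none i i<j q ; (inj₂ refl) → ¬q q }

module _ {n : ℕ} (G : Graph n) where
  open Graph G using (Walk; []; _∷_) renaming (_∼_ to _~_)

  walk→path : ∀ {u v k} → Walk u v k → Path _~_ u v k
  walk→path []      = ε
  walk→path (e ∷ w) = e ◅ walk→path w

  path→walk : ∀ {u v k} → Path _~_ u v k → Walk u v k
  path→walk ε       = []
  path→walk (e ◅ p) = e ∷ path→walk p

  dist : ∀ {u v k} → Path _~_ u v k → ∃[ j ] j ≤ k × Graph.Dist G u v j
  dist p with j , j≤k , q , min ← leastPath (Graph._∼?_ G) p =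
    j , j≤k , path→walk q , λ w → min (walk→path w)

module _ {A : Set} (R : A → A → Set) where

  -- A `Path` forgets its vertices. Here they are listed, so that repetitions can be cut out and the
  -- list can be handed to `Acyclic`.
  data Track : A → A → List A → Set where
    single : ∀ {x} → Track x x (x ∷ [])
    cons   : ∀ {x y z ys} → R x y → Track y z ys → Track x z (x ∷ ys)

module _ {A : Set} {R : A → A → Set} where

  suffix : ∀ {x y z xs} → Track R x y xs → Unique xs → z ∈ xs →
           ∃[ ys ] Track R z y ys × Unique ys
  suffix tr@single     un     (here refl) = _ , tr , un
  suffix tr@(cons _ _) un     (here refl) = _ , tr , un
  suffix (cons _ tr) (_ ∷ un) (there z∈) = suffix tr un z∈

  -- Loop erasure: if the new first vertex occurs again later, only the walk from that occurrence on
  -- is kept.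
  simple : DecidableEquality A → ∀ {x y k} → Path R x y k →
           ∃[ xs ] Track R x y xs × Unique xs
  simple _≟ᴬ_ ε = _ , single , [] ∷ []
  simple _≟ᴬ_ {x} (e ◅ p) with xs , tr , un ← simple _≟ᴬ_ p with Any.any? (x ≟ᴬ_) xs
  ... | yes x∈ = suffix tr un x∈
  ... | no x∉  = x ∷ xs , cons e tr , All.¬Any⇒All¬ _ x∉ ∷ un

  track-all : ∀ {P : A → Set} → (∀ {x y} → R x y → P y) →
              ∀ {x y xs} → P x → Track R x y xs → All P xs
  track-all f px single      = px ∷ []
  track-all f px (cons e tr) = px ∷ track-all f (f e) tr

  track-length : ∀ {x y xs} → x ≢ y → Track R x y xs → 2 ≤ length xs
  track-length x≢y single              = contradiction refl x≢y
  track-length x≢y (cons _ single)     = ≤-refl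
  track-length x≢y (cons _ (cons _ _)) = s≤s (s≤s z≤n)

  track-linked : ∀ {S : A → A → Set} → (∀ {x y} → R x y → S x y) →
                 ∀ {x y xs v w} → S v x → Track R x y xs → S y w → Linked S (v ∷ (xs ∷ʳ w))
  track-linked f first single      last = first ∷ last ∷ [-]
  track-linked f first (cons e tr) last = first ∷ track-linked f (f e) tr last

-- The disk around a median of Z in T separates: if more than half of Z were
-- connected outside the disk, the first tree edge towards this part would lead
-- to a vertex with a smaller sum of tree distances to Z.
module Median {n : ℕ} .{{_ : NonZero n}} (G T : Graph n) (r : ℕ)
  (T-tree : Graph.IsTree T)
  (T⊆G : ∀ {u v} → Graph._∼_ T u v → Graph._∼_ G u v)
  (stretch : ∀ {u v} → Graph._∼_ G u v → Path≤ (Graph._∼_ T) u v (2 * r))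
  where
  private
    module G = Graph G
    module T = Graph T

  Avoiding : Fin n → Fin n → Fin n → Set
  Avoiding v x y = x T.∼ y × x ≢ v × y ≢ v

  Disk : Fin n → Fin n → Set
  Disk v w = Path≤ G._∼_ v w r

  -- Only the head of a step is tested. Along a walk every vertex after the first is then tested
  -- once, and the start is a separate hypothesis. `OffBall` follows the same pattern.
  Outside : Fin n → Fin n → Fin n → Set
  Outside v x y = x G.∼ y × ¬ Disk v y

  abstract
    geodesic : ∀ u v → ∃[ j ] Path T._∼_ u v j × (∀ {i} → Path T._∼_ u v i → j ≤ i)
    geodesic u v
      with _ , w ← proj₁ T-tree u v
      with j , _ , p , min ← leastPath T._∼?_ (walk→path T w) = j , p , min

    d : Fin n → Fin n → ℕ
    d u v = proj₁ (geodesic u v)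

    d-path : ∀ u v → Path T._∼_ u v (d u v)
    d-path u v = proj₁ (proj₂ (geodesic u v))

    d-min : ∀ {u v i} → Path T._∼_ u v i → d u v ≤ i
    d-min {u} {v} = proj₂ (proj₂ (geodesic u v))

  avoiding-sym : ∀ {v x y} → Avoiding v x y → Avoiding v y x
  avoiding-sym (e , x≢ , y≢) = T.∼-sym e , y≢ , x≢

  -- If such a walk visited `v`, its remainder would be a walk from `v` to `z` shorter than their
  -- distance.
  short-avoids : ∀ {v a z j} → Path T._∼_ a z j → j < d v z → Path (Avoiding v) a z j
  short-avoids ε       _   = ε
  short-avoids (e ◅ p) j<d =
    (e , (λ { refl → <⇒≱ j<d (d-min (e ◅ p)) }) , λ { refl → <⇒≱ (<⇒≤ j<d) (d-min p) })
    ◅ short-avoids p (<⇒≤ j<d)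

  first-step : ∀ {v z} → z ≢ v →
               ∃[ u ] v T.∼ u × suc (d u z) ≤ d v z × ∃[ k ] Path (Avoiding v) u z k
  first-step {v} {z} z≢v = go (d-path v z) refl
    where
    go : ∀ {j} → Path T._∼_ v z j → j ≡ d v z →
         ∃[ u ] v T.∼ u × suc (d u z) ≤ d v z × ∃[ k ] Path (Avoiding v) u z k
    go ε       _  = contradiction refl z≢v
    go (e ◅ p) eq = _ , e , ≤-trans (s≤s (d-min p)) (≤-reflexive eq) ,
                    _ , short-avoids p (≤-reflexive eq)

  -- Two different neighbours of `v` that are joined off `v` would close a cycle through `v`.
  first-unique : ∀ {v u y k} → v T.∼ u → v T.∼ y → Path (Avoiding v) u y k → u ≡ y
  first-unique {v} {u} {y} vu vy p with u Fin.≟ y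
  ... | yes u≡y = u≡y
  ... | no u≢y with xs , tr , un ← simple Fin._≟_ p =
    ⊥-elim (proj₂ T-tree v xs (track-length u≢y tr) (v∉ tr ∷ un)
                  (track-linked proj₁ vu tr (T.∼-sym vy)))
    where
    v∉ : ∀ {xs} → Track (Avoiding v) u y xs → All (v ≢_) xs
    v∉ tr = All.map (λ x≢v v≡x → x≢v (sym v≡x))
      (track-all {P = _≢ v} (proj₂ ∘ proj₂) (λ { refl → T.∼-irrefl refl vu }) tr)

  pass-or-avoid : ∀ {v x y k} → x ≢ v → Path T._∼_ x y k →
    Path (Avoiding v) x y k ⊎
    ∃[ i ] ∃[ j ] i + j ≡ k × Path T._∼_ x v i × Path T._∼_ v y j
  pass-or-avoid x≢v ε = inj₁ ε
  pass-or-avoid {v} x≢v (_◅_ {y = w} e p) with w Fin.≟ v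
  ... | yes refl = inj₂ (1 , _ , refl , e ◅ ε , p)
  ... | no w≢v with pass-or-avoid w≢v p
  ...   | inj₁ q = inj₁ ((e , x≢v , w≢v) ◅ q)
  ...   | inj₂ (i , j , eq , q , q′) = inj₂ (suc i , j , cong suc eq , e ◅ q , q′)

  outside-≢ : ∀ {v w} → ¬ Disk v w → w ≢ v
  outside-≢ out refl = out (0 , z≤n , ε)

  edge-avoids : ∀ {v x y} → ¬ Disk v x → Outside v x y → ∃[ k ] Path (Avoiding v) x y k
  edge-avoids {v} {x} {y} x∉ (e , y∉) with k , k≤ , p ← stretch e with pass-or-avoid (outside-≢ x∉) p
  ... | inj₁ q = _ , q
  ... | inj₂ (i , j , refl , q , q′) = ⊥-elim (<⇒≱ too-long k≤)
    where
    i> : r < i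
    i> = ≰⇒> λ i≤ → x∉ (i , i≤ , reversePath (G.∼-sym ∘ T⊆G) q)
    j> : r < j
    j> = ≰⇒> λ j≤ → y∉ (j , j≤ , mapPath T⊆G q′)
    too-long : 2 * r < i + j
    too-long = +-mono-<-≤ i> (≤-trans (≤-reflexive (+-identityʳ r)) (<⇒≤ j>))

  path-avoids : ∀ {v x y k} → ¬ Disk v x → Path (Outside v) x y k → ∃[ j ] Path (Avoiding v) x y j
  path-avoids x∉ ε                  = _ , ε
  path-avoids x∉ (e@(_ , y∉) ◅ p) =
    _ , proj₂ (edge-avoids x∉ e) ◅◅ proj₂ (path-avoids y∉ p)

  outside-end : ∀ {v x y k} → ¬ Disk v x → Path (Outside v) x y k → ¬ Disk v y
  outside-end x∉ ε              = x∉
  outside-end x∉ ((_ , y∉) ◅ p) = outside-end y∉ p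

  -- By `path-avoids`, all vertices joined to `z₀` outside the disk lie in one branch of the tree at
  -- `v`. The first step of a geodesic from `v` to any of them is therefore the same `u`.
  closer : ∀ {v z₀ z k u} → ¬ Disk v z₀ → v T.∼ u → ∃[ j ] Path (Avoiding v) u z₀ j →
           Path (Outside v) z₀ z k → suc (d u z) ≤ d v z
  closer {z = z} z₀∉ vu (_ , q) p
    with u′ , vu′ , lt , _ , q′ ← first-step (outside-≢ (outside-end z₀∉ p))
    with refl ← first-unique vu vu′ (q ◅◅ proj₂ (path-avoids z₀∉ p) ◅◅ reversePath avoiding-sym q′) = lt

  sum-closer : ∀ {u v} zs → (∀ {z} → z ∈ zs → suc (d u z) ≤ d v z) →
               sum (map (d u) zs) + length zs ≤ sum (map (d v) zs)
  sum-closer {u} {v} []       _ = z≤n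
  sum-closer {u} {v} (z ∷ zs) f = begin
    (d u z + sum (map (d u) zs)) + suc (length zs)  ≡⟨ +-suc _ _ ⟩
    suc (d u z + sum (map (d u) zs) + length zs)    ≡⟨ cong suc (+-assoc (d u z) _ _) ⟩
    suc (d u z) + (sum (map (d u) zs) + length zs)  ≤⟨ +-mono-≤ (f (here refl)) (sum-closer zs (f ∘ there)) ⟩
    d v z + sum (map (d v) zs)                      ∎
    where open ≤-Reasoning

  sum-farther : ∀ {u v} zs → v T.∼ u → sum (map (d u) zs) ≤ sum (map (d v) zs) + length zs
  sum-farther         []       _ = z≤n
  sum-farther {u} {v} (z ∷ zs) e = begin
    d u z + sum (map (d u) zs)                     ≤⟨ +-mono-≤ (d-min (T.∼-sym e ◅ d-path v z)) (sum-farther zs e) ⟩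
    suc (d v z) + (sum (map (d v) zs) + length zs) ≡⟨ cong suc (sym (+-assoc (d v z) _ _)) ⟩
    suc (d v z + sum (map (d v) zs) + length zs)   ≡⟨ sym (+-suc _ _) ⟩
    (d v z + sum (map (d v) zs)) + suc (length zs) ∎
    where open ≤-Reasoning

  sum-++-↭ : ∀ {zs} v xs {ys} → zs ↭ xs ++ ys →
             sum (map (d v) zs) ≡ sum (map (d v) xs) + sum (map (d v) ys)
  sum-++-↭ v xs p = trans (sum-↭ (↭.map⁺ (d v) p)) (go xs)
    where
    go : ∀ xs {ys} → sum (map (d v) (xs ++ ys)) ≡ sum (map (d v) xs) + sum (map (d v) ys)
    go []       = refl
    go (x ∷ xs) = trans (cong (d v x +_) (go xs)) (sym (+-assoc (d v x) _ _))

  -- Here `A` and `B` are the sums of distances from the median to a part and to the rest of Z, `a`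
  -- and `b` those from its neighbour towards the part, `p` and `q` the sizes of part and rest. The
  -- last hypothesis is minimality of the median; the conclusion says that the part is not the
  -- larger one.
  cancel : ∀ {a b p q A B} → a + p ≤ A → b ≤ B + q → A + B ≤ a + b → p ≤ q
  cancel {a} {b} {p} {q} {A} {B} h₁ h₂ h₃ = +-cancelˡ-≤ (a + B) p q (begin
    a + B + p   ≡⟨ solve 3 (λ a B p → a :+ B :+ p := a :+ p :+ B) refl a B p ⟩
    a + p + B   ≤⟨ +-monoˡ-≤ B h₁ ⟩
    A + B       ≤⟨ h₃ ⟩
    a + b       ≤⟨ +-monoʳ-≤ a h₂ ⟩
    a + (B + q) ≡⟨ sym (+-assoc a B q) ⟩
    a + B + q   ∎)
    where
    open ≤-Reasoning
    open +-*-Solver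

  median-separates : ∀ zs → ∃[ c ] ∀ zs′ → Unique zs′ → zs′ ⊆ zs → ∀ z₀ → ¬ Disk c z₀ →
    (∀ {z} → z ∈ zs′ → ∃[ k ] Path (Outside c) z₀ z k) → 2 * length zs′ ≤ length zs
  median-separates zs with c , min ← argmin (λ v → sum (map (d v) zs)) = c , bound
    where
    bound : ∀ zs′ → Unique zs′ → zs′ ⊆ zs → ∀ z₀ → ¬ Disk c z₀ →
      (∀ {z} → z ∈ zs′ → ∃[ k ] Path (Outside c) z₀ z k) → 2 * length zs′ ≤ length zs
    bound zs′ un sub z₀ z₀∉ reach
      with u , cu , _ , q ← first-step (outside-≢ z₀∉)
         | ws , p ← complement un sub = begin
      length zs′ + (length zs′ + 0) ≤⟨ +-monoʳ-≤ (length zs′) (≤-trans (≤-reflexive (+-identityʳ _)) smaller) ⟩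
      length zs′ + length ws        ≡⟨ sym (length-++ zs′) ⟩
      length (zs′ ++ ws)            ≡⟨ sym (↭.↭-length p) ⟩
      length zs                     ∎
      where
      open ≤-Reasoning
      smaller : length zs′ ≤ length ws
      smaller = cancel (sum-closer zs′ λ z∈ → closer z₀∉ cu q (proj₂ (reach z∈)))
        (sum-farther ws cu)
        (subst₂ _≤_ (sum-++-↭ c zs′ p) (sum-++-↭ u zs′ p) (min u))

-- Contractions

-- Labelled arcs: the label is the index of the edge of G an arc comes from.
Arcs : Set₁
Arcs = ℕ → ℕ → ℕ → Set

∥_∥ : Arcs → ℕ → ℕ → Set
∥ κ ∥ a b = ∃[ e ] κ a b e

_↾_ : Arcs → (ℕ → Set) → ℕ → ℕ → Set
(κ ↾ H) a b = ∃[ e ] κ a b e × H e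

Ball : Arcs → ℕ → ℕ → ℕ → Set
Ball κ c ρ v = Path≤ ∥ κ ∥ c v ρ

OffBall : Arcs → ℕ → ℕ → ℕ → ℕ → Set
OffBall κ c ρ a b = ∥ κ ∥ a b × ¬ Ball κ c ρ b

-- Components are not formed as sets: any list of different vertices of `Z` that are reachable from
-- one `z₀` off the ball stands for a piece of a component. Vertices outside `Z`, contracted ones in
-- particular, do not count.
Balanced : Arcs → List ℕ → ℕ → ℕ → Set
Balanced κ Z c ρ = ∀ zs z₀ → Unique zs → zs ⊆ Z → ¬ Ball κ c ρ z₀ →
  (∀ {z} → z ∈ zs → ∃[ k ] Path (OffBall κ c ρ) z₀ z k) → 2 * length zs ≤ length Z

-- What can be reached off the larger ball can be reached off the smaller one. Read backwards, a
-- center that fails at some radius fails at all smaller ones, on which the search for the disk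
-- relies.
balanced-mono : ∀ {κ Z c ρ ρ′} → ρ ≤ ρ′ → Balanced κ Z c ρ → Balanced κ Z c ρ′
balanced-mono ρ≤ bal zs z₀ un sub z₀∉ reach = bal zs z₀ un sub (z₀∉ ∘ weaken ρ≤)
  λ z∈ → let _ , p = reach z∈ in
         _ , mapPath (λ { (e , b∉) → e , b∉ ∘ weaken ρ≤ }) p

-- A component of a contraction of G.  Vertices below n are vertices of G, the
-- others stand for contracted parts of G.
record Node (n r : ℕ) : Set₁ where
  field
    rep       : ℕ
    verts     : List ℕ
    κ         : Arcs
    κ-sym     : ∀ {a b e} → κ a b e → κ b a e
    κ-in      : ∀ {a b e} → κ a b e → a ∈ verts × b ∈ verts
    uniq      : Unique verts
    rep∈      : rep ∈ verts
    connected : ∀ {v} → v ∈ verts → ∃[ k ] Path ∥ κ ∥ rep v k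
    separable : ∀ Z → Z ⊆ verts → All (_< n) Z → ∃[ c ] c ∈ verts × Balanced κ Z c r

  size : ℕ
  size = length (nonmetas n verts)

  ∥κ∥-sym : ∀ {a b} → ∥ κ ∥ a b → ∥ κ ∥ b a
  ∥κ∥-sym (_ , e) = _ , κ-sym e

  ↾-sym : ∀ {H a b} → (κ ↾ H) a b → (κ ↾ H) b a
  ↾-sym (_ , e , h) = _ , κ-sym e , h

  path-end : ∀ {a b k} → a ∈ verts → Path ∥ κ ∥ a b k → b ∈ verts
  path-end a∈ ε             = a∈
  path-end a∈ ((_ , e) ◅ p) = path-end (proj₂ (κ-in e)) p

  linked : ∀ {a b} → a ∈ verts → b ∈ verts → ∃[ k ] Path ∥ κ ∥ a b k
  linked a∈ b∈ = _ , reversePath ∥κ∥-sym (proj₂ (connected a∈)) ◅◅ proj₂ (connected b∈)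

module _ {A : Set} {R : A → A → Set} {D : A → Set} (D? : ∀ a → Dec (D a)) where

  meets : ∀ {x y k} → Path R x y k →
    (¬ D x × Path (λ a b → R a b × ¬ D b) x y k) ⊎
    ∃[ w ] ∃[ i ] ∃[ j ] i + j ≡ k × D w × Path R x w i × Path R w y j
  meets {x} p with D? x
  meets     p       | yes d = inj₂ (_ , 0 , _ , refl , d , ε , p)
  meets     ε       | no ¬d = inj₁ (¬d , ε)
  meets     (e ◅ p) | no ¬d with meets p
  ... | inj₁ (¬d′ , q)                = inj₁ (¬d , (e , ¬d′) ◅ q)
  ... | inj₂ (w , i , j , eq , d , q) = inj₂ (w , suc i , j , cong suc eq , d , e ◅ proj₁ q , proj₂ q)

-- The child of a node for the component C of the complement of a disk around o:
-- everything outside C is contracted to the new vertex M.  Labels: 1 on the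
-- disk, 1 + M on C.
module Child {n r : ℕ} (ν : Node n r) (o ρ : ℕ) (lab : ℕ → ℕ) (M : ℕ) (C : List ℕ)
  (o∈      : o ∈ Node.verts ν)
  (disk    : ∀ {v} → v ∈ Node.verts ν → lab v ≡ 1 → Ball (Node.κ ν) o ρ v)
  (disk⁻   : ∀ {v} → Ball (Node.κ ν) o ρ v → lab v ≡ 1)
  (closed  : ∀ {a b e} → Node.κ ν a b e → lab a ≢ 1 → lab b ≢ 1 → lab a ≡ lab b)
  (C⊆      : ∀ {v} → v ∈ C → v ∈ Node.verts ν × lab v ≡ suc M)
  (⊆C      : ∀ {v} → v ∈ Node.verts ν → lab v ≡ suc M → v ∈ C)
  (C-uniq  : Unique C)
  (M≢0     : M ≢ 0)
  (n≤M     : n ≤ M)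
  (M∉      : M ∉ Node.verts ν)
  where
  open Node ν

  private
    D = λ v → lab v ≡ 1

    C≢D : ∀ {v} → v ∈ C → ¬ D v
    C≢D v∈ d = M≢0 (suc-injective (trans (sym (proj₂ (C⊆ v∈))) d))

    M∉C : M ∉ C
    M∉C = M∉ ∘ proj₁ ∘ C⊆

    ∈C? : ∀ v → Dec (lab v ≡ suc M)
    ∈C? v = lab v ≟ suc M

  data κ′ : ℕ → ℕ → ℕ → Set where
    inside : ∀ {a b e} → κ a b e → a ∈ C → b ∈ C → κ′ a b e
    enter  : ∀ {a d e} → κ a d e → a ∈ C → D d → κ′ a M e
    leave  : ∀ {d b e} → κ d b e → D d → b ∈ C → κ′ M b e

  κ′-sym : ∀ {a b e} → κ′ a b e → κ′ b a e
  κ′-sym (inside e a∈ b∈) = inside (κ-sym e) b∈ a∈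
  κ′-sym (enter e a∈ d)   = leave (κ-sym e) d a∈
  κ′-sym (leave e d b∈)   = enter (κ-sym e) b∈ d

  κ′-in : ∀ {a b e} → κ′ a b e → a ∈ M ∷ C × b ∈ M ∷ C
  κ′-in (inside e a∈ b∈) = there a∈ , there b∈
  κ′-in (enter e a∈ d)   = there a∈ , here refl
  κ′-in (leave e d b∈)   = here refl , there b∈

  C-next : ∀ {a b e} → a ∈ C → κ a b e → ¬ D b → b ∈ C
  C-next a∈ e ¬d = ⊆C (proj₂ (κ-in e))
    (trans (sym (closed e (C≢D a∈) ¬d)) (proj₂ (C⊆ a∈)))

  o-disk : D o
  o-disk = disk⁻ (0 , z≤n , ε)

  Rest : ℕ → ℕ → Set
  Rest a b = ∥ κ ∥ a b × b ∉ C

  -- A walk from `o` of length at most `ρ` stays in the disk, which is disjoint from `C`. The first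
  -- walk is the stretch already covered; it certifies that the next vertex is in the disk.
  ball-rest : ∀ {x a i j} → Path ∥ κ ∥ o x i → Path ∥ κ ∥ x a j → i + j ≤ ρ → Path Rest x a j
  ball-rest p ε le = ε
  ball-rest {i = i} p (_◅_ {k = j} e q) le =
    (e , λ b∈ → C≢D b∈ (disk⁻ (_ , ≤-trans (s≤s (m≤m+n i j)) le′ , p ▻ e))) ◅ ball-rest (p ▻ e) q le′
    where le′ = ≤-trans (≤-reflexive (sym (+-suc i j))) le

  -- The complement of a component is connected, which justifies contracting it to a single vertex.
  -- A walk to `o` cannot enter `C` before it meets the disk, as `C` has no other neighbours; from
  -- the first vertex in the disk on, a radius leads to `o`.
  rest→o : ∀ {a k} → a ∈ verts → a ∉ C → Path ∥ κ ∥ a o k → ∃[ j ] Path Rest a o j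
  rest→o {a} a∈ a∉ p with lab a ≟ 1
  rest→o {a} a∈ a∉ p | yes d with _ , le , q ← disk a∈ d =
    _ , reverse-rest (λ b∈ → C≢D b∈ o-disk) (ball-rest ε q le)
    where
    reverse-rest : ∀ {x y k} → x ∉ C → Path Rest x y k → Path Rest y x k
    reverse-rest x∉ ε                = ε
    reverse-rest x∉ ((e , y∉) ◅ p) = reverse-rest y∉ p ▻ (∥κ∥-sym e , x∉)
  rest→o a∈ a∉ ε | no ¬d = contradiction o-disk ¬d
  rest→o a∈ a∉ (_◅_ {y = b} (_ , e) p) | no ¬d =
    let _ , q = rest→o (proj₂ (κ-in e)) b∉ p in _ , ((_ , e) , b∉) ◅ q
    where
    b∉ : b ∉ C
    b∉ b∈ = a∉ (C-next b∈ (κ-sym e) ¬d)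

  data Rep : ℕ → ℕ → Set where
    stays : ∀ {a} → a ∈ C → Rep a a
    out   : ∀ {a} → a ∈ verts → a ∉ C → Rep M a

  rep-of : ∀ {a} → a ∈ verts → ∃[ a′ ] Rep a′ a × a′ ∈ M ∷ C
  rep-of {a} a∈ with ∈C? a
  ... | yes eq = _ , stays (⊆C a∈ eq) , there (⊆C a∈ eq)
  ... | no neq = _ , out a∈ (neq ∘ proj₂ ∘ C⊆) , here refl

  out-next : ∀ {a b e} → a ∈ C → b ∉ C → κ a b e → D b
  out-next {b = b} a∈ b∉ e with lab b ≟ 1
  ... | yes d = d
  ... | no ¬d = contradiction (C-next a∈ e ¬d) b∉

  contract-arc : ∀ {a b a′ b′ e} → Rep a′ a → Rep b′ b → κ a b e → a′ ≡ b′ ⊎ κ′ a′ b′ e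
  contract-arc (stays a∈) (stays b∈)  e = inj₂ (inside e a∈ b∈)
  contract-arc (stays a∈) (out _ b∉)  e = inj₂ (enter e a∈ (out-next a∈ b∉ e))
  contract-arc (out _ a∉) (stays b∈)  e = inj₂ (leave e (out-next b∈ a∉ (κ-sym e)) b∈)
  contract-arc (out _ _)  (out _ _)   e = inj₁ refl

  rep-unique : ∀ {a a′ a″} → Rep a′ a → Rep a″ a → a′ ≡ a″
  rep-unique (stays _)  (stays _)  = refl
  rep-unique (stays a∈) (out _ a∉) = contradiction a∈ a∉
  rep-unique (out _ a∉) (stays a∈) = contradiction a∈ a∉
  rep-unique (out _ _)  (out _ _)  = refl

  -- Arcs between two contracted vertices vanish, so walks can only become shorter. Hence the ball
  -- of a child contains the image of the ball with the same radius in its parent.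
  contract : ∀ {a b a′ b′ k} → Rep a′ a → Rep b′ b → Path ∥ κ ∥ a b k → Path≤ ∥ κ′ ∥ a′ b′ k
  contract ra rb ε with refl ← rep-unique ra rb = 0 , z≤n , ε
  contract ra rb ((_ , e) ◅ p) with x′ , rx , _ ← rep-of (proj₂ (κ-in e)) with contract-arc ra rx e | contract rx rb p
  ... | inj₁ refl | j , le , q = j , m≤n⇒m≤1+n le , q
  ... | inj₂ e′   | j , le , q = suc j , s≤s le , (_ , e′) ◅ q

  expand-arc : ∀ {a′ b′ e} → κ′ a′ b′ e → ∃[ a ] ∃[ b ] Rep a′ a × Rep b′ b × κ a b e
  expand-arc (inside e a∈ b∈) = _ , _ , stays a∈ , stays b∈ , e
  expand-arc (enter e a∈ d)   = _ , _ , stays a∈ , out (proj₂ (κ-in e)) (λ b∈ → C≢D b∈ d) , e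
  expand-arc (leave e d b∈)   = _ , _ , out (proj₁ (κ-in e)) (λ a∈ → C≢D a∈ d) , stays b∈ , e

  module _ {c c′ ρ′ : ℕ} (rc : Rep c′ c) where

    off-ball : ∀ {a a′} → Rep a′ a → ¬ Ball κ′ c′ ρ′ a′ → ¬ Ball κ c ρ′ a
    off-ball ra a∉ (_ , le , p) = a∉ (weaken le (contract rc ra p))

    -- Two vertices contracted to `M` are joined through `o` outside `C`. Every vertex of this walk
    -- is represented by `M`, so it is off the ball when `M` is.
    within-rep : ∀ {a b a′} → ¬ Ball κ′ c′ ρ′ a′ → Rep a′ a → Rep a′ b → ∃[ k ] Path (OffBall κ c ρ′) a b k
    within-rep a∉ (stays _)  (stays _)  = _ , ε
    within-rep a∉ (stays a∈) (out _ _)  = contradiction a∈ M∉C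
    within-rep a∉ (out _ _)  (stays b∈) = contradiction b∈ M∉C
    within-rep {a} {b} a∉ (out a∈ a∉C) (out b∈ b∉C) =
      _ , mapPath off to ◅◅ reverse-off (off-ball (out b∈ b∉C) a∉) (mapPath off from)
      where
      to   = proj₂ (rest→o a∈ a∉C (proj₂ (linked a∈ o∈)))
      from = proj₂ (rest→o b∈ b∉C (proj₂ (linked b∈ o∈)))
      off : ∀ {x y} → Rest x y → OffBall κ c ρ′ x y
      off ((_ , e) , y∉) = (_ , e) , off-ball (out (proj₂ (κ-in e)) y∉) a∉
      reverse-off : ∀ {x y k} → ¬ Ball κ c ρ′ x → Path (OffBall κ c ρ′) x y k → Path (OffBall κ c ρ′) y x k
      reverse-off x∉ ε              = ε
      reverse-off x∉ ((e , y∉) ◅ p) = reverse-off y∉ p ▻ (∥κ∥-sym e , x∉)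

    -- Arcs lift one by one, but two arcs that meet at `M` need not meet in the parent; `within-rep`
    -- bridges the gap without entering the ball.
    expand-off : ∀ {a b a′ b′ k} → ¬ Ball κ′ c′ ρ′ a′ → Rep a′ a → Rep b′ b →
      Path (OffBall κ′ c′ ρ′) a′ b′ k → ∃[ j ] Path (OffBall κ c ρ′) a b j
    expand-off a∉ ra rb ε = within-rep a∉ ra rb
    expand-off a∉ ra rb (((_ , e′) , x∉) ◅ p)
      with _ , _ , ra₁ , rx , e ← expand-arc e′ =
      _ , proj₂ (within-rep a∉ ra ra₁) ◅◅ ((_ , e) , off-ball rx x∉) ◅ proj₂ (expand-off x∉ rx rb p)

  private
    C-only : ∀ {Z} → Z ⊆ M ∷ C → All (_< n) Z → Z ⊆ C
    C-only sub small z∈ with sub z∈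
    ... | here refl = contradiction (All.lookup small z∈) (≤⇒≯ n≤M)
    ... | there z∈C = z∈C

    start∈ : ∀ {c s a b k} → b ∈ C → Path (OffBall κ′ c s) a b k → a ∈ M ∷ C
    start∈ b∈ ε                   = there b∈
    start∈ b∈ (((_ , e) , _) ◅ _) = proj₁ (κ′-in e)

    rep-back : ∀ {a′} → a′ ∈ M ∷ C → ∃[ a ] Rep a′ a
    rep-back (here refl) = o , out o∈ λ o∈C → C≢D o∈C o-disk
    rep-back (there a∈)  = _ , stays a∈

  child-connected : ∀ {v} → v ∈ M ∷ C → ∃[ k ] Path ∥ κ′ ∥ M v k
  child-connected (here refl) = _ , ε
  child-connected (there v∈) =
    _ , reversePath (λ { (_ , e) → _ , κ′-sym e }) (proj₂ (go v∈ (proj₂ (linked (proj₁ (C⊆ v∈)) o∈))))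
    where
    go : ∀ {v k} → v ∈ C → Path ∥ κ ∥ v o k → ∃[ j ] Path ∥ κ′ ∥ v M j
    go v∈ ε = contradiction o-disk (C≢D v∈)
    go v∈ (_◅_ {y = b} (_ , e) p) with lab b ≟ 1
    ... | yes d = _ , (_ , enter e v∈ d) ◅ ε
    ... | no ¬d = let b∈ = C-next v∈ e ¬d in _ , (_ , inside e v∈ b∈) ◅ proj₂ (go b∈ p)

  -- The center that the parent has for the same `Z` is taken, or `M` if it has been contracted. As
  -- `Z` consists of vertices of `C` only, the induction requires separability for all subsets of
  -- the original vertices.
  child-separable : ∀ Z → Z ⊆ M ∷ C → All (_< n) Z → ∃[ c ] c ∈ M ∷ C × Balanced κ′ Z c r
  child-separable Z sub small
    with c , c∈ , bal ← separable Z (proj₁ ∘ C⊆ ∘ C-only sub small) small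
    with c′ , rc , c′∈ ← rep-of c∈ = c′ , c′∈ , bal′
    where
    bal′ : Balanced κ′ Z c′ r
    bal′ []         z₀ _  _   _   _     = z≤n
    bal′ zs@(_ ∷ _) z₀ un zs⊆ z₀∉ reach
      with _ , rz₀ ← rep-back (start∈ (C-only sub small (zs⊆ (here refl))) (proj₂ (reach (here refl)))) =
      bal zs _ un zs⊆ (off-ball rc rz₀ z₀∉)
        λ z∈ → expand-off rc z₀∉ rz₀ (stays (C-only sub small (zs⊆ z∈))) (proj₂ (reach z∈))

  child : Node n r
  child = record
    { rep = M ; verts = M ∷ C ; κ = κ′ ; κ-sym = κ′-sym ; κ-in = κ′-in
    ; uniq = All.tabulate (λ { v∈ refl → M∉C v∈ }) ∷ C-uniq
    ; rep∈ = here refl ; connected = child-connected ; separable = child-separable }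

  child-size : Node.size child ≡ length (nonmetas n C)
  child-size = cong length (filter-reject (_<? n) (≤⇒≯ n≤M))

  -- A walk that uses M is cut at its first and last visit of M; the disk around
  -- o bridges the gap.
  module _ {H : ℕ → Set} where
    mutual
      exit : ∀ {y ℓ} → y ∈ C → Path (κ′ ↾ H) M y ℓ →
        ∃[ d ] ∃[ q ] q ≤ ℓ × d ∈ verts × D d × Path (κ ↾ H) d y q
      exit y∈ ε                               = contradiction y∈ M∉C
      exit y∈ ((_ , inside e M∈ _ , _) ◅ _)   = contradiction M∈ M∉C
      exit y∈ ((_ , enter e M∈ _ , _) ◅ _)    = contradiction M∈ M∉C
      exit y∈ ((_ , leave e d b∈ , h) ◅ p) with expand b∈ y∈ p
      ... | inj₁ q = _ , _ , ≤-refl , proj₁ (κ-in e) , d , (_ , e , h) ◅ q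
      ... | inj₂ (_ , d′ , p₁ , q₁ , le , _ , _ , d′∈ , dd′ , _ , q) =
        _ , _ , m≤n⇒m≤1+n (≤-trans (m≤n+m q₁ p₁) le) , d′∈ , dd′ , q

      expand : ∀ {x y ℓ} → x ∈ C → y ∈ C → Path (κ′ ↾ H) x y ℓ →
        Path (κ ↾ H) x y ℓ ⊎
        ∃[ d ] ∃[ d′ ] ∃[ p ] ∃[ q ] p + q ≤ ℓ × d ∈ verts × D d × d′ ∈ verts × D d′ ×
          Path (κ ↾ H) x d p × Path (κ ↾ H) d′ y q
      expand x∈ y∈ ε = inj₁ ε
      expand x∈ y∈ ((_ , leave _ _ _ , _) ◅ _) = contradiction x∈ M∉C
      expand x∈ y∈ ((_ , enter e _ d , h) ◅ p) with d′ , q , le , d′∈ , dd′ , t ← exit y∈ p =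
        inj₂ (_ , d′ , 1 , q , s≤s le , proj₂ (κ-in e) , d , d′∈ , dd′ , (_ , e , h) ◅ ε , t)
      expand x∈ y∈ ((_ , inside e _ b∈ , h) ◅ p) with expand b∈ y∈ p
      ... | inj₁ q = inj₁ ((_ , e , h) ◅ q)
      ... | inj₂ (d , d′ , p₁ , q₁ , le , d∈ , dd , d′∈ , dd′ , s , t) =
        inj₂ (d , d′ , suc p₁ , q₁ , s≤s le , d∈ , dd , d′∈ , dd′ , (_ , e , h) ◅ s , t)

    expand≤ : (∀ {v} → v ∈ verts → D v → Path≤ (κ ↾ H) o v ρ) →
              ∀ {x y ℓ} → x ∈ C → y ∈ C → Path (κ′ ↾ H) x y ℓ → Path≤ (κ ↾ H) x y (ℓ + 2 * ρ)
    expand≤ tree {ℓ = ℓ} x∈ y∈ p with expand x∈ y∈ p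
    ... | inj₁ q = weaken (m≤m+n ℓ _) (exactly q)
    ... | inj₂ (d , d′ , p₁ , q₁ , le , d∈ , dd , d′∈ , dd′ , s , t) =
      weaken bound (exactly s ◅◅≤ reversePath≤ ↾-sym (tree d∈ dd) ◅◅≤ tree d′∈ dd′ ◅◅≤ exactly t)
      where
      bound : p₁ + (ρ + (ρ + q₁)) ≤ ℓ + 2 * ρ
      bound = ≤-trans (≤-reflexive
        (solve 3 (λ p q s → p :+ (s :+ (s :+ q)) := (p :+ q) :+ con 2 :* s) refl p₁ q₁ ρ))
        (+-monoˡ-≤ (2 * ρ) le)
        where open +-*-Solver

  -- Without passing the disk a walk cannot leave the component, so the contraction does not affect
  -- it.
  alive-child : ∀ {x y k} → x ∈ C →
    Path (λ a b → (∥ κ ∥ a b × b < n) × ¬ D b) x y k →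
    Path (λ a b → ∥ κ′ ∥ a b × b < n) x y k
  alive-child x∈ ε = ε
  alive-child x∈ ((((_ , e) , b<n) , ¬d) ◅ p) =
    let b∈ = C-next x∈ e ¬d in ((_ , inside e x∈ b∈) , b<n) ◅ alive-child b∈ p

-- Budgeted execution of programs

-- Computed from the program text, so that the frame conditions of concrete programs are settled by
-- evaluation and proved by `tt`.
keeps : Program → ℕ → Bool
keeps skip               a = true
keeps (b [ _ ]≔ _)       a = not (a ≡ᵇ b)
keeps (p ⨾ q)            a = keeps p a ∧ keeps q a
keeps (if _ run p else q) a = keeps p a ∧ keeps q a
keeps (while _ run p)    a = keeps p a

T-∧ : ∀ {x y} → T (x ∧ y) → T x × T y
T-∧ {true} {true} _ = tt , tt

frame : ∀ {p σ τ k a} → ⟨ p , σ ⟩⇓⟨ τ , k ⟩ → T (keeps p a) → ∀ i → τ a i ≡ σ a i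
frame ⇓skip           _  i = refl
frame {σ = σ} {a = a} (⇓assign {a = b} {e} {f}) kp i = go (a ≡ᵇ b) kp
  where
  go : ∀ t → T (not t) → (if t ∧ does (i ≟ ⟦ e ⟧ σ) then ⟦ f ⟧ σ else σ a i) ≡ σ a i
  go false _ = refl
frame (⇓seq r s)      kp i = let kp₁ , kp₂ = T-∧ kp in trans (frame s kp₂ i) (frame r kp₁ i)
frame (⇓then _ r)     kp i = frame r (proj₁ (T-∧ kp)) i
frame {p = if _ run p else q} (⇓else _ r) kp i = frame r (proj₂ (T-∧ {keeps p _} kp)) i
frame (⇓stop _)       kp i = refl
frame (⇓loop _ r s)   kp i = trans (frame s kp i) (frame r kp i)

_∈ᵇ_ : ℕ → List ℕ → Bool
a ∈ᵇ []       = false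
a ∈ᵇ (b ∷ bs) = (a ≡ᵇ b) ∨ (a ∈ᵇ bs)

keepsAll : Program → List ℕ → Bool
keepsAll p []       = true
keepsAll p (a ∷ as) = keeps p a ∧ keepsAll p as

_≈[_]_ : Memory → List ℕ → Memory → Set
σ ≈[ as ] τ = ∀ a → T (a ∈ᵇ as) → ∀ i → σ a i ≡ τ a i

≈-refl : ∀ {as σ} → σ ≈[ as ] σ
≈-refl a _ i = refl

≈-trans : ∀ {as σ τ υ} → σ ≈[ as ] τ → τ ≈[ as ] υ → σ ≈[ as ] υ
≈-trans r s a a∈ i = trans (r a a∈ i) (s a a∈ i)

keepsAll-∈ : ∀ p as a → T (keepsAll p as) → T (a ∈ᵇ as) → T (keeps p a)
keepsAll-∈ p (b ∷ as) a kp a∈ with T-∧ {keeps p b} kp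
... | kb , kas with a ≡ᵇ b in eq
...   | false = keepsAll-∈ p as a kas a∈
...   | true rewrite ≡ᵇ⇒≡ a b (subst T (sym eq) tt) = kb

-- The budget b covers the running time and what is left for the postcondition.
record Runs {ℓ} (p : Program) (σ : Memory) (b : ℕ) (P : Memory → ℕ → Set ℓ) : Set ℓ where
  constructor runs
  field
    {final}     : Memory
    {time left} : ℕ
    trace       : ⟨ p , σ ⟩⇓⟨ final , time ⟩
    fits        : time + left ≤ b
    post        : P final left

module _ {ℓ} {P : Memory → ℕ → Set ℓ} where

  R-≤ : ∀ {p σ b b′} → b ≤ b′ → Runs p σ b P → Runs p σ b′ P
  R-≤ le (runs t f q) = runs t (≤-trans f le) q

  R-map : ∀ {ℓ′} {Q : Memory → ℕ → Set ℓ′} {p σ b} → (∀ {τ b′} → P τ b′ → Q τ b′) → Runs p σ b P → Runs p σ b Q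
  R-map h (runs t f q) = runs t f (h q)

  R-frame : ∀ {p σ b} as → T (keepsAll p as) → Runs p σ b P → Runs p σ b (λ τ b′ → P τ b′ × τ ≈[ as ] σ)
  R-frame as kp (runs t f q) = runs t f (q , λ a a∈ → frame t (keepsAll-∈ _ as a kp a∈))

  -- The frame rule for time: units set aside survive the run, so a budget can be divided between a
  -- program and its continuation.
  R-spare : ∀ {p σ b} d → Runs p σ b P → Runs p σ (d + b) (λ τ b′ → ∃[ b₀ ] b′ ≡ d + b₀ × P τ b₀)
  R-spare {b = b} d (runs {time = k} {l} t f q) = runs t
    (≤-trans (≤-reflexive (solve 3 (λ k d l → k :+ (d :+ l) := d :+ (k :+ l)) refl k d l)) (+-monoʳ-≤ d f)) (l , refl , q)
    where open +-*-Solver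

  R-seq : ∀ {ℓ′} {Q : Memory → ℕ → Set ℓ′} {p q σ b} →
          Runs p σ b P → (∀ {τ b′} → P τ b′ → Runs q τ b′ Q) → Runs (p ⨾ q) σ b Q
  R-seq (runs {time = k} t f x) h with runs {time = j} {l} u g y ← h x =
    runs (⇓seq t u) (≤-trans (≤-reflexive (+-assoc k j l)) (≤-trans (+-monoʳ-≤ k g) f)) y

  R-assign : ∀ {a e f σ b} → P (update σ a (⟦ e ⟧ σ) (⟦ f ⟧ σ)) b →
             Runs (a [ e ]≔ f) σ (suc (cost e + cost f) + b) P
  R-assign x = runs ⇓assign ≤-refl x

  R-skip : ∀ {σ b} → P σ b → Runs skip σ (1 + b) P
  R-skip x = runs ⇓skip ≤-refl x

  R-if : ∀ {e p q σ b} → (⟦ e ⟧ σ ≢ 0 → Runs p σ b P) → (⟦ e ⟧ σ ≡ 0 → Runs q σ b P) →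
         Runs (if e run p else q) σ (suc (cost e) + b) P
  R-if {e} {σ = σ} h₁ h₀ with ⟦ e ⟧ σ ≟ 0
  ... | yes z with runs {time = k} {l} t f x ← h₀ z =
    runs (⇓else z t) (s≤s (≤-trans (≤-reflexive (+-assoc (cost e) k l)) (+-monoʳ-≤ (cost e) f))) x
  ... | no nz with runs {time = k} {l} t f x ← h₁ nz =
    runs (⇓then nz t) (s≤s (≤-trans (≤-reflexive (+-assoc (cost e) k l)) (+-monoʳ-≤ (cost e) f))) x

R-then : ∀ {ℓ} {P : Memory → ℕ → Set ℓ} {a e f q σ b} →
         Runs q (update σ a (⟦ e ⟧ σ) (⟦ f ⟧ σ)) b P →
         Runs ((a [ e ]≔ f) ⨾ q) σ (suc (cost e + cost f) + b) P
R-then {e = e} {f} (runs {time = k} {l} t g x) =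
  runs (⇓seq ⇓assign t) (s≤s (≤-trans (≤-reflexive (+-assoc (cost e + cost f) k l)) (+-monoʳ-≤ (cost e + cost f) g))) x

R-then-at : ∀ {ℓ} {P : Memory → ℕ → Set ℓ} {a e f q σ b} i x → ⟦ e ⟧ σ ≡ i → ⟦ f ⟧ σ ≡ x →
            Runs q (update σ a i x) b P →
            Runs ((a [ e ]≔ f) ⨾ q) σ (suc (cost e + cost f) + b) P
R-then-at _ _ refl refl = R-then

R-assign-at : ∀ {ℓ} {P : Memory → ℕ → Set ℓ} {a e f σ b} i x → ⟦ e ⟧ σ ≡ i → ⟦ f ⟧ σ ≡ x →
              P (update σ a i x) b → Runs (a [ e ]≔ f) σ (suc (cost e + cost f) + b) P
R-assign-at _ _ refl refl = R-assign

-- Every round takes at least one unit from the budget, which bounds the number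
-- of rounds.
R-while : ∀ {ℓ ℓ′} {P : Memory → ℕ → Set ℓ′} {e p} (I : Memory → ℕ → Set ℓ) →
  (∀ {σ b} → I σ b → ∃[ b₀ ] suc (cost e) + b₀ ≤ b ×
     (⟦ e ⟧ σ ≡ 0 → P σ b₀) × (⟦ e ⟧ σ ≢ 0 → Runs p σ b₀ I)) →
  ∀ {σ b} → I σ b → Runs (while e run p) σ b P
R-while {P = P} {e} {p} I step {b = b} = go b ≤-refl
  where
  go : ∀ m {σ b} → b ≤ m → I σ b → Runs (while e run p) σ b P
  go m {σ} b≤ i with step i
  ... | b₀ , le , stop , body with ⟦ e ⟧ σ ≟ 0
  ...   | yes z = runs (⇓stop z) le (stop z)
  ...   | no nz with body nz | m
  ...     | _ | zero with () ← ≤-trans le b≤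
  ...     | runs {time = k} {l} t f i′ | suc m
    with runs {time = k′} {l′} t′ f′ x ← go m (≤-trans (≤-trans (m≤n+m l k) f) (≤-trans (m≤n+m b₀ (cost e)) (s≤s⁻¹ (≤-trans le b≤)))) i′ =
    runs (⇓loop nz t t′) (≤-trans (s≤s (begin
      cost e + (k + k′) + l′   ≡⟨ +-assoc (cost e) (k + k′) l′ ⟩
      cost e + (k + k′ + l′)   ≡⟨ cong (cost e +_) (+-assoc k k′ l′) ⟩
      cost e + (k + (k′ + l′)) ≤⟨ +-monoʳ-≤ (cost e) (+-monoʳ-≤ k f′) ⟩
      cost e + (k + l)         ≤⟨ +-monoʳ-≤ (cost e) f ⟩
      cost e + b₀              ∎)) le) x
    where open ≤-Reasoning

cell : ℕ → Exp
cell a = a [ lit 0 ]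

for : ℕ → Exp → Program → Program
for a e p = (a [ lit 0 ]≔ lit 0) ⨾
  while (e ⊖ cell a) run (p ⨾ (a [ lit 0 ]≔ inc (cell a)))

test : Exp → ℕ
test e = 2 + (cost e + 2)

module _ {ℓ} {a : ℕ} {e : Exp} {p : Program} (J : ℕ → Memory → ℕ → Set ℓ) (M : ℕ)
  (bound : ∀ {i σ b} → J i σ b → ⟦ e ⟧ σ ≡ M)
  (step  : ∀ {i σ b} → i < M → σ a 0 ≡ i → J i σ b →
           Runs p σ b (λ τ b′ → τ a 0 ≡ i × J (suc i) (update τ a 0 (suc (τ a 0))) b′))
  where

  private
    I : Memory → ℕ → Set ℓ
    I σ b = ∃[ i ] ∃[ j ] ∃[ b₀ ] j + i ≡ M × b ≡ (j * (5 + test e) + test e) + b₀ × σ a 0 ≡ i × J i σ b₀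

    update-counter : ∀ σ x → update σ a 0 x a 0 ≡ x
    update-counter σ x with a ≡ᵇ a in eq
    ... | true  = refl
    ... | false = ⊥-elim (subst T eq (≡⇒≡ᵇ a a refl))

  -- `J` carries a budget of its own, so the rounds may draw on a common amount instead of having a
  -- fixed cost each. The remaining terms are 3 for the initialisation, 5 for every increment and
  -- `test e` for each of the `M` + 1 tests.
  R-for : ∀ {σ b} → J 0 (update σ a 0 0) b →
          Runs (for a e p) σ (3 + ((M * (5 + test e) + test e) + b)) (J M)
  R-for {σ} {b} j₀ = R-then {b = (M * (5 + test e) + test e) + b}
    (R-while I loop (0 , M , b , +-identityʳ M , refl , update-counter σ 0 , j₀))
    where
    loop : ∀ {σ b} → I σ b → ∃[ b₀ ] test e + b₀ ≤ b ×
      (⟦ e ⊖ cell a ⟧ σ ≡ 0 → J M σ b₀) ×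
      (⟦ e ⊖ cell a ⟧ σ ≢ 0 → Runs (p ⨾ (a [ lit 0 ]≔ inc (cell a))) σ b₀ I)
    loop {σ} (i , zero , b₀ , refl , refl , eq , x) = b₀ , ≤-refl , (λ _ → x) ,
      λ nz → contradiction (trans (cong₂ _∸_ (bound x) eq) (n∸n≡0 i)) nz
    loop {σ} (i , suc j , b₀ , refl , refl , eq , x) = 5 + ((j * (5 + test e) + test e) + b₀) ,
      ≤-reflexive (solve 3 (λ t j b → t :+ (con 5 :+ ((j :* (con 5 :+ t) :+ t) :+ b)) :=
        (con 5 :+ t :+ j :* (con 5 :+ t) :+ t) :+ b) refl (test e) j b₀) ,
      (λ z → contradiction z (subst (_≢ 0) (sym (trans (cong₂ _∸_ (bound x) eq) (m+n∸n≡m (suc j) i))) λ ())) ,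
      λ _ → R-seq (R-spare (5 + (j * (5 + test e) + test e)) (step (s≤s (m≤n+m i j)) eq x))
        λ { {τ} (b₁ , refl , eq′ , y) → R-assign
          (suc i , j , b₁ , +-suc j i , refl , trans (update-counter τ _) (cong suc eq′) , y) }
      where open +-*-Solver

module _ {ℓ} {a : ℕ} {e : Exp} {p : Program} (J : ℕ → Memory → Set ℓ) (M B : ℕ)
  (bound : ∀ {i σ} → J i σ → ⟦ e ⟧ σ ≡ M)
  (step  : ∀ {i σ} → i < M → σ a 0 ≡ i → J i σ →
           Runs p σ B (λ τ _ → τ a 0 ≡ i × J (suc i) (update τ a 0 (suc (τ a 0)))))
  where

  R-for′ : ∀ {σ} → J 0 (update σ a 0 0) →
           Runs (for a e p) σ (M * (5 + test e + B) + (3 + test e)) (λ τ _ → J M τ)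
  R-for′ j₀ = R-≤ (≤-reflexive
      (solve 3 (λ M t B → con 3 :+ ((M :* (con 5 :+ t) :+ t) :+ M :* B) :=
                          M :* (con 5 :+ t :+ B) :+ (con 3 :+ t)) refl M (test e) B))
    (R-map proj₁ (R-for (λ i σ b → J i σ × ∃[ j ] j + i ≡ M × j * B ≤ b) M (bound ∘ proj₁)
      (λ { i< eq (x , zero , refl , _) → contradiction i< (<-irrefl refl)
         ; {i} i< eq (x , suc j , refl , le) →
             R-map (λ { (_ , refl , eq′ , y) → eq′ , y , j , +-suc j i , m≤m+n _ _ })
               (R-≤ (≤-trans (≤-reflexive (+-comm (j * B) B)) le) (R-spare (j * B) (step i< eq x))) })
      (j₀ , M , +-identityʳ M , ≤-refl)))
    where open +-*-Solver

-- Arrays, list segments and linked lists in memory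

set : (ℕ → ℕ) → ℕ → ℕ → ℕ → ℕ
set f i x j = if does (j ≟ i) then x else f j

set-same : ∀ f i x {j} → j ≡ i → set f i x j ≡ x
set-same f i x {j} eq rewrite dec-true (j ≟ i) eq = refl

set-other : ∀ f i x {j} → j ≢ i → set f i x j ≡ f j
set-other f i x {j} neq rewrite dec-false (j ≟ i) neq = refl

data Seg (f : ℕ → ℕ) : ℕ → List ℕ → Set where
  []  : ∀ {s} → Seg f s []
  _∷_ : ∀ {s x xs} → f s ≡ x → Seg f (suc s) xs → Seg f s (x ∷ xs)

seg-map : ∀ {f g s xs} → (∀ i → i < s + length xs → g i ≡ f i) → Seg f s xs → Seg g s xs
seg-map h []                     = []
seg-map {s = s} h (_∷_ {xs = xs} eq seg) =
  trans (h s (m<m+n s z<s)) eq ∷ seg-map (λ i i< → h i (≤-trans i< (≤-reflexive (sym (+-suc s (length xs)))))) seg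

seg-snoc : ∀ {f s xs x} → Seg f s xs → f (s + length xs) ≡ x → Seg f s (xs ∷ʳ x)
seg-snoc {f} {s} [] eq = trans (cong f (sym (+-identityʳ s))) eq ∷ []
seg-snoc {f} {s} (_∷_ {xs = xs} eq′ seg) eq = eq′ ∷ seg-snoc seg (trans (cong f (sym (+-suc s (length xs)))) eq)

seg-++⁻ : ∀ {f s} xs {ys} → Seg f s (xs ++ ys) → Seg f (s + length xs) ys
seg-++⁻ {f} {s} [] {ys} seg = subst (λ i → Seg f i ys) (sym (+-identityʳ s)) seg
seg-++⁻ {f} {s} (x ∷ xs) {ys} (_ ∷ seg) = subst (λ i → Seg f i ys) (sym (+-suc s (length xs))) (seg-++⁻ xs seg)

seg-push : ∀ {f xs x} → Seg f 0 xs → Seg (set f (length xs) x) 0 (xs ∷ʳ x)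
seg-push {f} {xs} {x} seg = seg-snoc (seg-map (λ i i< → set-other f (length xs) x (<⇒≢ i<)) seg) (set-same f (length xs) x refl)

data Chain (next : ℕ → ℕ) : ℕ → List ℕ → Set where
  nil  : Chain next 0 []
  link : ∀ {p hs} → p ≢ 0 → Chain next (next p) hs → Chain next p (p ∷ hs)

chain-map : ∀ {f g p hs} → (∀ {h} → h ∈ hs → g h ≡ f h) → Chain f p hs → Chain g p hs
chain-map h nil         = nil
chain-map {g = g} h (link {p} nz c) = link nz (subst (λ q → Chain g q _) (sym (h (here refl))) (chain-map (h ∘ there) c))

R-seq′ : ∀ {ℓ ℓ′} {P : Memory → Set ℓ} {Q : Memory → ℕ → Set ℓ′} {p q σ c d} →
         Runs p σ c (λ τ _ → P τ) → (∀ {τ} → P τ → Runs q τ d Q) → Runs (p ⨾ q) σ (c + d) Q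
R-seq′ {c = c} {d} r h = R-≤ (≤-reflexive (+-comm d c))
  (R-seq (R-spare d r) λ { (_ , refl , x) → R-≤ (m≤m+n d _) (h x) })

-- Memory beyond the input is unconstrained, so arrays whose zeros carry meaning (visited marks,
-- heads of lists, marked edges) are zeroed first. Array 29 is reserved for this counter.
clear : ℕ → Exp → Program
clear a e = for 29 e (a [ cell 29 ]≔ lit 0)

module _ (a : ℕ) (e : Exp) (M : ℕ) (σ : Memory) (a≢ : a ≢ 29)
  (bound : ∀ {τ} → (∀ b → b ≢ a → b ≢ 29 → ∀ i → τ b i ≡ σ b i) → ⟦ e ⟧ τ ≡ M) where

  private
    elsewhere : ∀ τ b i x c j → c ≢ b → update τ b i x c j ≡ τ c j
    elsewhere τ b i x c j c≢b rewrite dec-false (c ≟ b) c≢b = refl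

    other-index : ∀ τ b i x c j → j ≢ i → update τ b i x c j ≡ τ c j
    other-index τ b i x c j j≢i rewrite dec-false (j ≟ i) j≢i with does (c ≟ b)
    ... | true  = refl
    ... | false = refl

    written : ∀ τ b i x j → j ≡ i → update τ b i x b j ≡ x
    written τ b i x j j≡i rewrite dec-true (b ≟ b) refl | dec-true (j ≟ i) j≡i = refl

    Zeros : ℕ → Memory → Set
    Zeros i τ = (∀ b → b ≢ a → b ≢ 29 → ∀ i → τ b i ≡ σ b i) × (∀ v → v < i → τ a v ≡ 0)

    zero-step : ∀ {i τ} → i < M → τ 29 0 ≡ i → Zeros i τ →
      Runs (a [ cell 29 ]≔ lit 0) τ 4 (λ υ _ → υ 29 0 ≡ i × Zeros (suc i) (update υ 29 0 (suc (υ 29 0))))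
    zero-step {i} {τ} i<M eq (same , zeros) = R-assign-at {b = 0} i 0 eq refl
      ( trans (elsewhere τ a i 0 29 0 (a≢ ∘ sym)) eq
      , (λ b b≢a b≢29 j → trans (elsewhere υ 29 0 (suc (υ 29 0)) b j b≢29) (trans (elsewhere τ a i 0 b j b≢a) (same b b≢a b≢29 j)))
      , λ v v< → trans (elsewhere υ 29 0 (suc (υ 29 0)) a v a≢) (value v v< (v ≟ i)))
      where
      υ = update τ a i 0
      value : ∀ v → v < suc i → Dec (v ≡ i) → υ a v ≡ 0
      value v v< (yes v≡i) = written τ a i 0 v v≡i
      value v v< (no v≢i)  = trans (other-index τ a i 0 a v v≢i) (zeros v (≤∧≢⇒< (s≤s⁻¹ v<) v≢i))

  clear-runs : Runs (clear a e) σ (M * (5 + test e + 4) + (3 + test e))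
                 (λ τ _ → ∀ v → v < M → τ a v ≡ 0)
  clear-runs = R-map proj₂ (R-for′ Zeros M 4 (bound ∘ proj₁) zero-step
    ((λ b _ b≢29 i → elsewhere σ 29 0 0 b i b≢29) , λ _ ()))

_⊆ᵇ_ : List ℕ → List ℕ → Bool
[]       ⊆ᵇ bs = true
(a ∷ as) ⊆ᵇ bs = (a ∈ᵇ bs) ∧ (as ⊆ᵇ bs)

≈-⊆ : ∀ {σ τ} as bs → T (as ⊆ᵇ bs) → σ ≈[ bs ] τ → σ ≈[ as ] τ
≈-⊆ {σ} {τ} (a ∷ as) bs sub r b b∈ i with b ≡ᵇ a in eq
... | true  = r b (subst (λ x → T (x ∈ᵇ bs)) (sym (≡ᵇ⇒≡ b a (subst T (sym eq) tt))) (proj₁ (T-∧ sub))) i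
... | false = ≈-⊆ {σ} {τ} as bs (proj₂ (T-∧ {a ∈ᵇ bs} sub)) r b b∈ i

≈-update : ∀ {σ τ i x} a as → T (not (a ∈ᵇ as)) → σ ≈[ as ] τ → update σ a i x ≈[ as ] τ
≈-update {σ} {τ} {i} {x} a as a∉ r b b∈ j = trans (go (b ≡ᵇ a) refl) (r b b∈ j)
  where
  go : ∀ t → (b ≡ᵇ a) ≡ t → (if t ∧ does (j ≟ i) then x else σ b j) ≡ σ b j
  go false _  = refl
  go true  eq = ⊥-elim (absurd (subst (λ c → T (c ∈ᵇ as)) (≡ᵇ⇒≡ b a (subst T (sym eq) tt)) b∈))
    where
    absurd : T (a ∈ᵇ as) → ⊥
    absurd a∈ with a ∈ᵇ as
    ... | true = a∉

-- Breadth-first search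

-- Arcs are numbered from 1, so that 0 ends the adjacency lists HEAD, NEXT.
SIZES ENDS₁ ENDS₂ SRC TGT LBL HEAD NEXT VIS QUEUE REM PAR NODE MARK : ℕ
SIZES = 0
ENDS₁ = 1
ENDS₂ = 2
SRC   = 3
TGT   = 4
LBL   = 5
HEAD  = 6
NEXT  = 7
VIS   = 8
QUEUE = 9
REM   = 10
PAR   = 11
NODE  = 12
MARK  = 13

names qhead qtail ptr colour count start limit arc : ℕ
names  = 20
qhead  = 21
qtail  = 22
ptr    = 23
colour = 24
count  = 25
start  = 26
limit  = 27
arc    = 28

infix 4 _:≔_
_:≔_ : ℕ → Exp → Program
a :≔ e = a [ lit 0 ]≔ e

-- The last line adds 1 to the counter exactly when the new vertex is below n.
discover : Program
discover =
  (VIS [ TGT [ cell arc ] ]≔ cell colour) ⨾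
  (QUEUE [ cell qtail ]≔ (TGT [ cell arc ])) ⨾
  (qtail :≔ inc (cell qtail)) ⨾
  (REM [ TGT [ cell arc ] ]≔ ((REM [ QUEUE [ cell qhead ] ]) ⊖ lit 1)) ⨾
  (PAR [ TGT [ cell arc ] ]≔ (LBL [ cell arc ])) ⨾
  (count :≔ (inc (cell count) ⊖ (lit 1 ⊖ (cell SIZES ⊖ (TGT [ cell arc ])))))

-- `ptr` runs through the arcs of the vertex at the head of the queue. `REM` holds the depth still
-- allowed below a vertex; when it is 0, `pop` leaves `ptr` at 0 and the vertex is not expanded,
-- which realises the radius.
scan pop explore launch search : Program
scan = (arc :≔ cell ptr) ⨾ (ptr :≔ NEXT [ cell ptr ]) ⨾
  if VIS [ TGT [ cell arc ] ] run skip else discover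
pop = (qhead :≔ inc (cell qhead)) ⨾
  if REM [ QUEUE [ cell qhead ] ] run (ptr :≔ HEAD [ QUEUE [ cell qhead ] ]) else skip
explore = while cell qtail ⊖ cell qhead run if cell ptr run scan else pop
launch =
  (VIS [ cell start ]≔ cell colour) ⨾
  (QUEUE [ lit 0 ]≔ cell start) ⨾
  (qhead :≔ lit 0) ⨾
  (qtail :≔ lit 1) ⨾
  (REM [ cell start ]≔ cell limit) ⨾
  (count :≔ (lit 1 ⊖ (lit 1 ⊖ (cell SIZES ⊖ cell start)))) ⨾
  if cell limit run (ptr :≔ HEAD [ cell start ]) else (ptr :≔ lit 0)
search = launch ⨾ explore

count-∷ʳ : ∀ n vs w c → c ≡ length (nonmetas n vs) →
  suc c ∸ (1 ∸ (n ∸ w)) ≡ length (nonmetas n (vs ∷ʳ w))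
count-∷ʳ n vs w c refl rewrite filter-++ (_<? n) vs (w ∷ []) | length-++ (nonmetas n vs) {nonmetas n (w ∷ [])} =
  helper (w <? n)
  where
  helper : Dec (w < n) → suc (length (nonmetas n vs)) ∸ (1 ∸ (n ∸ w)) ≡ length (nonmetas n vs) + length (nonmetas n (w ∷ []))
  helper (yes w<n) rewrite filter-accept (_<? n) {xs = []} w<n | m≤n⇒m∸n≡0 (m<n⇒0<n∸m w<n) = +-comm 1 _
  helper (no w≮n)  rewrite filter-reject (_<? n) {xs = []} w≮n | m≤n⇒m∸n≡0 (≮⇒≥ w≮n) = sym (+-identityʳ _)

chain-≢0 : ∀ {f p hs} → Chain f p hs → p ≢ 0 → ∃[ hs′ ] hs ≡ p ∷ hs′ × Chain f (f p) hs′
chain-≢0 nil        p≢0 = contradiction refl p≢0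
chain-≢0 (link _ c) _   = _ , refl , c

chain-≡0 : ∀ {f p hs} → Chain f p hs → p ≡ 0 → hs ≡ []
chain-≡0 nil          _   = refl
chain-≡0 (link p≢0 _) p≡0 = contradiction p≡0 p≢0

searchStatic : List ℕ
searchStatic = SIZES ∷ TGT ∷ LBL ∷ HEAD ∷ NEXT ∷ []

module Search (n : ℕ) (verts : List ℕ) (κ : Arcs) (adj : ℕ → List ℕ) (μ : Memory)
  (μ-n   : μ SIZES 0 ≡ n)
  (chain : ∀ {v} → v ∈ verts → Chain (μ NEXT) (μ HEAD v) (adj v))
  (arc⁺  : ∀ {v h} → v ∈ verts → h ∈ adj v → κ v (μ TGT h) (μ LBL h))
  (arc⁻  : ∀ {v b e} → κ v b e → ∃[ h ] h ∈ adj v × μ TGT h ≡ b)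
  (κ-in  : ∀ {a b e} → κ a b e → a ∈ verts × b ∈ verts)
  where

  -- The rounds that a set of vertices may cost a search: one `pop` for each vertex and one `scan`
  -- for each of its arcs.
  weight : List ℕ → ℕ
  weight []       = 0
  weight (v ∷ vs) = suc (length (adj v)) + weight vs

  weight-↭ : ∀ {vs ws} → vs ↭ ws → weight vs ≡ weight ws
  weight-↭ ↭.refl          = refl
  weight-↭ (↭.prep v p)    = cong (suc (length (adj v)) +_) (weight-↭ p)
  weight-↭ (↭.swap v w p) = trans (cong (λ x → suc (length (adj v)) + (suc (length (adj w)) + x)) (weight-↭ p))
    (solve 3 (λ a b c → a :+ (b :+ c) := b :+ (a :+ c)) refl (suc (length (adj v))) (suc (length (adj w))) _)
    where open +-*-Solver
  weight-↭ (↭.trans p q)   = trans (weight-↭ p) (weight-↭ q)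

  weight-∷ʳ : ∀ vs w → weight (vs ∷ʳ w) ≡ suc (length (adj w)) + weight vs
  weight-∷ʳ vs w = weight-↭ (↭-sym (↭.∷↭∷ʳ w vs))

  -- V₀ are the marks before the search, which runs from s up to depth bnd and
  -- only enters vertices with V₀ v ≡ 0; the mark of reached vertices is ℓ.  The
  -- list un overapproximates the vertices still unmarked.
  module Run (V₀ : ℕ → ℕ) (s bnd ℓ U : ℕ) (ℓ≢0 : ℓ ≢ 0) where

    -- `rem v` is `bnd` minus the depth of `v` in the tree described by `par`. By `short`, depths
    -- are below the number of vertices reached, so a limit of at least that number leaves no
    -- reached vertex unexpanded.
    record Core (vis rem par : ℕ → ℕ) (qs un : List ℕ) : Set where
      field
        uniq     : Unique qs
        inV      : qs ⊆ verts
        labelled : ∀ {v} → v ∈ qs → vis v ≡ ℓ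
        others   : ∀ {v} → v ∉ qs → vis v ≡ V₀ v
        free     : ∀ {v} → v ∈ qs → V₀ v ≡ 0
        starts   : ∃[ tl ] qs ≡ s ∷ tl
        rem≤     : ∀ {v} → v ∈ qs → rem v ≤ bnd
        short    : ∀ {v} → v ∈ qs → suc bnd ≤ rem v + length qs
        rem-s    : rem s ≡ bnd
        parent   : ∀ {v} → v ∈ qs → v ≡ s ⊎ (v ≢ s × ∃[ u ] u ∈ qs × κ u v (par v) × rem u ≡ suc (rem v))
        rest-un  : ∀ {v} → v ∈ verts → vis v ≡ 0 → v ∈ un
        un-size  : length un + length qs ≡ U

      s∈ : s ∈ qs
      s∈ = subst (s ∈_) (sym (proj₂ starts)) (here refl)

    -- Either `b` was barred from the start, or it is at most one level deeper than `a`. This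
    -- inequality along all arcs is what makes depths equal to distances.
    Handled : (ℕ → ℕ) → List ℕ → ℕ → ℕ → Set
    Handled rem qs a b = V₀ b ≢ 0 ⊎ (b ∈ qs × rem a ≤ suc (rem b))

    push : ∀ {vis rem par qs un un′ u w e x y} → Core vis rem par qs un →
      u ∈ qs → κ u w e → vis w ≡ 0 → rem u ≢ 0 → x ≡ ℓ → y ≡ rem u ∸ 1 → un ↭ w ∷ un′ →
      Core (set vis w x) (set rem w y) (set par w e) (qs ∷ʳ w) un′
    push {vis} {rem} {par} {qs} {un} {un′} {u} {w} {e} {x} {y} c u∈ k vis≡0 rem≢0 x≡ y≡ perm = record
      { uniq = unique-∷ʳ uniq w∉
      ; inV = λ v∈ → case ∈-∷ʳ⁻ v∈ of λ { (inj₁ v∈) → inV v∈ ; (inj₂ refl) → proj₂ (κ-in k) }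
      ; labelled = λ v∈ → case ∈-∷ʳ⁻ v∈ of λ
          { (inj₁ v∈) → trans (set-other vis w x (≢w v∈)) (labelled v∈)
          ; (inj₂ refl) → trans (set-same vis w x refl) x≡ }
      ; others = λ {v} v∉ → trans (set-other vis w x λ { refl → v∉ w∈′ }) (others (v∉ ∘ ∈.∈-++⁺ˡ))
      ; free = λ v∈ → case ∈-∷ʳ⁻ v∈ of λ { (inj₁ v∈) → free v∈ ; (inj₂ refl) → trans (sym (others w∉)) vis≡0 }
      ; starts = let tl , eq = starts in tl ∷ʳ w , cong (_∷ʳ w) eq
      ; rem≤ = λ v∈ → case ∈-∷ʳ⁻ v∈ of λ
          { (inj₁ v∈) → subst (_≤ bnd) (sym (keep v∈)) (rem≤ v∈)
          ; (inj₂ refl) → subst (_≤ bnd) (sym new) (≤-trans (m∸n≤m _ 1) (rem≤ u∈)) }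
      ; short = λ v∈ → case ∈-∷ʳ⁻ v∈ of λ
          { (inj₁ v∈) → ≤-trans (short v∈) (+-mono-≤ (≤-reflexive (sym (keep v∈))) (≤-trans (n≤1+n _) (≤-reflexive (sym (length-∷ʳ qs w)))))
          ; (inj₂ refl) → ≤-trans (short u∈) (≤-reflexive (trans (cong (_+ length qs) (trans step-down (cong suc (sym new))))
              (trans (sym (+-suc _ _)) (cong (set rem w y w +_) (sym (length-∷ʳ qs w)))))) }
      ; rem-s = trans (keep s∈) rem-s
      ; parent = λ v∈ → case ∈-∷ʳ⁻ v∈ of λ
          { (inj₁ v∈) → case parent v∈ of λ
              { (inj₁ eq) → inj₁ eq
              ; (inj₂ (v≢s , u′ , u′∈ , k′ , eq)) → inj₂ (v≢s , u′ , ∈.∈-++⁺ˡ u′∈ ,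
                  subst (κ u′ _) (sym (set-other par w e (≢w v∈))) k′ ,
                  trans (keep u′∈) (trans eq (cong suc (sym (keep v∈))))) }
          ; (inj₂ refl) → inj₂ ((λ { refl → w∉ s∈ }) , u , ∈.∈-++⁺ˡ u∈ ,
              subst (κ u _) (sym (set-same par w e refl)) k ,
              trans (keep u∈) (trans step-down (cong suc (sym new)))) }
      ; rest-un = λ {v} v∈ z → rest v∈ (v ≟ w) z
      ; un-size = trans (trans (cong (length un′ +_) (length-∷ʳ qs w)) (trans (+-suc _ _)
          (cong (_+ length qs) (sym (↭.↭-length perm))))) un-size
      }
      where
      open Core c
      w∉ : w ∉ qs
      w∉ w∈ = ℓ≢0 (trans (sym (labelled w∈)) vis≡0)
      w∈′ : w ∈ qs ∷ʳ w
      w∈′ = ∈.∈-++⁺ʳ qs (here refl)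
      ≢w : ∀ {v} → v ∈ qs → v ≢ w
      ≢w v∈ refl = w∉ v∈
      keep : ∀ {v} → v ∈ qs → set rem w y v ≡ rem v
      keep v∈ = set-other rem w y (≢w v∈)
      new : set rem w y w ≡ rem u ∸ 1
      new = trans (set-same rem w y refl) y≡
      step-down : rem u ≡ suc (rem u ∸ 1)
      step-down = sym (m+[n∸m]≡n (n≢0⇒n>0 rem≢0))
      rest : ∀ {v} → v ∈ verts → Dec (v ≡ w) → set vis w x v ≡ 0 → v ∈ un′
      rest v∈ (yes refl) z = contradiction (trans (sym (trans (set-same vis w x refl) x≡)) z) ℓ≢0
      rest v∈ (no v≢w)  z with ↭.∈-resp-↭ perm (rest-un v∈ (trans (sym (set-other vis w x v≢w)) z))
      ... | here eq   = contradiction eq v≢w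
      ... | there v∈′ = v∈′

    -- `dn` has been expanded, `u` is being expanded with the arcs `hs` left, and `rest` waits.
    -- `desc` and `near` are the classical queue invariant: depths do not decrease along the queue
    -- and exceed that of `u` by at most one.
    record Active (σ : Memory) (qs dn : List ℕ) (u : ℕ) (rest hs un : List ℕ) : Set where
      field
        core   : Core (σ VIS) (σ REM) (σ PAR) qs un
        front  : qs ≡ dn ++ u ∷ rest
        queue  : Seg (σ QUEUE) 0 qs
        tail   : σ qtail 0 ≡ length qs
        head   : σ qhead 0 ≡ length dn
        cnt    : σ count 0 ≡ length (nonmetas n qs)
        static : σ ≈[ searchStatic ] μ
        col    : σ colour 0 ≡ ℓ
        here-  : Chain (μ NEXT) (σ ptr 0) hs
        desc   : AllPairs (λ a b → σ REM b ≤ σ REM a) (u ∷ rest)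
        near   : ∀ {v} → v ∈ qs → σ REM u ≤ suc (σ REM v)
        hs-arc : ∀ {h} → h ∈ hs → κ u (μ TGT h) (μ LBL h)
        hs-rem : ∀ {h} → h ∈ hs → σ REM u ≢ 0
        cur    : ∀ {b e} → σ REM u ≢ 0 → κ u b e → Handled (σ REM) qs u b ⊎ ∃[ h ] h ∈ hs × μ TGT h ≡ b
        closed : ∀ {a b e} → a ∈ dn → σ REM a ≢ 0 → κ a b e → Handled (σ REM) qs a b

      u∈ : u ∈ qs
      u∈ = subst (u ∈_) (sym front) (∈.∈-++⁺ʳ dn (here refl))

      at-head : σ QUEUE (σ qhead 0) ≡ u
      at-head with eq ∷ _ ← seg-++⁻ dn (subst (Seg (σ QUEUE) 0) front queue) = trans (cong (σ QUEUE) head) eq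

    record Done (σ : Memory) (qs un : List ℕ) : Set where
      field
        core   : Core (σ VIS) (σ REM) (σ PAR) qs un
        queue  : Seg (σ QUEUE) 0 qs
        tail   : σ qtail 0 ≡ length qs
        cnt    : σ count 0 ≡ length (nonmetas n qs)
        closed : ∀ {a b e} → a ∈ qs → σ REM a ≢ 0 → κ a b e → Handled (σ REM) qs a b

    -- `it` bounds the rounds left. Scanning an arc or popping a vertex lowers the sum by at least
    -- one; a discovery merely moves the weight of a vertex from `un` to `rest`.
    data State (σ : Memory) (it : ℕ) : Set where
      active : ∀ {qs dn u rest hs un} → Active σ qs dn u rest hs un →
               weight un + (weight rest + suc (length hs)) ≤ it → State σ it
      done   : ∀ {qs un} → Done σ qs un → σ qhead 0 ≡ σ qtail 0 → weight un ≤ it → State σ it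

    seen : ∀ {σ qs dn u rest hs un} → Active σ qs dn u rest hs un → ∀ w → σ VIS w ≢ 0 → Handled (σ REM) qs u w
    seen {qs = qs} A w vis≢0 with Any.any? (w ≟_) qs
    ... | yes w∈ = inj₂ (w∈ , Active.near A w∈)
    ... | no w∉  = inj₁ λ z → vis≢0 (trans (Core.others (Active.core A) w∉) z)

    module _ {σ qs dn u rest hs un} (A : Active σ qs dn u rest hs un) {it}
             (le : weight un + (weight rest + suc (length hs)) ≤ suc it) where
      open Active A
      open Core core

      private
        p = σ ptr 0
        w = σ TGT p

      scan-step : p ≢ 0 → ∀ b → Runs scan σ (62 + b) (λ τ b′ → b′ ≡ b × State τ it)
      scan-step p≢0 b with hs′ , refl , ch ← chain-≢0 here- p≢0 =
        R-then-at 0 p refl refl (R-then-at 0 (σ NEXT p) refl refl (R-if old new))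
        where
        w≡ : w ≡ μ TGT p
        w≡ = static TGT tt p
        ch′ : Chain (μ NEXT) (σ NEXT p) hs′
        ch′ = subst (λ q → Chain (μ NEXT) q hs′) (sym (static NEXT tt p)) ch
        shorter : weight un + (weight rest + suc (length hs′)) ≤ it
        shorter = s≤s⁻¹ (≤-trans (≤-reflexive (trans (sym (+-suc (weight un) _))
                    (cong (weight un +_) (sym (+-suc (weight rest) _))))) le)
        old : σ VIS w ≢ 0 → Runs skip _ (48 + b) (λ τ b′ → b′ ≡ b × State τ it)
        old nz = R-≤ (+-monoˡ-≤ b (≤ᵇ⇒≤ 1 48 tt)) (R-skip (refl , active (record
          { core = core ; front = front ; queue = queue ; tail = tail ; head = head ; cnt = cnt
          ; static = λ { 0 t → static 0 t ; 4 t → static 4 t ; 5 t → static 5 t ; 6 t → static 6 t ; 7 t → static 7 t }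
          ; col = col ; here- = ch′ ; desc = desc ; near = near
          ; hs-arc = hs-arc ∘ there ; hs-rem = hs-rem ∘ there
          ; cur = λ r≢0 k → case cur r≢0 k of λ
              { (inj₁ h) → inj₁ h
              ; (inj₂ (_ , here refl , refl)) → inj₁ (subst (Handled (σ REM) qs u) w≡ (seen A w nz))
              ; (inj₂ (h , there h∈ , eq)) → inj₂ (h , h∈ , eq) }
          ; closed = closed }) shorter))
        new : σ VIS w ≡ 0 → Runs discover _ (48 + b) (λ τ b′ → b′ ≡ b × State τ it)
        new z with un′ , perm ← extract (rest-un (proj₂ (κ-in (hs-arc (here refl)))) (trans (cong (σ VIS) (sym w≡)) z)) =
          R-then-at w (σ colour 0) refl refl (R-then-at (σ qtail 0) w refl refl
          (R-then-at 0 (suc (σ qtail 0)) refl refl (R-then-at w y refl refl (R-then-at w (σ LBL p) refl refl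
          (R-assign-at 0 (suc (σ count 0) ∸ (1 ∸ (σ SIZES 0 ∸ w))) refl refl (refl , active {dn = dn} {u} {rest ∷ʳ w} {hs′} {un′} (record
            { core = core′
            ; front = trans (cong (_∷ʳ w) front) (++-assoc dn (u ∷ rest) (w ∷ []))
            ; queue = subst (λ i → Seg (set (σ QUEUE) i w) 0 (qs ∷ʳ w)) (sym tail) (seg-push queue)
            ; tail = trans (cong suc tail) (sym (length-∷ʳ qs w))
            ; head = head
            ; cnt = trans (cong (λ m → suc (σ count 0) ∸ (1 ∸ (m ∸ w))) (trans (static SIZES tt 0) μ-n)) (count-∷ʳ n qs w _ cnt)
            ; static = λ { 0 t → static 0 t ; 4 t → static 4 t ; 5 t → static 5 t ; 6 t → static 6 t ; 7 t → static 7 t }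
            ; col = col ; here- = ch′
            ; desc = desc′
            ; near = λ v∈ → case ∈-∷ʳ⁻ v∈ of λ
                { (inj₁ v∈) → subst₂ (λ x y → x ≤ suc y) (sym (keep u∈)) (sym (keep v∈)) (near v∈)
                ; (inj₂ refl) → ≤-reflexive (trans (keep u∈) step-down) }
            ; hs-arc = hs-arc ∘ there
            ; hs-rem = λ h∈ → hs-rem (there h∈) ∘ trans (sym (keep u∈))
            ; cur = λ r≢0 k → case cur (r≢0 ∘ trans (keep u∈)) k of λ
                { (inj₁ h) → inj₁ (handled u∈ h)
                ; (inj₂ (_ , here refl , refl)) → inj₁ (inj₂ (subst (_∈ qs ∷ʳ w) w≡ w∈′ ,
                    ≤-reflexive (trans (keep u∈) (trans step-down (cong (suc ∘ rem′) w≡)))))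
                ; (inj₂ (h , there h∈ , eq)) → inj₂ (h , h∈ , eq) }
            ; closed = λ a∈ r≢0 k → let a∈q = subst (_ ∈_) (sym front) (∈.∈-++⁺ˡ a∈) in
                handled a∈q (closed a∈ (r≢0 ∘ trans (keep a∈q)) k)
            }) (≤-trans (≤-reflexive reweigh) shorter)))))))
          where
          -- The cell just written, at `qtail`, comes after the one at `qhead`, so the head of the
          -- queue is intact.
          at : set (σ QUEUE) (σ qtail 0) w (σ qhead 0) ≡ u
          at = trans (set-other (σ QUEUE) _ w (<⇒≢ (subst₂ _<_ (sym head) (sym (trans tail (trans (cong length front)
                 (trans (length-++ dn) (+-suc _ _))))) (s≤s (m≤m+n _ _))))) at-head
          y = σ REM (set (σ QUEUE) (σ qtail 0) w (σ qhead 0)) ∸ 1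
          rem′ = set (σ REM) w y
          u≢0 : σ REM u ≢ 0
          u≢0 = hs-rem (here refl)
          core′ : Core (set (σ VIS) w (σ colour 0)) rem′ (set (σ PAR) w (σ LBL p)) (qs ∷ʳ w) un′
          core′ = push core u∈ (subst₂ (κ u) (sym w≡) (sym (static LBL tt p)) (hs-arc (here refl))) z u≢0 col
                    (cong (λ a → σ REM a ∸ 1) at) (subst (λ a → un ↭ a ∷ un′) (sym w≡) perm)
          w∉ : w ∉ qs
          w∉ w∈ = ℓ≢0 (trans (sym (labelled w∈)) z)
          w∈′ : w ∈ qs ∷ʳ w
          w∈′ = ∈.∈-++⁺ʳ qs (here refl)
          keep : ∀ {v} → v ∈ qs → rem′ v ≡ σ REM v
          keep v∈ = set-other (σ REM) w y λ { refl → w∉ v∈ }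
          step-down : σ REM u ≡ suc (rem′ w)
          step-down = trans (sym (m+[n∸m]≡n (n≢0⇒n>0 u≢0))) (cong suc (sym (trans (set-same (σ REM) w y refl) (cong (λ a → σ REM a ∸ 1) at))))
          handled : ∀ {a b} → a ∈ qs → Handled (σ REM) qs a b → Handled rem′ (qs ∷ʳ w) a b
          handled a∈ (inj₁ h) = inj₁ h
          handled a∈ (inj₂ (b∈ , le)) = inj₂ (∈.∈-++⁺ˡ b∈ , subst₂ (λ x y → x ≤ suc y) (sym (keep a∈)) (sym (keep b∈)) le)
          todo⊆ : u ∷ rest ⊆ qs
          todo⊆ a∈ = subst (_ ∈_) (sym front) (∈.∈-++⁺ʳ dn a∈)
          re-desc : ∀ {vs} → vs ⊆ qs → AllPairs (λ a b → σ REM b ≤ σ REM a) vs → AllPairs (λ a b → rem′ b ≤ rem′ a) vs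
          re-desc sub []       = []
          re-desc sub (ps ∷ d) =
            All.tabulate (λ b∈ → subst₂ _≤_ (sym (keep (sub (there b∈)))) (sym (keep (sub (here refl)))) (All.lookup ps b∈))
            ∷ re-desc (sub ∘ there) d
          desc′ : AllPairs (λ a b → rem′ b ≤ rem′ a) (u ∷ rest ∷ʳ w)
          desc′ = allPairs-∷ʳ (re-desc todo⊆ desc) (All.tabulate λ v∈ →
            subst (rem′ w ≤_) (sym (keep (todo⊆ v∈))) (s≤s⁻¹ (≤-trans (≤-reflexive (sym step-down)) (near (todo⊆ v∈)))))
          reweigh : weight un′ + (weight (rest ∷ʳ w) + suc (length hs′)) ≡ weight un + (weight rest + suc (length hs′))
          reweigh = trans (cong (λ x → weight un′ + (x + suc (length hs′))) (trans (weight-∷ʳ rest w) (cong (λ a → suc (length (adj a)) + weight rest) w≡)))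
            (trans (solve 4 (λ a b c d → a :+ ((b :+ c) :+ d) := (b :+ a) :+ (c :+ d)) refl (weight un′) (suc (length (adj (μ TGT p)))) (weight rest) (suc (length hs′)))
              (cong (_+ (weight rest + suc (length hs′))) (sym (weight-↭ perm))))
            where open +-*-Solver

      pop-step : p ≡ 0 → ∀ b → Runs pop σ (62 + b) (λ τ b′ → b′ ≡ b × State τ it)
      pop-step p≡0 b with refl ← chain-≡0 here- p≡0 = R-≤ (+-monoˡ-≤ b (≤ᵇ⇒≤ 19 62 tt))
        (R-then (R-if (λ nz → next rest refl nz)
                      (λ z → R-≤ (+-monoˡ-≤ b (≤ᵇ⇒≤ 1 9 tt)) (R-skip (refl , next₀ rest refl z)))))
        where
        remains : weight un + weight rest ≤ it
        remains = s≤s⁻¹ (≤-trans (≤-reflexive (trans (sym (+-suc (weight un) _))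
                 (cong (weight un +_) (+-comm 1 (weight rest))))) le)
        up : σ qhead 0 ≡ length dn → suc (σ qhead 0) ≡ length (dn ∷ʳ u)
        up eq = trans (cong suc eq) (sym (length-∷ʳ dn u))
        closed′ : ∀ {a b e} → a ∈ dn ∷ʳ u → σ REM a ≢ 0 → κ a b e → Handled (σ REM) qs a b
        closed′ a∈ r≢0 k with ∈-∷ʳ⁻ a∈
        ... | inj₁ a∈dn = closed a∈dn r≢0 k
        ... | inj₂ refl with cur r≢0 k
        ...   | inj₁ h = h
        all-done : rest ≡ [] → Done σ qs un
        all-done refl = record { core = core ; queue = queue ; tail = tail ; cnt = cnt
          ; closed = λ a∈ → closed′ (subst (_ ∈_) front a∈) }
        ended : rest ≡ [] → suc (σ qhead 0) ≡ σ qtail 0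
        ended refl = trans (up head) (trans (cong length (sym front)) (sym tail))
        front′ : ∀ {u₂ rest₂} → rest ≡ u₂ ∷ rest₂ → qs ≡ (dn ∷ʳ u) ++ u₂ ∷ rest₂
        front′ refl = trans front (sym (++-assoc dn (u ∷ []) _))
        at₂ : ∀ {u₂ rest₂} → rest ≡ u₂ ∷ rest₂ → σ QUEUE (suc (σ qhead 0)) ≡ u₂
        at₂ eq with eq′ ∷ _ ← seg-++⁻ (dn ∷ʳ u) (subst (Seg (σ QUEUE) 0) (front′ eq) queue) =
          trans (cong (σ QUEUE) (up head)) eq′
        u₂∈ : ∀ {u₂ rest₂} → rest ≡ u₂ ∷ rest₂ → u₂ ∈ qs
        u₂∈ eq = subst (_ ∈_) (sym (front′ eq)) (∈.∈-++⁺ʳ (dn ∷ʳ u) (here refl))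
        desc₂ : ∀ {u₂ rest₂} → rest ≡ u₂ ∷ rest₂ → AllPairs (λ a b → σ REM b ≤ σ REM a) (u₂ ∷ rest₂)
        desc₂ refl with _ ∷ d ← desc = d
        near₂ : ∀ {u₂ rest₂} → rest ≡ u₂ ∷ rest₂ → ∀ {v} → v ∈ qs → σ REM u₂ ≤ suc (σ REM v)
        near₂ refl v∈ with (le₂ ∷ _) ∷ _ ← desc = ≤-trans le₂ (near v∈)
        lighter : ∀ {u₂ rest₂} → rest ≡ u₂ ∷ rest₂ → ∀ {m} → m ≤ length (adj u₂) →
                  weight un + (weight rest₂ + suc m) ≤ it
        lighter {u₂} {rest₂} refl {m} m≤ = ≤-trans (+-monoʳ-≤ (weight un) (≤-trans (≤-reflexive (+-comm (weight rest₂) (suc m)))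
          (+-monoˡ-≤ (weight rest₂) (s≤s m≤)))) remains
        next₀ : ∀ rs → rest ≡ rs → σ REM (σ QUEUE (suc (σ qhead 0))) ≡ 0 → State (update σ qhead 0 (suc (σ qhead 0))) it
        next₀ [] eq _ = done (record { Done (all-done eq) }) (ended eq) (≤-trans (m≤m+n _ _) remains)
        next₀ (u₂ ∷ rest₂) eq z = active {hs = []} (record
          { core = core ; front = front′ eq ; queue = queue ; tail = tail ; head = up head ; cnt = cnt
          ; static = λ { 0 t → static 0 t ; 4 t → static 4 t ; 5 t → static 5 t ; 6 t → static 6 t ; 7 t → static 7 t }
          ; col = col ; here- = subst (λ q → Chain (μ NEXT) q []) (sym p≡0) nil
          ; desc = desc₂ eq ; near = near₂ eq
          ; hs-arc = λ () ; hs-rem = λ ()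
          ; cur = λ r≢0 _ → contradiction (trans (cong (σ REM) (sym (at₂ eq))) z) r≢0
          ; closed = closed′ }) (lighter eq z≤n)
        next : ∀ rs → rest ≡ rs → σ REM (σ QUEUE (suc (σ qhead 0))) ≢ 0 →
          Runs (ptr :≔ HEAD [ QUEUE [ cell qhead ] ]) (update σ qhead 0 (suc (σ qhead 0))) (9 + b) (λ τ b′ → b′ ≡ b × State τ it)
        -- The queue is exhausted and the cell read is stale, so `ptr` may receive any value; the
        -- loop ends before it is used.
        next [] eq _ = R-≤ (+-monoˡ-≤ b (≤ᵇ⇒≤ 6 9 tt)) (R-assign (refl , done (record { Done (all-done eq) }) (ended eq) (≤-trans (m≤m+n _ _) remains)))
        next (u₂ ∷ rest₂) eq nz = R-≤ (+-monoˡ-≤ b (≤ᵇ⇒≤ 6 9 tt)) (R-assign (refl , active {hs = adj u₂} (record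
          { core = core ; front = front′ eq ; queue = queue ; tail = tail ; head = up head ; cnt = cnt
          ; static = λ { 0 t → static 0 t ; 4 t → static 4 t ; 5 t → static 5 t ; 6 t → static 6 t ; 7 t → static 7 t }
          ; col = col
          ; here- = subst (λ q → Chain (μ NEXT) q (adj u₂))
              (sym (trans (cong (σ HEAD) (at₂ eq)) (static HEAD tt u₂))) (chain (inV (u₂∈ eq)))
          ; desc = desc₂ eq ; near = near₂ eq
          ; hs-arc = arc⁺ (inV (u₂∈ eq)) ; hs-rem = λ _ z → nz (trans (cong (σ REM) (at₂ eq)) z)
          ; cur = λ _ k → inj₂ (arc⁻ k)
          ; closed = closed′ }) (lighter eq ≤-refl)))

    -- The weight of the vertices not reached is handed back, so that consecutive searches with the
    -- same marks are together paid by one traversal of the node; `D` is passed on to what follows.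
    -- The launch takes 39 units, a round 71 = 6 + 3 + 62 for loop test, branch test and body, and
    -- the last test 6.
    search-runs : ∀ {σ un} D it →
      σ ≈[ searchStatic ] μ → σ start 0 ≡ s → σ limit 0 ≡ bnd → σ colour 0 ≡ ℓ → (∀ v → σ VIS v ≡ V₀ v) →
      s ∈ verts → V₀ s ≡ 0 → (∀ {v} → v ∈ verts → V₀ v ≡ 0 → v ∈ un) → length un ≡ U → weight un ≤ it →
      Runs search σ (39 + (it * 71 + (6 + D))) λ τ b′ →
        ∃[ qs ] ∃[ un′ ] ∃[ it′ ] Done τ qs un′ × weight un′ ≤ it′ × b′ ≡ it′ * 71 + D
    search-runs {σ} {un} D it static eqs eqb eqc eqv s∈ s-free un-ok un-len le
      with un′ , perm ← extract (un-ok s∈ s-free) = R-seq launched λ { (refl , st) → R-while I step (it , refl , st) }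
      where
      I : Memory → ℕ → Set
      I τ b = ∃[ it ] b ≡ it * 71 + (6 + D) × State τ it
      Result : Memory → ℕ → Set
      Result τ b′ = ∃[ qs ] ∃[ un′ ] ∃[ it′ ] Done τ qs un′ × weight un′ ≤ it′ × b′ ≡ it′ * 71 + D
      V-here : set (σ VIS) s (σ colour 0) s ≡ ℓ
      V-here = trans (set-same (σ VIS) s _ refl) eqc
      core₀ : Core (set (σ VIS) s (σ colour 0)) (set (σ REM) s (σ limit 0)) (σ PAR) (s ∷ []) un′
      core₀ = record
        { uniq = [] ∷ []
        ; inV = λ { (here refl) → s∈ }
        ; labelled = λ { (here refl) → V-here }
        ; others = λ v∉ → trans (set-other (σ VIS) s _ (λ eq → v∉ (here eq))) (eqv _)
        ; free = λ { (here refl) → s-free }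
        ; starts = [] , refl
        ; rem≤ = λ { (here refl) → ≤-reflexive rem-here }
        ; short = λ { (here refl) → ≤-reflexive (trans (cong suc (sym rem-here)) (+-comm 1 _)) }
        ; rem-s = rem-here
        ; parent = λ { (here refl) → inj₁ refl }
        ; rest-un = λ {v} v∈ z → rest v∈ (v ≟ s) z
        ; un-size = trans (+-comm (length un′) 1) (trans (sym (↭.↭-length perm)) un-len) }
        where
        rem-here : set (σ REM) s (σ limit 0) s ≡ bnd
        rem-here = trans (set-same (σ REM) s _ refl) eqb
        rest : ∀ {v} → v ∈ verts → Dec (v ≡ s) → set (σ VIS) s (σ colour 0) v ≡ 0 → v ∈ un′
        rest v∈ (yes refl) z = contradiction (trans (sym V-here) z) ℓ≢0
        rest v∈ (no v≢s)  z with ↭.∈-resp-↭ perm (un-ok v∈ (trans (sym (eqv _)) (trans (sym (set-other (σ VIS) s _ v≢s)) z)))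
        ... | here eq   = contradiction eq v≢s
        ... | there v∈′ = v∈′
      active₀ : ∀ p hs → length hs ≤ length (adj s) → Chain (μ NEXT) p hs →
        (∀ {h} → h ∈ hs → κ s (μ TGT h) (μ LBL h)) → (∀ {h} → h ∈ hs → bnd ≢ 0) →
        (∀ {b e} → bnd ≢ 0 → κ s b e → ∃[ h ] h ∈ hs × μ TGT h ≡ b) →
        State (update (update (update (update (update (update (update σ VIS s (σ colour 0)) QUEUE 0 s) qhead 0 0) qtail 0 1)
          REM s (σ limit 0)) count 0 (1 ∸ (1 ∸ (σ SIZES 0 ∸ s)))) ptr 0 p) it
      active₀ p hs hs≤ ch ok-arc ok-rem ok-cur = active {qs = s ∷ []} {dn = []} {u = s} {rest = []} {hs = hs} {un = un′} (record
        { core = core₀ ; front = refl ; queue = refl ∷ [] ; tail = refl ; head = refl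
        ; cnt = trans (cong (λ m → 1 ∸ (1 ∸ (m ∸ s))) (trans (static SIZES tt 0) μ-n)) (count-∷ʳ n [] s 0 refl)
        ; static = λ { 0 t → static 0 t ; 4 t → static 4 t ; 5 t → static 5 t ; 6 t → static 6 t ; 7 t → static 7 t }
        ; col = eqc ; here- = ch ; desc = [] ∷ []
        ; near = λ { (here refl) → n≤1+n _ }
        ; hs-arc = ok-arc
        ; hs-rem = λ h∈ z → ok-rem h∈ (trans (sym (Core.rem-s core₀)) z)
        ; cur = λ r≢0 k → inj₂ (ok-cur (λ z → r≢0 (trans (Core.rem-s core₀) z)) k)
        ; closed = λ () })
        (≤-trans (+-monoʳ-≤ (weight un′) (s≤s hs≤)) (≤-trans (≤-reflexive (trans (+-comm (weight un′) _) (sym (weight-↭ perm)))) le))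
      launched : Runs launch σ (39 + (it * 71 + (6 + D))) (λ τ b′ → b′ ≡ it * 71 + (6 + D) × State τ it)
      launched =
        R-then-at s (σ colour 0) eqs refl (R-then-at 0 s refl eqs (R-then-at 0 0 refl refl
        (R-then-at 0 1 refl refl (R-then-at s (σ limit 0) eqs refl
        (R-then-at 0 (1 ∸ (1 ∸ (σ SIZES 0 ∸ s))) refl (cong (λ v → 1 ∸ (1 ∸ (σ SIZES 0 ∸ v))) eqs) (R-if deep flat))))))
        where
        deep = λ nz → R-assign-at 0 (σ HEAD s) refl (cong (σ HEAD) eqs) (refl , active₀ (σ HEAD s) (adj s) ≤-refl
          (subst (λ q → Chain (μ NEXT) q (adj s)) (sym (static HEAD tt s)) (chain s∈)) (arc⁺ s∈)
          (λ _ z → nz (trans eqb z)) (λ _ → arc⁻))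
        flat = λ z → R-≤ (+-monoˡ-≤ _ (≤ᵇ⇒≤ 3 5 tt)) (R-assign-at 0 0 refl refl (refl , active₀ 0 [] z≤n nil (λ ()) (λ ())
          (λ b≢0 _ → contradiction (trans (sym eqb) z) b≢0)))
      step : ∀ {τ b} → I τ b → ∃[ b₀ ] 6 + b₀ ≤ b ×
        (τ qtail 0 ∸ τ qhead 0 ≡ 0 → Result τ b₀) ×
        (τ qtail 0 ∸ τ qhead 0 ≢ 0 → Runs (if cell ptr run scan else pop) τ b₀ I)
      step (zero , _ , active {rest = rest} {un = un} A le) with () ← n≤0⇒n≡0 (≤-trans (≤-reflexive (sym
        (trans (cong (weight un +_) (+-suc (weight rest) _)) (+-suc (weight un) _)))) le)
      step {τ} (suc it , refl , active {qs} {dn} {u} {rest} A le) = 65 + (it * 71 + (6 + D)) , ≤-refl ,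
        (λ z → contradiction (m∸n≡0⇒m≤n z) (<⇒≱ (subst₂ _<_ (sym (Active.head A))
          (sym (trans (Active.tail A) (trans (cong length (Active.front A)) (trans (length-++ dn) (+-suc (length dn) (length rest))))))
          (s≤s (m≤m+n (length dn) (length rest)))))) ,
        λ _ → R-if (λ p≢0 → R-map (λ { (refl , st) → it , refl , st }) (scan-step A le p≢0 _))
                   (λ p≡0 → R-map (λ { (refl , st) → it , refl , st }) (pop-step A le p≡0 _))
      step {τ} (it , refl , done {qs} {un} d eq le) = it * 71 + D ,
        ≤-reflexive (solve 2 (λ x d → con 6 :+ (x :+ d) := x :+ (con 6 :+ d)) refl (it * 71) D) ,
        (λ _ → qs , un , it , d , le , refl) ,
        λ nz → contradiction (trans (cong (τ qtail 0 ∸_) eq) (n∸n≡0 (τ qtail 0))) nz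
        where open +-*-Solver

    module Found {σ qs un} (d : Done σ qs un) where
      open Done d public
      open Core core public

      TreeArc : ℕ → ℕ → Set
      TreeArc a b = κ a b (σ PAR b) × b ∈ qs × b ≢ s

      tree-path : ∀ k {v} → v ∈ qs → k + σ REM v ≡ bnd → Path TreeArc s v k
      tree-path k v∈ eq with parent v∈
      tree-path zero    v∈ eq | inj₁ refl = ε
      tree-path (suc k) v∈ eq | inj₁ refl =
        contradiction (≤-reflexive (trans eq (sym rem-s))) (<⇒≱ (s≤s (m≤n+m _ k)))
      tree-path zero    v∈ eq | inj₂ (_ , u , u∈ , _ , r) =
        contradiction (≤-trans (≤-reflexive (trans (cong suc (sym eq)) (sym r))) (rem≤ u∈)) (<-irrefl refl)
      tree-path (suc k) v∈ eq | inj₂ (v≢s , u , u∈ , arc , r) =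
        tree-path k u∈ (trans (cong (k +_) r) (trans (+-suc k _) eq)) ▻ (arc , v∈ , v≢s)

      depth : ∀ {v} → v ∈ qs → ∃[ k ] k + σ REM v ≡ bnd
      depth v∈ = _ , m∸n+n≡m (rem≤ v∈)

      FreeArc : ℕ → ℕ → Set
      FreeArc a b = ∥ κ ∥ a b × V₀ b ≡ 0

      -- Each arc of the walk costs at most one level, by `closed`, and enough depth remains to
      -- expand its start. So depths are at most distances, while `tree-path` supplies walks of
      -- exactly these lengths.
      complete′ : ∀ {a v k} → a ∈ qs → Path FreeArc a v k → k ≤ σ REM a → v ∈ qs × σ REM a ≤ k + σ REM v
      complete′ a∈ ε _ = a∈ , ≤-refl
      complete′ {a} a∈ (((_ , e) , free-b) ◅ p) k≤ with closed a∈ (λ z → contradiction (≤-trans k≤ (≤-reflexive z)) λ ()) e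
      ... | inj₁ nf        = contradiction free-b nf
      ... | inj₂ (b∈ , le) with v∈ , le′ ← complete′ b∈ p (s≤s⁻¹ (≤-trans k≤ le)) = v∈ , ≤-trans le (s≤s le′)

      complete : ∀ {v k} → Path FreeArc s v k → k ≤ bnd → v ∈ qs × bnd ≤ k + σ REM v
      complete p k≤ with v∈ , le ← complete′ s∈ p (≤-trans k≤ (≤-reflexive (sym rem-s))) =
        v∈ , ≤-trans (≤-reflexive (sym rem-s)) le

      -- With a bound of at least the number of vertices the search is unbounded.
      closure : length qs ≤ bnd → ∀ {a b e} → a ∈ qs → κ a b e → V₀ b ≡ 0 → b ∈ qs
      closure len≤ {a} a∈ e free-b with closed a∈ positive e
        where
        positive : σ REM a ≢ 0
        positive z = <⇒≱ (≤-trans (short a∈) (≤-trans (≤-reflexive (cong (_+ length qs) z)) len≤)) ≤-refl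
      ... | inj₁ nf       = contradiction free-b nf
      ... | inj₂ (b∈ , _) = b∈

-- Testing and choosing disks

center radius ok fresh idx nodeLen nodeSize : ℕ
center   = 30
radius   = 31
ok       = 32
fresh    = 33
idx      = 34
nodeLen  = 35
nodeSize = 36

-- Mark 1 is the disk. A component is marked by one more than the name reserved for its contracted
-- vertex, so the contraction can read the name off the mark. The limit `names` is at least the
-- number of vertices and thus does not cut off the searches for components.
newPart component trial : Program
newPart = (limit :≔ cell names) ⨾ (colour :≔ inc (cell fresh)) ⨾ search ⨾ (fresh :≔ inc (cell fresh)) ⨾
  if cell count ⊖ (cell nodeSize ⊖ cell count) run (ok :≔ lit 0) else skip
component = (start :≔ (NODE [ cell idx ])) ⨾ if VIS [ cell start ] run skip else newPart
trial = clear VIS (cell names) ⨾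
  (start :≔ cell center) ⨾ (limit :≔ cell radius) ⨾ (colour :≔ lit 1) ⨾ search ⨾
  (ok :≔ lit 1) ⨾ (fresh :≔ cell names) ⨾ for idx (cell nodeLen) component

cand best bestCenter nodeRep tidx : ℕ
cand       = 37
best       = 38
bestCenter = 39
nodeRep    = 40
tidx       = 41

-- Every round of choose lowers the radius or drops a candidate center; its loop
-- condition is the minimum of the radius and the number of candidates left.
attempt choose addTree : Program
attempt = (center :≔ (NODE [ cell cand ])) ⨾ (radius :≔ (cell best ⊖ lit 1)) ⨾ trial ⨾
  if cell ok run ((best :≔ (cell best ⊖ lit 1)) ⨾ (bestCenter :≔ cell center)) else (cand :≔ inc (cell cand))
choose = (cand :≔ lit 0) ⨾ (best :≔ cell nodeLen) ⨾ (bestCenter :≔ cell nodeRep) ⨾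
  while cell best ⊖ (cell best ⊖ (cell nodeLen ⊖ cell cand)) run attempt
addTree = clear VIS (cell names) ⨾
  (start :≔ cell bestCenter) ⨾ (limit :≔ cell names) ⨾ (colour :≔ lit 1) ⨾ search ⨾
  for tidx (cell qtail ⊖ lit 1) (MARK [ PAR [ QUEUE [ inc (cell tidx) ] ] ]≔ lit 1)

marked : (ℕ → ℕ) → ℕ → ℕ
marked f zero    = 0
marked f (suc m) = (f m ⊓ 1) + marked f m

marked-above : ∀ f m {i x} → m ≤ i → marked (set f i x) m ≡ marked f m
marked-above f zero    _  = refl
marked-above f (suc m) {i} {x} m<i = cong₂ (λ y z → (y ⊓ 1) + z) (set-other f i x (<⇒≢ m<i)) (marked-above f m (<⇒≤ m<i))

marked-set : ∀ f m i → marked (set f i 1) m ≤ suc (marked f m)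
marked-set f zero    i = z≤n
marked-set f (suc m) i with m ≟ i
... | yes refl = ≤-trans (≤-reflexive (cong₂ (λ y z → (y ⊓ 1) + z) (set-same f m 1 refl) (marked-above f m ≤-refl)))
                        (s≤s (m≤n+m (marked f m) (f m ⊓ 1)))
... | no m≢i   = ≤-trans (+-mono-≤ (≤-reflexive (cong (_⊓ 1) (set-other f i 1 m≢i))) (marked-set f m i))
                        (≤-reflexive (+-suc (f m ⊓ 1) _))

trialStatic : List ℕ
trialStatic = SIZES ∷ TGT ∷ LBL ∷ HEAD ∷ NEXT ∷ NODE ∷ names ∷ nodeLen ∷ nodeSize ∷ []

-- Truncation does no harm: for c > s the inner difference is 0 and the outer one is c, which is not
-- 0.
half : ∀ c s → c ∸ (s ∸ c) ≡ 0 → 2 * c ≤ s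
half c s z with c ≤? s
... | yes c≤s = begin
  c + (c + 0)   ≡⟨ cong (c +_) (+-identityʳ c) ⟩
  c + c         ≤⟨ +-monoʳ-≤ c (m∸n≡0⇒m≤n z) ⟩
  c + (s ∸ c)   ≡⟨ m+[n∸m]≡n c≤s ⟩
  s             ∎
  where open ≤-Reasoning
... | no c≰s rewrite m≤n⇒m∸n≡0 (<⇒≤ (≰⇒> c≰s)) = contradiction (≤-trans (≤-reflexive z) z≤n) c≰s

half⁻ : ∀ c s → 2 * c ≤ s → c ∸ (s ∸ c) ≡ 0
half⁻ c s le = m≤n⇒m∸n≡0 (begin
  c               ≡⟨ sym (m+n∸n≡m c c) ⟩
  c + c ∸ c       ≤⟨ ∸-monoˡ-≤ c (≤-trans (≤-reflexive (cong (c +_) (sym (+-identityʳ c)))) le) ⟩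
  s ∸ c           ∎)
  where open ≤-Reasoning

record Adjacency (verts : List ℕ) (κ : Arcs) (adj : ℕ → List ℕ) (μ : Memory) : Set where
  field
    chain : ∀ {v} → v ∈ verts → Chain (μ NEXT) (μ HEAD v) (adj v)
    arc⁺  : ∀ {v h} → v ∈ verts → h ∈ adj v → κ v (μ TGT h) (μ LBL h)
    arc⁻  : ∀ {v b e} → κ v b e → ∃[ h ] h ∈ adj v × μ TGT h ≡ b

module Trial {n r : ℕ} (ν : Node n r) (adj : ℕ → List ℕ) (μ : Memory) (N : ℕ)
  (μ-n     : μ SIZES 0 ≡ n)
  (adjc    : Adjacency (Node.verts ν) (Node.κ ν) adj μ)
  (μ-N     : μ names 0 ≡ N)
  (μ-node  : Seg (μ NODE) 0 (Node.verts ν))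
  (μ-len   : μ nodeLen 0 ≡ length (Node.verts ν))
  (μ-size  : μ nodeSize 0 ≡ Node.size ν)
  (verts<N : ∀ {v} → v ∈ Node.verts ν → v < N)
  where
  open Node ν hiding (uniq)
  open Adjacency adjc
  open Search n verts κ adj μ μ-n chain arc⁺ arc⁻ κ-in public

  keep : ∀ {σ i x} a → T (not (a ∈ᵇ trialStatic)) → σ ≈[ trialStatic ] μ → update σ a i x ≈[ trialStatic ] μ
  keep a = ≈-update a trialStatic

  Z : List ℕ
  Z = nonmetas n verts

  N≢0 : N ≢ 0
  N≢0 refl with () ← verts<N rep∈

  order≤N : ∀ {qs} → Unique qs → qs ⊆ verts → length qs ≤ N
  order≤N un sub = length-below un (All.tabulate (verts<N ∘ sub))

  record Part (V : ℕ → ℕ) (c ρ M : ℕ) (C : List ℕ) : Set where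
    field
      inside  : ∀ {v} → v ∈ C → v ∈ verts × V v ≡ suc M
      whole   : ∀ {v} → v ∈ verts → V v ≡ suc M → v ∈ C
      C-uniq  : Unique C
      root    : ℕ
      root-in : root ∈ C
      root∉   : ¬ Ball κ c ρ root
      spans   : ∀ {v} → v ∈ C → ∃[ k ] Path (OffBall κ c ρ) root v k

  data Parts (V : ℕ → ℕ) (c ρ : ℕ) : List (List ℕ) → Set where
    []  : Parts V c ρ []
    _∷_ : ∀ {C cs} → Part V c ρ (N + length cs) C → Parts V c ρ cs → Parts V c ρ (C ∷ cs)

  -- During a trial some vertices of the node still have mark 0, so `closed` and `covered` speak of
  -- marked vertices only. By `outside` all other nodes keep mark 0, by which the contraction
  -- recognises the arcs that it must not touch.
  record Marks (V : ℕ → ℕ) (c ρ : ℕ) (cs : List (List ℕ)) : Set where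
    field
      disk⁺   : ∀ {v} → v ∈ verts → V v ≡ 1 → Ball κ c ρ v
      disk⁻   : ∀ {v} → Ball κ c ρ v → V v ≡ 1
      outside : ∀ {v} → v ∉ verts → v < N → V v ≡ 0
      bounded : ∀ {v} → v ∈ verts → V v ≤ N + length cs
      parts   : Parts V c ρ cs
      closed  : ∀ {a b e} → κ a b e → V a ≢ 0 → V a ≢ 1 → V b ≢ 1 → V a ≡ V b
      covered : ∀ {v} → v ∈ verts → V v ≢ 0 → V v ≢ 1 → ∃[ C ] C ∈ cs × v ∈ C

  part-of : ∀ {V c ρ cs C} → Parts V c ρ cs → C ∈ cs → ∃[ M ] Part V c ρ M C
  part-of (p ∷ ps) (here refl) = _ , p
  part-of (p ∷ ps) (there C∈)  = part-of ps C∈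

  data Verdict (σ : Memory) (c ρ : ℕ) (cs : List (List ℕ)) : Set where
    good : σ ok 0 ≢ 0 → (∀ {C} → C ∈ cs → 2 * length (nonmetas n C) ≤ size) → Verdict σ c ρ cs
    bad  : σ ok 0 ≡ 0 → ¬ Balanced κ Z c ρ → Verdict σ c ρ cs

  module _ {c ρ : ℕ} where

    balanced⇒half : ∀ {V M C} → Part V c ρ M C → Balanced κ Z c ρ → 2 * length (nonmetas n C) ≤ size
    balanced⇒half {C = C} part bal = bal (nonmetas n C) root (AllPairs.filter⁺ (_<? n) C-uniq)
      (λ v∈ → let v∈C , v<n = ∈-nonmetas⁻ {vs = C} v∈ in ∈-nonmetas⁺ (proj₁ (inside v∈C)) v<n)
      root∉ (λ v∈ → spans (proj₁ (∈-nonmetas⁻ {vs = C} v∈)))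
      where open Part part

    -- Marks are constant along walks off the ball, so all of `zs` lies in the one component that
    -- contains `z₀`.
    half⇒balanced : ∀ {V cs} → Marks V c ρ cs → (∀ {v} → v ∈ verts → V v ≢ 0) →
      (∀ {C} → C ∈ cs → 2 * length (nonmetas n C) ≤ size) → Balanced κ Z c ρ
    half⇒balanced marks all-seen halves []             z₀ _  _   _   _     = z≤n
    half⇒balanced {V} marks all-seen halves zs@(z ∷ _) z₀ un zs⊆ z₀∉ reach =
      ≤-trans (*-monoʳ-≤ 2 (length-mono-⊆ un λ z∈ →
        let z∈V , z<n = ∈-nonmetas⁻ {vs = verts} (zs⊆ z∈)
        in ∈-nonmetas⁺ (Part.whole part z∈V (trans (sym (constant z₀∉ (proj₂ (reach z∈)))) (proj₂ (Part.inside part z₀∈C)))) z<n))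
        (halves C∈)
      where
      open Marks marks
      from : ∀ {a k} → z ∈ verts → Path (OffBall κ c ρ) a z k → a ∈ verts
      from z∈ ε                   = z∈
      from z∈ (((_ , e) , _) ◅ _) = proj₁ (κ-in e)
      z₀∈ : z₀ ∈ verts
      z₀∈ = from (proj₁ (∈-nonmetas⁻ {vs = verts} (zs⊆ (here refl)))) (proj₂ (reach (here refl)))
      found = covered z₀∈ (all-seen z₀∈) λ d → z₀∉ (disk⁺ z₀∈ d)
      C∈ = proj₁ (proj₂ found)
      z₀∈C = proj₂ (proj₂ found)
      part = proj₂ (part-of parts C∈)
      constant : ∀ {a b k} → ¬ Ball κ c ρ a → Path (OffBall κ c ρ) a b k → V a ≡ V b
      constant a∉ ε = refl
      constant a∉ (((_ , e) , x∉) ◅ p) = let a∈ , x∈ = κ-in e in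
        trans (closed e (all-seen a∈) (a∉ ∘ disk⁺ a∈) (x∉ ∘ disk⁺ x∈)) (constant x∉ p)

    first-marks : ∀ {V₀ τ qs un U} → (∀ {v} → v < N → V₀ v ≡ 0) → Run.Done V₀ c ρ 1 U (λ ()) τ qs un → Marks (τ VIS) c ρ []
    first-marks {V₀} {τ} {qs} {U = U} zero-V d = record
      { disk⁺ = λ v∈ V≡1 → in-disk v∈ V≡1 (Any.any? (_ ≟_) qs)
      ; disk⁻ = labelled ∘ in-qs
      ; outside = λ v∉ v<N → trans (others (v∉ ∘ inV)) (zero-V v<N)
      ; bounded = λ v∈ → ≤-trans (small v∈ (Any.any? (_ ≟_) qs)) (≤-trans (n≢0⇒n>0 N≢0) (m≤m+n N 0))
      ; parts = []
      ; closed = λ e a≢0 a≢1 _ → ⊥-elim (only (proj₁ (κ-in e)) a≢0 a≢1 (Any.any? (_ ≟_) qs))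
      ; covered = λ v∈ v≢0 v≢1 → ⊥-elim (only v∈ v≢0 v≢1 (Any.any? (_ ≟_) qs)) }
      where
      open Run V₀ c ρ 1 U (λ ())
      open Found d using (labelled; others; inV; depth; tree-path; complete)
      in-disk : ∀ {v} → v ∈ verts → τ VIS v ≡ 1 → Dec (v ∈ qs) → Ball κ c ρ v
      in-disk v∈ V≡1 (no v∉) = contradiction (trans (sym V≡1) (trans (others v∉) (zero-V (verts<N v∈)))) λ ()
      in-disk v∈ V≡1 (yes v∈q) with k , eq ← depth v∈q =
        k , ≤-trans (m≤m+n k _) (≤-reflexive eq) , mapPath (λ { (e , _) → _ , e }) (tree-path k v∈q eq)
      in-qs : ∀ {v} → Ball κ c ρ v → v ∈ qs
      in-qs (k , k≤ , p) = proj₁ (complete (mapPath (λ { (_ , e) → (_ , e) , zero-V (verts<N (proj₂ (κ-in e))) }) p) k≤)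
      small : ∀ {v} → v ∈ verts → Dec (v ∈ qs) → τ VIS v ≤ 1
      small v∈ (yes v∈q) = ≤-reflexive (labelled v∈q)
      small v∈ (no v∉)   = ≤-trans (≤-reflexive (trans (others v∉) (zero-V (verts<N v∈)))) z≤n
      only : ∀ {v} → v ∈ verts → τ VIS v ≢ 0 → τ VIS v ≢ 1 → Dec (v ∈ qs) → ⊥
      only v∈ _   ≢1 (yes v∈q) = ≢1 (labelled v∈q)
      only v∈ ≢0  _  (no v∉)   = ≢0 (trans (others v∉) (zero-V (verts<N v∈)))

    module _ {V₀ : ℕ → ℕ} {τ : Memory} {qs un : List ℕ} {U s : ℕ} {cs : List (List ℕ)} (marks : Marks V₀ c ρ cs)
             (d : Run.Done V₀ s N (suc (N + length cs)) U (λ ()) τ qs un) where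
      private
        open Run V₀ s N (suc (N + length cs)) U (λ ())
        open Found d using (labelled; others; inV; free; uniq; s∈; depth; tree-path; closure)
        module K = Marks marks
        V = τ VIS
        fr = N + length cs

        fr≢0 : fr ≢ 0
        fr≢0 z = N≢0 (m+n≡0⇒m≡0 N z)

        old : ∀ {v} → V₀ v ≢ 0 → V v ≡ V₀ v
        old v≢0 = others λ v∈ → v≢0 (free v∈)

        in? : ∀ v → Dec (v ∈ qs)
        in? v = Any.any? (v ≟_) qs

        back : ∀ {v x} → V v ≡ suc x → x ≢ fr → V₀ v ≡ suc x
        back {v} eq x≢ with in? v
        ... | yes v∈ = contradiction (suc-injective (trans (sym eq) (labelled v∈))) x≢
        ... | no v∉  = trans (sym (others v∉)) eq

        re-part : ∀ {M C} → M < fr → Part V₀ c ρ M C → Part V c ρ M C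
        re-part M< p = record
          { inside = λ v∈ → let v∈V , eq = inside v∈ in v∈V , trans (old (λ z → contradiction (trans (sym eq) z) λ ())) eq
          ; whole = λ v∈ eq → whole v∈ (back eq (<⇒≢ M<))
          ; C-uniq = C-uniq ; root = root ; root-in = root-in ; root∉ = root∉ ; spans = spans }
          where open Part p

        re-parts : ∀ {ds} → length ds ≤ length cs → Parts V₀ c ρ ds → Parts V c ρ ds
        re-parts le []       = []
        re-parts le (p ∷ ps) = re-part (+-monoʳ-< N le) p ∷ re-parts (<⇒≤ le) ps

      new-part : Part V c ρ fr qs
      new-part = record
        { inside = λ v∈ → inV v∈ , labelled v∈
        ; whole = λ {v} v∈ eq → find v∈ eq (in? v)
        ; C-uniq = uniq
        ; root = s ; root-in = s∈
        ; root∉ = not-ball (free s∈)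
        ; spans = λ v∈ → let k , eq = depth v∈ in
            k , mapPath (λ { (e , b∈ , _) → (_ , e) , not-ball (free b∈) }) (tree-path k v∈ eq) }
        where
        not-ball : ∀ {v} → V₀ v ≡ 0 → ¬ Ball κ c ρ v
        not-ball z b = contradiction (trans (sym z) (K.disk⁻ b)) λ ()
        find : ∀ {v} → v ∈ verts → V v ≡ suc fr → Dec (v ∈ qs) → v ∈ qs
        find v∈ eq (yes v∈q) = v∈q
        find v∈ eq (no v∉)   = contradiction (≤-trans (≤-reflexive (sym (trans (sym (others v∉)) eq))) (K.bounded v∈)) (<-irrefl refl)

      next-marks : Marks V c ρ (qs ∷ cs)
      next-marks = record
        { disk⁺ = λ v∈ eq → K.disk⁺ v∈ (back eq (fr≢0 ∘ sym))
        ; disk⁻ = λ b → let eq = K.disk⁻ b in trans (old λ z → contradiction (trans (sym eq) z) λ ()) eq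
        ; outside = λ v∉ v<N → trans (others (v∉ ∘ inV)) (K.outside v∉ v<N)
        ; bounded = λ {v} v∈ → ≤-trans (bound v∈ (in? v)) (≤-reflexive (sym (+-suc N _)))
        ; parts = new-part ∷ re-parts ≤-refl K.parts
        ; closed = λ {a} {b} e a≢0 a≢1 b≢1 → same e a≢0 a≢1 b≢1 (in? a) (in? b)
        ; covered = λ {v} v∈ v≢0 v≢1 → cover v∈ v≢0 v≢1 (in? v) }
        where
        bound : ∀ {v} → v ∈ verts → Dec (v ∈ qs) → V v ≤ suc fr
        bound v∈ (yes v∈q) = ≤-reflexive (labelled v∈q)
        bound v∈ (no v∉)   = ≤-trans (≤-reflexive (others v∉)) (m≤n⇒m≤1+n (K.bounded v∈))
        0≢1 : ∀ {v} → V₀ v ≡ 0 → V₀ v ≢ 1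
        0≢1 z o = contradiction (trans (sym z) o) λ ()
        -- In the mixed cases an unmarked neighbour of the new component would have been reached, by
        -- `closure`, and a vertex of an older component would already have passed its mark on to
        -- the new vertex.
        same : ∀ {a b e} → κ a b e → V a ≢ 0 → V a ≢ 1 → V b ≢ 1 → Dec (a ∈ qs) → Dec (b ∈ qs) → V a ≡ V b
        same e a≢0 a≢1 b≢1 (yes a∈) (yes b∈) = trans (labelled a∈) (sym (labelled b∈))
        same {a} {b} e a≢0 a≢1 b≢1 (yes a∈) (no b∉)  = contradiction
          (trans (K.closed (κ-sym e) b≢0 (b≢1 ∘ trans (others b∉)) (0≢1 (free a∈))) (free a∈)) b≢0
          where
          b≢0 : V₀ b ≢ 0
          b≢0 z = b∉ (closure (order≤N uniq inV) a∈ e z)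
        same {a} e a≢0 a≢1 b≢1 (no a∉)  (yes b∈) =
          contradiction (trans (others a∉) (trans (K.closed e (a≢0 ∘ trans (others a∉)) (a≢1 ∘ trans (others a∉)) (0≢1 (free b∈))) (free b∈))) a≢0
        same e a≢0 a≢1 b≢1 (no a∉)  (no b∉)  = trans (others a∉)
          (trans (K.closed e (a≢0 ∘ trans (others a∉)) (a≢1 ∘ trans (others a∉)) (b≢1 ∘ trans (others b∉))) (sym (others b∉)))
        cover : ∀ {v} → v ∈ verts → V v ≢ 0 → V v ≢ 1 → Dec (v ∈ qs) → ∃[ C ] C ∈ qs ∷ cs × v ∈ C
        cover v∈ _ _ (yes v∈q)   = qs , here refl , v∈q
        cover v∈ v≢0 v≢1 (no v∉) = let C , C∈ , v∈C = K.covered v∈ (v≢0 ∘ trans (others v∉)) (v≢1 ∘ trans (others v∉))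
                                   in C , there C∈ , v∈C

    -- The `suc` in `un-size` is the center, which lies in no component. It is the origin of the
    -- bound k - 1 on the total size of the components.
    record Loop (i : ℕ) (σ : Memory) (dn todo : List ℕ) (cs : List (List ℕ)) (un : List ℕ) : Set where
      field
        splits  : verts ≡ dn ++ todo
        index   : length dn ≡ i
        visited : ∀ {v} → v ∈ dn → σ VIS v ≢ 0
        marks   : Marks (σ VIS) c ρ cs
        un-ok   : ∀ {v} → v ∈ verts → σ VIS v ≡ 0 → v ∈ un
        un-size : suc (length un + length (concat cs)) ≤ length verts
        verdict : Verdict σ c ρ cs
        fresh-ok : σ fresh 0 ≡ N + length cs
        static  : σ ≈[ trialStatic ] μ

    -- 71 units for every search round that may still occur, shared by all components, and 80 for
    -- every vertex left to inspect.
    LoopAt : ℕ → Memory → ℕ → Set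
    LoopAt i σ b = ∃[ dn ] ∃[ todo ] ∃[ cs ] ∃[ un ] ∃[ it ] Loop i σ dn todo cs un ×
      weight un ≤ it × b ≡ it * 71 + length todo * 80

    Next : ℕ → Memory → ℕ → Set
    Next i τ b = τ idx 0 ≡ i × LoopAt (suc i) (update τ idx 0 (suc (τ idx 0))) b

    module Step {i : ℕ} {σ : Memory} {dn : List ℕ} {v : ℕ} {todo : List ℕ} {cs : List (List ℕ)} {un : List ℕ} {it : ℕ}
      (eqi : σ idx 0 ≡ i) (L : Loop i σ dn (v ∷ todo) cs un) (w≤ : weight un ≤ it) where
      open +-*-Solver
      open Loop L

      R fr : ℕ
      R  = length todo * 80
      fr = N + length cs

      at-idx : σ NODE (σ idx 0) ≡ v
      at-idx with eq ∷ _ ← seg-++⁻ dn (subst (Seg (μ NODE) 0) splits μ-node) =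
        trans (static NODE tt _) (trans (cong (μ NODE) (trans eqi (sym index))) eq)

      v∈ : v ∈ verts
      v∈ = subst (v ∈_) (sym splits) (∈.∈-++⁺ʳ dn (here refl))

      splits′ : verts ≡ (dn ∷ʳ v) ++ todo
      splits′ = trans splits (sym (++-assoc dn (v ∷ []) todo))

      index′ : length (dn ∷ʳ v) ≡ suc i
      index′ = trans (length-∷ʳ dn v) (cong suc index)

      σ₁ σ₃ : Memory
      σ₁ = update σ start 0 v
      σ₃ = update (update σ₁ limit 0 N) colour 0 (suc fr)

      old : σ VIS v ≢ 0 → Runs skip σ₁ (1 + (it * 71 + R)) (Next i)
      old nz = R-skip (eqi , dn ∷ʳ v , todo , cs , un , it , record
        { splits = splits′ ; index = index′
        ; visited = λ w∈ → case ∈-∷ʳ⁻ w∈ of λ { (inj₁ w∈) → visited w∈ ; (inj₂ refl) → nz }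
        ; marks = marks ; un-ok = un-ok ; un-size = un-size
        ; verdict = case verdict of λ { (good o h) → good o h ; (bad z nb) → bad z nb }
        ; fresh-ok = fresh-ok
        ; static = keep idx tt (keep start tt static) }
        , w≤ , refl)

      open Run (σ VIS) v N (suc fr) (length un) (λ ())

      module After {τ : Memory} {qs un′ : List ℕ} {it′ : ℕ} (d : Done τ qs un′) (w′≤ : weight un′ ≤ it′)
                   (same : τ ≈[ idx ∷ fresh ∷ ok ∷ trialStatic ] σ₃) where
        module F = Found d

        static-τ : τ ≈[ trialStatic ] μ
        static-τ = ≈-trans {as = trialStatic} {τ = σ₃} (≈-⊆ trialStatic (idx ∷ fresh ∷ ok ∷ trialStatic) tt same)
          (keep colour tt (keep limit tt (keep start tt static)))

        idx-τ : τ idx 0 ≡ i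
        idx-τ = trans (same idx tt 0) eqi

        counted : τ count 0 ∸ (τ nodeSize 0 ∸ τ count 0) ≡ length (nonmetas n qs) ∸ (size ∸ length (nonmetas n qs))
        counted = cong₂ (λ x y → x ∸ (y ∸ x)) F.cnt (trans (static-τ nodeSize tt 0) μ-size)

        seen-dn : ∀ {w} → w ∈ dn ∷ʳ v → τ VIS w ≢ 0
        seen-dn {w} w∈ z′ with Any.any? (w ≟_) qs
        ... | yes w∈q = contradiction (trans (sym (F.labelled w∈q)) z′) λ ()
        ... | no w∉ with ∈-∷ʳ⁻ w∈
        ...   | inj₁ w∈dn = visited w∈dn (trans (sym (F.others w∉)) z′)
        ...   | inj₂ refl = w∉ F.s∈

        next : ∀ {τ′} → (∀ w → τ′ VIS w ≡ τ VIS w) → Marks (τ′ VIS) c ρ (qs ∷ cs) → τ′ fresh 0 ≡ suc fr →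
               τ′ ≈[ trialStatic ] μ → Verdict τ′ c ρ (qs ∷ cs) → Loop (suc i) τ′ (dn ∷ʳ v) todo (qs ∷ cs) un′
        next eqV mk eqf st vd = record
          { splits = splits′ ; index = index′ ; visited = λ w∈ z → seen-dn w∈ (trans (sym (eqV _)) z)
          ; marks = mk
          ; un-ok = λ w∈ z → F.rest-un w∈ (trans (sym (eqV _)) z)
          ; un-size = ≤-trans (≤-reflexive (cong suc (trans (cong (length un′ +_) (length-++ qs))
              (trans (sym (+-assoc (length un′) _ _)) (cong (_+ length (concat cs)) F.un-size))))) un-size
          ; verdict = vd ; fresh-ok = trans eqf (sym (+-suc N _))
          ; static = st }

        τ₁ : Memory
        τ₁ = update τ fresh 0 (suc fr)

        heavy : τ count 0 ∸ (τ nodeSize 0 ∸ τ count 0) ≢ 0 → Runs (ok :≔ lit 0) τ₁ (3 + (it′ * 71 + R)) (Next i)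
        heavy nz = R-assign-at 0 0 refl refl (idx-τ , dn ∷ʳ v , todo , qs ∷ cs , un′ , it′ ,
          next (λ _ → refl) (next-marks marks d) refl
            (keep idx tt (keep ok tt (keep fresh tt static-τ)))
            (bad refl λ bal → nz (trans counted (half⁻ (length (nonmetas n qs)) size (balanced⇒half (new-part marks d) bal)))) ,
          w′≤ , refl)

        light : τ count 0 ∸ (τ nodeSize 0 ∸ τ count 0) ≡ 0 → Runs skip τ₁ (1 + (it′ * 71 + R)) (Next i)
        light z′ = R-skip (idx-τ , dn ∷ʳ v , todo , qs ∷ cs , un′ , it′ ,
          next (λ _ → refl) (next-marks marks d) refl
            (keep idx tt (keep fresh tt static-τ))
            (case verdict of λ
              { (good o h) → good (o ∘ trans (sym (same ok tt 0))) λ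
                  { (here refl) → half (length (nonmetas n qs)) size (trans (sym counted) z′) ; (there C∈) → h C∈ }
              ; (bad o nb) → bad (trans (same ok tt 0) o) nb }) ,
          w′≤ , refl)

        after : Runs ((fresh :≔ inc (cell fresh)) ⨾ if cell count ⊖ (cell nodeSize ⊖ cell count) run (ok :≔ lit 0) else skip)
          τ (it′ * 71 + (17 + R)) (Next i)
        after = R-≤ (≤-reflexive (solve 2 (λ x y → con 17 :+ (x :+ y) := x :+ (con 17 :+ y)) refl (it′ * 71) R))
          (R-then-at 0 (suc fr) refl (cong suc (trans (same fresh tt 0) fresh-ok))
            (R-if heavy (λ z → R-≤ (m≤n+m _ 2) (light z))))

      new : σ VIS v ≡ 0 → Runs newPart σ₁ (48 + (it * 71 + (23 + R))) (Next i)
      new z = R-then-at 0 N refl (trans (static names tt 0) μ-N) (R-then-at 0 (suc fr) refl (cong suc fresh-ok)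
        (R-seq (R-frame (idx ∷ fresh ∷ ok ∷ trialStatic) tt (search-runs {σ = σ₃} {un = un} (17 + R) it
            (≈-⊆ searchStatic trialStatic tt (keep colour tt (keep limit tt (keep start tt static))))
            refl refl refl (λ _ → refl) v∈ z un-ok refl w≤))
          λ { ((qs , un′ , it′ , d , w′≤ , refl) , same) → After.after d w′≤ same }))

      step : Runs component σ (it * 71 + suc (length todo) * 80) (Next i)
      step = R-≤ (≤-reflexive (solve 2 (λ x y → con 57 :+ (x :+ (con 23 :+ y)) := x :+ (con 80 :+ y)) refl (it * 71) R))
        (R-then-at 0 v refl at-idx (R-if
          (λ nz → R-≤ (≤-trans (+-monoʳ-≤ 1 (+-monoʳ-≤ (it * 71) (m≤n+m R 23))) (m≤n+m _ 47)) (old nz))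
          new))

    loop-step : ∀ {i σ b} → i < length verts → σ idx 0 ≡ i → LoopAt i σ b → Runs component σ b (Next i)
    loop-step i< eqi (dn , [] , cs , un , it , L , _ , _) =
      contradiction i< (<-irrefl (trans (sym (Loop.index L)) (cong length (sym (trans (Loop.splits L) (++-identityʳ dn))))))
    loop-step i< eqi (dn , v ∷ todo , cs , un , it , L , w≤ , refl) = Step.step {v = v} {todo = todo} {un = un} {it = it} eqi L w≤

    record Outcome (τ : Memory) : Set where
      field
        cs       : List (List ℕ)
        marks    : Marks (τ VIS) c ρ cs
        all-seen : ∀ {v} → v ∈ verts → τ VIS v ≢ 0
        fresh-ok : τ fresh 0 ≡ N + length cs
        small    : suc (length (concat cs)) ≤ length verts
        verdict  : τ ok 0 ≢ 0 × Balanced κ Z c ρ ⊎ τ ok 0 ≡ 0 × ¬ Balanced κ Z c ρ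

    outcome : ∀ {τ b} → LoopAt (length verts) τ b → Outcome τ
    outcome {τ} (dn , todo , cs , un , it , L , _) = record
      { cs = cs ; marks = marks ; all-seen = seen ; fresh-ok = fresh-ok
      ; small = ≤-trans (s≤s (m≤n+m _ (length un))) un-size
      ; verdict = case verdict of λ
          { (good o h) → inj₁ (o , half⇒balanced marks seen h)
          ; (bad o nb) → inj₂ (o , nb) } }
      where
      open Loop L
      finished : ∀ todo → verts ≡ dn ++ todo → verts ≡ dn
      finished []       eq = trans eq (++-identityʳ dn)
      finished (w ∷ ws) eq = contradiction (trans index (trans (cong length eq) (length-++ dn)))
        (<⇒≢ (m<m+n (length dn) z<s))
      seen : ∀ {v} → v ∈ verts → τ VIS v ≢ 0
      seen v∈ = visited (subst (_ ∈_) (finished todo splits) v∈)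

  trialCost : ℕ
  trialCost = (N * 15 + 9) + (11 + (39 + (weight verts * 71 + (6 + (10 + ((length verts * 11 + 6) + length verts * 80))))))

  trial-runs : ∀ {σ c ρ} → σ ≈[ trialStatic ] μ → σ center 0 ≡ c → σ radius 0 ≡ ρ → c ∈ verts →
    Runs trial σ trialCost (λ τ _ → Outcome {c} {ρ} τ)
  trial-runs {σ} {c} {ρ} static eqc eqρ c∈ =
    R-seq′ (R-frame (center ∷ radius ∷ trialStatic) tt
             (clear-runs VIS (cell names) N σ (λ ()) λ same → trans (same names (λ ()) (λ ()) 0) (trans (static names tt 0) μ-N)))
      λ { {τ} (zeros , same) → cleared zeros same }
    where
    open +-*-Solver
    L = length verts
    cleared : ∀ {τ} → (∀ v → v < N → τ VIS v ≡ 0) → τ ≈[ center ∷ radius ∷ trialStatic ] σ → Runs _ τ _ (λ τ _ → Outcome {c} {ρ} τ)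
    cleared {τ} zeros same =
      R-then-at 0 c refl (trans (same center tt 0) eqc) (R-then-at 0 ρ refl (trans (same radius tt 0) eqρ) (R-then-at 0 1 refl refl
      (R-seq (R-frame trialStatic tt (search-runs {σ = τ₃} {un = verts} (10 + ((L * 11 + 6) + L * 80)) (weight verts)
          (≈-⊆ searchStatic trialStatic tt static-τ₃)
          refl refl refl (λ _ → refl) c∈ (zeros c (verts<N c∈)) (λ v∈ _ → v∈) refl ≤-refl))
        λ { ((qs , un , it , d , w≤ , refl) , same′) → searched d w≤ same′ })))
      where
      τ₃ = update (update (update τ start 0 c) limit 0 ρ) colour 0 1
      static-τ₃ : τ₃ ≈[ trialStatic ] μ
      static-τ₃ = keep colour tt (keep limit tt (keep start tt
        (≈-trans {as = trialStatic} {τ = σ} (≈-⊆ trialStatic (center ∷ radius ∷ trialStatic) tt same) static)))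
      open Run (τ VIS) c ρ 1 L (λ ())
      searched : ∀ {υ qs un it} → Done υ qs un → weight un ≤ it → υ ≈[ trialStatic ] τ₃ →
        Runs _ υ (it * 71 + (10 + ((L * 11 + 6) + L * 80))) (λ τ _ → Outcome {c} {ρ} τ)
      searched {υ} {qs} {un} {it} d w≤ same′ =
        R-≤ (≤-reflexive (solve 3 (λ x y z → con 10 :+ ((y :+ con 6) :+ (x :+ z)) := x :+ (con 10 :+ ((y :+ con 6) :+ z))) refl (it * 71) (L * 11) (L * 80)))
        (R-then-at 0 1 refl refl (R-then-at 0 N refl (trans (static-υ names tt 0) μ-N)
        (R-map outcome (R-for LoopAt L
          (λ { (_ , _ , _ , _ , _ , loop , _) → trans (Loop.static loop nodeLen tt 0) μ-len })
          loop-step ([] , verts , [] , un , it , record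
            { splits = refl ; index = refl ; visited = λ ()
            ; marks = first-marks (λ {v} → zeros v) d
            ; un-ok = F.rest-un
            ; un-size = ≤-trans (un-small F.starts) (≤-reflexive F.un-size)
            ; verdict = good (λ ()) (λ ())
            ; fresh-ok = sym (+-identityʳ N)
            ; static = keep idx tt (keep fresh tt (keep ok tt static-υ)) } , w≤ , refl)))))
        where
        module F = Found d
        static-υ : υ ≈[ trialStatic ] μ
        static-υ = ≈-trans {as = trialStatic} {τ = τ₃} same′ static-τ₃
        un-small : ∃[ tl ] qs ≡ c ∷ tl → suc (length un + 0) ≤ length un + length qs
        un-small (tl , refl) = ≤-trans (≤-reflexive (sym (+-suc (length un) 0))) (+-monoʳ-≤ (length un) (s≤s z≤n))

  attemptCost : ℕ
  attemptCost = 36 + trialCost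

  Chosen : Memory → Set
  Chosen τ = ∃[ c ] ∃[ R ] τ bestCenter 0 ≡ c × τ best 0 ≡ R × c ∈ verts × Balanced κ Z c R × R ≤ r

  -- Every dropped candidate is known to fail at radius `R` - 1, and it remains so when `R` is
  -- lowered, by monotonicity. When no candidate is left, no center works at `R` - 1; as `separable`
  -- provides one for radius r, this forces `R` ≤ r.
  choose-runs : ∀ {σ x} → σ ≈[ trialStatic ] μ → σ nodeRep 0 ≡ x → x ∈ verts → (∀ {v} → v ∈ verts → Ball κ x (length verts) v) →
    Runs choose σ (11 + ((length verts + length verts) * attemptCost + 12)) (λ τ _ → Chosen τ)
  choose-runs {σ} {x} static eqx x∈ reach =
    R-then-at 0 0 refl refl (R-then-at 0 L refl (trans (static nodeLen tt 0) μ-len) (R-then-at 0 x refl eqx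
    (R-while I round ([] , verts , L , x , refl , refl , refl , refl , x∈ , everything , (λ ()) ,
      keep bestCenter tt (keep best tt (keep cand tt static)) , refl))))
    where
    open +-*-Solver
    L = length verts
    I : Memory → ℕ → Set
    I τ b = ∃[ dn ] ∃[ todo ] ∃[ R ] ∃[ c ] verts ≡ dn ++ todo × τ cand 0 ≡ length dn × τ best 0 ≡ R × τ bestCenter 0 ≡ c ×
      c ∈ verts × Balanced κ Z c R × (∀ {w} → w ∈ dn → ¬ Balanced κ Z w (R ∸ 1)) × τ ≈[ trialStatic ] μ ×
      b ≡ (length todo + R) * attemptCost + 12
    -- The starting disk covers the whole node, so nothing lies outside and balance is vacuous.
    everything : Balanced κ Z x L
    everything []      z₀ _ _   _   _     = z≤n
    everything (z ∷ _) z₀ _ zs⊆ z₀∉ reaches = contradiction (go (proj₂ (reaches (here refl)))) λ ()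
      where
      go : ∀ {k} → Path (OffBall κ x L) z₀ z k → ⊥
      go ε                    = z₀∉ (reach (proj₁ (∈-nonmetas⁻ {vs = verts} (zs⊆ (here refl)))))
      go (((_ , e) , b∉) ◅ _) = b∉ (reach (proj₂ (κ-in e)))
    left : ∀ {τ} dn todo → verts ≡ dn ++ todo → τ cand 0 ≡ length dn → τ ≈[ trialStatic ] μ →
           τ nodeLen 0 ∸ τ cand 0 ≡ length todo
    left dn todo eq eqc st = trans (cong₂ _∸_ (trans (st nodeLen tt 0) (trans μ-len (trans (cong length eq) (length-++ dn)))) eqc)
      (m+n∸m≡n (length dn) (length todo))
    minimal : ∀ {c R} → (R ≡ 0 ⊎ (∀ {w} → w ∈ verts → ¬ Balanced κ Z w (R ∸ 1))) → Balanced κ Z c R → R ≤ r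
    minimal (inj₁ refl) _ = z≤n
    minimal {R = R} (inj₂ none) _ with R ≤? r
    ... | yes R≤r = R≤r
    ... | no R≰r with c* , c*∈ , bal ← separable Z (proj₁ ∘ ∈-nonmetas⁻ {vs = verts}) (All.tabulate (proj₂ ∘ ∈-nonmetas⁻ {vs = verts})) =
      contradiction (balanced-mono (∸-monoˡ-≤ 1 (≰⇒> R≰r)) bal) (none c*∈)
    round : ∀ {τ b} → I τ b → ∃[ b₀ ] 12 + b₀ ≤ b ×
      (τ best 0 ∸ (τ best 0 ∸ (τ nodeLen 0 ∸ τ cand 0)) ≡ 0 → Chosen τ) ×
      (τ best 0 ∸ (τ best 0 ∸ (τ nodeLen 0 ∸ τ cand 0)) ≢ 0 → Runs attempt τ b₀ I)
    round {τ} (dn , [] , R , c , eq , eqd , eqR , eqc , c∈ , bal , none , st , refl) = R * attemptCost ,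
      ≤-reflexive (+-comm 12 _) ,
      (λ _ → c , R , eqc , eqR , c∈ , bal , minimal {c} (inj₂ λ w∈ → none (subst (_ ∈_) (trans eq (++-identityʳ dn)) w∈)) bal) ,
      λ nz → contradiction (trans (cong₂ (λ x y → x ∸ (x ∸ y)) eqR (left {τ} dn [] eq eqd st)) (n∸n≡0 R)) nz
    round {τ} (dn , todo@(_ ∷ _) , zero , c , eq , eqd , eqR , eqc , c∈ , bal , none , st , refl) = (length todo + 0) * attemptCost ,
      ≤-reflexive (+-comm 12 _) ,
      (λ _ → c , 0 , eqc , eqR , c∈ , bal , z≤n) ,
      λ nz → contradiction (trans (cong₂ (λ x y → x ∸ (x ∸ y)) eqR (left {τ} dn todo eq eqd st)) refl) nz
    round {τ} (dn , v ∷ todo , suc R , c , eq , eqd , eqR , eqc , c∈ , bal , none , st , refl) =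
      24 + trialCost + ((length todo + suc R) * attemptCost + 12) ,
      ≤-reflexive (solve 2 (λ t y → con 12 :+ (con 24 :+ t :+ (y :+ con 12)) := (con 36 :+ t) :+ y :+ con 12) refl trialCost ((length todo + suc R) * attemptCost)) ,
      (λ z → contradiction (m∸n≡0⇒m≤n (trans (sym (cong₂ (λ x y → x ∸ (x ∸ y)) eqR (left {τ} dn (v ∷ todo) eq eqd st))) z))
        (<⇒≱ (s≤s (m∸n≤m R (length todo))))) ,
      λ _ → R-≤ (≤-reflexive (solve 2 (λ t y → con 11 :+ (t :+ (con 13 :+ y)) := con 24 :+ t :+ y) refl trialCost ((length todo + suc R) * attemptCost + 12)))
        (R-then-at 0 v refl at (R-then-at 0 R refl (cong (_∸ 1) eqR)
        (R-seq′ (R-frame (center ∷ cand ∷ best ∷ bestCenter ∷ trialStatic) tt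
            (trial-runs {c = v} {R} (keep radius tt (keep center tt st)) refl refl v∈))
          λ { {υ} (oc , same) → tried oc same })))
      where
      at : τ NODE (τ cand 0) ≡ v
      at with e ∷ _ ← seg-++⁻ dn (subst (Seg (μ NODE) 0) eq μ-node) = trans (st NODE tt _) (trans (cong (μ NODE) eqd) e)
      v∈ : v ∈ verts
      v∈ = subst (v ∈_) (sym eq) (∈.∈-++⁺ʳ dn (here refl))
      τ₂ = update (update τ center 0 v) radius 0 R
      tried : ∀ {υ} → Outcome {v} {R} υ → υ ≈[ center ∷ cand ∷ best ∷ bestCenter ∷ trialStatic ] τ₂ →
        Runs (if cell ok run ((best :≔ (cell best ⊖ lit 1)) ⨾ (bestCenter :≔ cell center)) else (cand :≔ inc (cell cand)))
          υ (13 + ((length todo + suc R) * attemptCost + 12)) I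
      tried {υ} oc same = R-if
        (λ nz → R-then-at 0 R refl (cong (_∸ 1) best-υ) (R-assign-at 0 v refl (same center tt 0)
          (dn , v ∷ todo , R , v , eq , cand-υ , refl , refl , v∈ , success nz ,
           (λ w∈ nb → none w∈ (balanced-mono (m∸n≤m R 1) nb)) , keep bestCenter tt (keep best tt st-υ) ,
           cong (λ y → y * attemptCost + 12) (+-suc (length todo) R))))
        (λ z → R-≤ (m≤n+m _ 5) (R-assign-at 0 (suc (length dn)) refl (cong suc cand-υ)
          (dn ∷ʳ v , todo , suc R , c , trans eq (sym (++-assoc dn (v ∷ []) todo)) , sym (length-∷ʳ dn v) ,
           best-υ , trans (same bestCenter tt 0) eqc , c∈ , bal ,
           (λ w∈ → case ∈-∷ʳ⁻ w∈ of λ { (inj₁ w∈) → none w∈ ; (inj₂ refl) → failure z }) , keep cand tt st-υ , refl)))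
        where
        best-υ : υ best 0 ≡ suc R
        best-υ = trans (same best tt 0) eqR
        cand-υ : υ cand 0 ≡ length dn
        cand-υ = trans (same cand tt 0) eqd
        st-υ : υ ≈[ trialStatic ] μ
        st-υ = ≈-trans {as = trialStatic} {τ = τ₂} (≈-⊆ trialStatic (center ∷ cand ∷ best ∷ bestCenter ∷ trialStatic) tt same)
          (keep radius tt (keep center tt st))
        success : υ ok 0 ≢ 0 → Balanced κ Z v R
        success nz with Outcome.verdict oc
        ... | inj₁ (_ , b) = b
        ... | inj₂ (z , _) = contradiction z nz
        failure : υ ok 0 ≡ 0 → ¬ Balanced κ Z v R
        failure z with Outcome.verdict oc
        ... | inj₁ (nz , _) = contradiction z nz
        ... | inj₂ (_ , nb) = nb

  record Tree (o : ℕ) (σ τ : Memory) : Set where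
    field
      kept    : ∀ {e} → σ MARK e ≢ 0 → τ MARK e ≢ 0
      few     : ∀ m → marked (τ MARK) m ≤ marked (σ MARK) m + (length verts ∸ 1)
      geodesics : ∀ {k v} → Path ∥ κ ∥ o v k → Path≤ (κ ↾ λ e → τ MARK e ≢ 0) o v k

  treeCost : ℕ
  treeCost = (N * 15 + 9) + (11 + (39 + (weight verts * 71 + (6 + ((length verts ∸ 1) * 20 + 11)))))

  -- The queue lists the tree in order of discovery. Its first entry is the root, which has no
  -- parent arc; hence one edge less than vertices is marked.
  addTree-runs : ∀ {σ o} → σ ≈[ trialStatic ] μ → σ bestCenter 0 ≡ o → o ∈ verts →
    Runs addTree σ treeCost (λ τ _ → Tree o σ τ)
  addTree-runs {σ} {o} static eqo o∈ =
    R-seq′ (R-frame (bestCenter ∷ MARK ∷ trialStatic) tt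
             (clear-runs VIS (cell names) N σ (λ ()) λ same → trans (same names (λ ()) (λ ()) 0) (trans (static names tt 0) μ-N)))
      λ { {τ} (zeros , same) → cleared zeros same }
    where
    L = length verts
    cleared : ∀ {τ} → (∀ v → v < N → τ VIS v ≡ 0) → τ ≈[ bestCenter ∷ MARK ∷ trialStatic ] σ → Runs _ τ _ (λ τ _ → Tree o σ τ)
    cleared {τ} zeros same =
      R-then-at 0 o refl (trans (same bestCenter tt 0) eqo) (R-then-at 0 N refl (trans (static-τ names tt 0) μ-N) (R-then-at 0 1 refl refl
      (R-seq (R-frame (MARK ∷ trialStatic) tt (search-runs {σ = τ₃} {un = verts} ((L ∸ 1) * 20 + 11) (weight verts)
          (≈-⊆ searchStatic trialStatic tt (keep colour tt (keep limit tt (keep start tt static-τ))))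
          refl refl refl (λ _ → refl) o∈ (zeros o (verts<N o∈)) (λ v∈ _ → v∈) refl ≤-refl))
        λ { ((qs , un , it , d , w≤ , refl) , same′) → R-≤ (m≤n+m _ (it * 71)) (searched d (proj₂ (Found.starts d)) same′) })))
      where
      τ₃ = update (update (update τ start 0 o) limit 0 N) colour 0 1
      static-τ : τ ≈[ trialStatic ] μ
      static-τ = ≈-trans {as = trialStatic} {τ = σ} (≈-⊆ trialStatic (bestCenter ∷ MARK ∷ trialStatic) tt same) static
      open Run (τ VIS) o N 1 L (λ ())
      searched : ∀ {υ qs un tl} → Done υ qs un → qs ≡ o ∷ tl → υ ≈[ MARK ∷ trialStatic ] τ₃ →
        Runs (for tidx (cell qtail ⊖ lit 1) (MARK [ PAR [ QUEUE [ inc (cell tidx) ] ] ]≔ lit 1)) υ ((L ∸ 1) * 20 + 11) (λ τ _ → Tree o σ τ)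
      searched {υ} {qs} {un} {tl} d refl same′ = R-≤ (+-monoˡ-≤ 11 (*-monoˡ-≤ 20 tl≤))
        (R-map finish (R-for′ J (length tl) 7 (λ { (_ , _ , _ , _ , q , _) → cong (_∸ 1) (trans (q qtail tt 0) F.tail) }) mark-one
          ([] , tl , refl , refl , ≈-update tidx (QUEUE ∷ PAR ∷ qtail ∷ []) tt (≈-refl {QUEUE ∷ PAR ∷ qtail ∷ []} {υ}) , (λ nz → nz ∘ trans (sym (mark-υ _))) , (λ ()) , λ m → ≤-reflexive (trans (marked-cong m) (sym (+-identityʳ _))))))
        where
        module F = Found d
        tl≤ : length tl ≤ L ∸ 1
        tl≤ = ∸-monoˡ-≤ 1 (length-mono-⊆ F.uniq F.inV)
        mark-υ : ∀ e → υ MARK e ≡ σ MARK e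
        mark-υ e = trans (same′ MARK tt e) (same MARK tt e)
        marked-cong : ∀ m → marked (υ MARK) m ≡ marked (σ MARK) m
        marked-cong zero    = refl
        marked-cong (suc m) = cong₂ (λ x y → (x ⊓ 1) + y) (mark-υ m) (marked-cong m)
        J : ℕ → Memory → Set
        J i τ = ∃[ dn ] ∃[ todo ] tl ≡ dn ++ todo × length dn ≡ i × τ ≈[ QUEUE ∷ PAR ∷ qtail ∷ [] ] υ ×
          (∀ {e} → σ MARK e ≢ 0 → τ MARK e ≢ 0) × (∀ {w} → w ∈ dn → τ MARK (υ PAR w) ≢ 0) ×
          (∀ m → marked (τ MARK) m ≤ marked (σ MARK) m + i)
        mark-one : ∀ {i τ} → i < length tl → τ tidx 0 ≡ i → J i τ →
          Runs (MARK [ PAR [ QUEUE [ inc (cell tidx) ] ] ]≔ lit 1) τ 7 (λ τ _ → τ tidx 0 ≡ i × J (suc i) (update τ tidx 0 (suc (τ tidx 0))))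
        mark-one i< eqi (dn , [] , eq , len , _) = contradiction i< (<-irrefl (trans (sym len) (cong length (sym (trans eq (++-identityʳ dn))))))
        mark-one {i} {τ} i< eqi (dn , w ∷ todo , eq , len , q , old , new , cnt) =
          R-assign-at {b = 0} (υ PAR w) 1 at refl (eqi , dn ∷ʳ w , todo , trans eq (sym (++-assoc dn (w ∷ []) todo)) ,
            trans (length-∷ʳ dn w) (cong suc len) ,
            ≈-update tidx (QUEUE ∷ PAR ∷ qtail ∷ []) tt (≈-update MARK (QUEUE ∷ PAR ∷ qtail ∷ []) tt q) ,
            (λ nz → stays (old nz)) ,
            (λ w∈ → case ∈-∷ʳ⁻ w∈ of λ { (inj₁ w∈) → stays (new w∈)
              ; (inj₂ refl) → λ z → contradiction (trans (sym z) (set-same (τ MARK) (υ PAR w) 1 refl)) λ () }) ,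
            λ m → ≤-trans (marked-set (τ MARK) m (υ PAR w)) (≤-trans (s≤s (cnt m)) (≤-reflexive (sym (+-suc _ i)))))
          where
          at : τ PAR (τ QUEUE (suc (τ tidx 0))) ≡ υ PAR w
          at with _ ∷ seg ← F.queue with e ∷ _ ← seg-++⁻ dn (subst (Seg (υ QUEUE) 1) eq seg) =
            trans (q PAR tt _) (cong (υ PAR) (trans (q QUEUE tt _) (trans (cong (υ QUEUE ∘ suc) (trans eqi (sym len))) e)))
          stays : ∀ {e} → τ MARK e ≢ 0 → set (τ MARK) (υ PAR w) 1 e ≢ 0
          stays {e} nz z with e ≟ υ PAR w
          ... | yes e≡ = contradiction (trans (sym z) (set-same (τ MARK) (υ PAR w) 1 e≡)) λ ()
          ... | no e≢  = nz (trans (sym (set-other (τ MARK) (υ PAR w) 1 e≢)) z)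
        finish : ∀ {τ} → J (length tl) τ → Tree o σ τ
        finish {τ} (dn , todo , eq , len , q , old , new , cnt) = record
          { kept = old
          ; few = λ m → ≤-trans (cnt m) (+-monoʳ-≤ (marked (σ MARK) m) tl≤)
          ; geodesics = geo }
          where
          all-marked : ∀ {w} → w ∈ tl → τ MARK (υ PAR w) ≢ 0
          all-marked {w} w∈ = new (subst (w ∈_) (complete-list todo eq) w∈)
            where
            complete-list : ∀ todo → tl ≡ dn ++ todo → tl ≡ dn
            complete-list []      eq = trans eq (++-identityʳ dn)
            complete-list (_ ∷ _) eq = contradiction (trans len (trans (cong length eq) (length-++ dn))) (<⇒≢ (m<m+n (length dn) z<s))
          H : ℕ → Set
          H e = τ MARK e ≢ 0
          geo : ∀ {k v} → Path ∥ κ ∥ o v k → Path≤ (κ ↾ H) o v k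
          geo {k} {v} p = k′ , k′≤ (k ≤? N) , mapPath tree-arc (F.tree-path k′ (reached F.s∈ p) dep)
            where
            reached : ∀ {a b j} → a ∈ o ∷ tl → Path ∥ κ ∥ a b j → b ∈ o ∷ tl
            reached a∈ ε             = a∈
            reached a∈ ((_ , e) ◅ p) = reached (F.closure (order≤N F.uniq F.inV) a∈ e (zeros _ (verts<N (proj₂ (κ-in e))))) p
            k′ = proj₁ (F.depth (reached F.s∈ p))
            dep = proj₂ (F.depth (reached F.s∈ p))
            tree-arc : ∀ {a b} → F.TreeArc a b → (κ ↾ H) a b
            tree-arc (e , here refl , b≢o) = contradiction refl b≢o
            tree-arc (e , there b∈ , _)    = _ , e , all-marked b∈
            -- The search is limited to depth `N`. For a walk of at most that length the depth is
            -- bounded by its length; a longer walk exceeds every depth anyway.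
            k′≤ : Dec (k ≤ N) → k′ ≤ k
            k′≤ (yes k≤) = +-cancelʳ-≤ _ k′ k (≤-trans (≤-reflexive dep)
              (proj₂ (F.complete (mapPath (λ { (_ , e) → (_ , e) , zeros _ (verts<N (proj₂ (κ-in e))) }) p) k≤)))
            k′≤ (no k≰)  = ≤-trans (≤-trans (m≤m+n k′ _) (≤-reflexive dep)) (<⇒≤ (≰⇒> k≰))

-- Adjacency lists and contraction

arcs hidx cidx ridx : ℕ
arcs = 43
hidx = 44
cidx = 45
ridx = 46

-- Each edge is present in both orientations, which are redirected independently. An arc within the
-- disk becomes a loop at a vertex that no child contains; of an arc between disk and component, the
-- end in the disk becomes the contracted vertex; arcs within a component or in other nodes stay.
build gather redirectArc redirect : Program
build = clear HEAD (cell names) ⨾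
  for hidx (cell arcs) (
    (NEXT [ inc (cell hidx) ]≔ (HEAD [ SRC [ inc (cell hidx) ] ])) ⨾
    (HEAD [ SRC [ inc (cell hidx) ] ]≔ inc (cell hidx)))
gather = clear VIS (cell names) ⨾
  (start :≔ cell nodeRep) ⨾ (limit :≔ cell names) ⨾ (colour :≔ lit 1) ⨾ search ⨾
  (nodeLen :≔ cell qtail) ⨾ (nodeSize :≔ cell count) ⨾
  for cidx (cell nodeLen) (NODE [ cell cidx ]≔ (QUEUE [ cell cidx ]))
redirectArc =
  if VIS [ SRC [ inc (cell ridx) ] ] run
    if (VIS [ SRC [ inc (cell ridx) ] ]) ⊖ lit 1 run
      if (VIS [ TGT [ inc (cell ridx) ] ]) ⊖ lit 1 run skip
      else (TGT [ inc (cell ridx) ]≔ ((VIS [ SRC [ inc (cell ridx) ] ]) ⊖ lit 1))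
    else
      if (VIS [ TGT [ inc (cell ridx) ] ]) ⊖ lit 1 run
        (SRC [ inc (cell ridx) ]≔ ((VIS [ TGT [ inc (cell ridx) ] ]) ⊖ lit 1))
      else (SRC [ inc (cell ridx) ]≔ (TGT [ inc (cell ridx) ]))
  else skip
redirect = for ridx (cell arcs) redirectArc

adjTo : (ℕ → ℕ) → ℕ → ℕ → List ℕ
adjTo S zero    v = []
adjTo S (suc i) v = if does (S (suc i) ≟ v) then suc i ∷ adjTo S i v else adjTo S i v

module _ (S : ℕ → ℕ) where

  adjTo-yes : ∀ i {v} → S (suc i) ≡ v → adjTo S (suc i) v ≡ suc i ∷ adjTo S i v
  adjTo-yes i {v} eq rewrite dec-true (S (suc i) ≟ v) eq = refl

  adjTo-no : ∀ i {v} → S (suc i) ≢ v → adjTo S (suc i) v ≡ adjTo S i v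
  adjTo-no i {v} neq rewrite dec-false (S (suc i) ≟ v) neq = refl

  ∈-adjTo⁺ : ∀ {i h v} → h < i → S (suc h) ≡ v → suc h ∈ adjTo S i v
  ∈-adjTo⁺ {suc i} {h} {v} h< eq with h ≟ i | S (suc i) ≟ v
  ... | yes refl | yes eq′ = subst (_ ∈_) (sym (adjTo-yes i eq′)) (here refl)
  ... | yes refl | no neq  = contradiction eq neq
  ... | no h≢i   | yes eq′ = subst (_ ∈_) (sym (adjTo-yes i eq′)) (there (∈-adjTo⁺ (≤∧≢⇒< (s≤s⁻¹ h<) h≢i) eq))
  ... | no h≢i   | no neq  = subst (_ ∈_) (sym (adjTo-no i neq)) (∈-adjTo⁺ (≤∧≢⇒< (s≤s⁻¹ h<) h≢i) eq)

  ∈-adjTo⁻ : ∀ {i x v} → x ∈ adjTo S i v → ∃[ h ] x ≡ suc h × h < i × S (suc h) ≡ v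
  ∈-adjTo⁻ {suc i} {x} {v} x∈ with S (suc i) ≟ v
  ... | no neq = let h , eq , h< , s = ∈-adjTo⁻ (subst (x ∈_) (adjTo-no i neq) x∈) in h , eq , m≤n⇒m≤1+n h< , s
  ... | yes eq′ with subst (x ∈_) (adjTo-yes i eq′) x∈
  ...   | here refl = i , refl , ≤-refl , eq′
  ...   | there x∈′ = let h , eq , h< , s = ∈-adjTo⁻ x∈′ in h , eq , m≤n⇒m≤1+n h< , s

  degrees : ℕ → List ℕ → ℕ
  degrees i vs = sum (map (λ v → length (adjTo S i v)) vs)

  degrees-absent : ∀ i vs → All (S (suc i) ≢_) vs → degrees (suc i) vs ≡ degrees i vs
  degrees-absent i []       []         = refl
  degrees-absent i (v ∷ vs) (neq ∷ ns) = cong₂ _+_ (cong length (adjTo-no i neq)) (degrees-absent i vs ns)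

  degrees-suc : ∀ i vs → Unique vs → degrees (suc i) vs ≤ suc (degrees i vs)
  degrees-suc i []       []       = z≤n
  degrees-suc i (v ∷ vs) (v∉ ∷ un) with S (suc i) ≟ v
  ... | yes refl = ≤-reflexive (cong₂ (λ l d → length l + d) (adjTo-yes i refl) (degrees-absent i vs v∉))
  ... | no neq   = ≤-trans (+-mono-≤ (≤-reflexive (cong length (adjTo-no i neq))) (degrees-suc i vs un))
                           (≤-reflexive (+-suc (length (adjTo S i v)) _))

  -- Every arc is in the list of its source only. This bounds the weight of a node by its number of
  -- vertices plus the total number of arcs.
  degrees≤ : ∀ i vs → Unique vs → degrees i vs ≤ i
  degrees≤ zero vs un = ≤-reflexive (none vs)
    where
    none : ∀ vs → degrees zero vs ≡ 0
    none []       = refl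
    none (v ∷ vs) = none vs
  degrees≤ (suc i) vs un = ≤-trans (degrees-suc i vs un) (s≤s (degrees≤ i vs un))

module _ {σ : Memory} {N H : ℕ} (eqN : σ names 0 ≡ N) (eqH : σ arcs 0 ≡ H) (S< : ∀ {h} → h < H → σ SRC (suc h) < N) where
  private
    S = σ SRC

    Chains : ℕ → Memory → Set
    Chains i τ = τ ≈[ SRC ∷ arcs ∷ [] ] σ × (∀ {v} → v < N → Chain (τ NEXT) (τ HEAD v) (adjTo S i v))

    link-arc : ∀ {i τ} → i < H → τ hidx 0 ≡ i → Chains i τ →
      Runs ((NEXT [ inc (cell hidx) ]≔ (HEAD [ SRC [ inc (cell hidx) ] ])) ⨾ (HEAD [ SRC [ inc (cell hidx) ] ]≔ inc (cell hidx)))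
        τ 17 (λ τ _ → τ hidx 0 ≡ i × Chains (suc i) (update τ hidx 0 (suc (τ hidx 0))))
    link-arc {i} {τ} i< eqi (same , ch) =
      R-then-at (suc i) (τ HEAD w) (cong suc eqi) (cong (τ HEAD) src) (R-assign-at {b = 0} w (suc i) src (cong suc eqi)
        (eqi , ≈-update hidx (SRC ∷ arcs ∷ []) tt (≈-update HEAD (SRC ∷ arcs ∷ []) tt (≈-update NEXT (SRC ∷ arcs ∷ []) tt same)) ,
         λ {v} v< → new v< (w ≟ v)))
      where
      w = S (suc i)
      src : τ SRC (suc (τ hidx 0)) ≡ w
      src = trans (same SRC tt _) (cong (S ∘ suc) eqi)
      next′ = set (τ NEXT) (suc i) (τ HEAD w)
      old : ∀ {v p} → Chain (τ NEXT) p (adjTo S i v) → Chain next′ p (adjTo S i v)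
      old = chain-map λ h∈ → let h , eq , h< , _ = ∈-adjTo⁻ S h∈ in
        set-other (τ NEXT) (suc i) (τ HEAD w) (λ eq′ → <⇒≢ h< (suc-injective (trans (sym eq) eq′)))
      new : ∀ {v} → v < N → Dec (w ≡ v) → Chain next′ (set (τ HEAD) w (suc i) v) (adjTo S (suc i) v)
      new {v} v< (yes refl) = subst₂ (Chain next′) (sym (set-same (τ HEAD) w (suc i) refl)) (sym (adjTo-yes S i refl))
        (link (λ ()) (subst (λ p → Chain next′ p (adjTo S i w)) (sym (set-same (τ NEXT) (suc i) (τ HEAD w) refl)) (old (ch v<))))
      new {v} v< (no w≢v) = subst₂ (Chain next′) (sym (set-other (τ HEAD) w (suc i) (w≢v ∘ sym))) (sym (adjTo-no S i w≢v)) (old (ch v<))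

  build-runs : Runs build σ ((N * 15 + 9) + (H * 28 + 9)) (λ τ _ → ∀ {v} → v < N → Chain (τ NEXT) (τ HEAD v) (adjTo S H v))
  build-runs = R-seq′ (R-frame (SRC ∷ arcs ∷ []) tt
      (clear-runs HEAD (cell names) N σ (λ ()) λ same → trans (same names (λ ()) (λ ()) 0) eqN))
    λ { {τ} (zeros , same) → R-map proj₂ (R-for′ Chains H 17 (λ { (st , _) → trans (st arcs tt 0) eqH }) link-arc
          (≈-update hidx (SRC ∷ arcs ∷ []) tt same , λ {v} v< → subst (λ p → Chain (τ NEXT) p []) (sym (zeros v v<)) nil)) }

Arc : Memory → ℕ → Arcs
Arc σ H a b e = ∃[ h ] h < H × σ SRC (suc h) ≡ a × σ TGT (suc h) ≡ b × σ LBL (suc h) ≡ e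

-- The table also holds the arcs of other nodes and the remains of earlier disks; asking for a
-- source in `verts` singles out those of this node.
record LinkedTo {n r : ℕ} (σ : Memory) (H : ℕ) (ν : Node n r) : Set where
  open Node ν
  field
    arc→κ : ∀ {a b e} → a ∈ verts → Arc σ H a b e → κ a b e
    κ→arc : ∀ {a b e} → κ a b e → Arc σ H a b e

linked-≈ : ∀ {n r σ τ H} {ν : Node n r} → τ ≈[ SRC ∷ TGT ∷ LBL ∷ [] ] σ → LinkedTo σ H ν → LinkedTo τ H ν
linked-≈ same lk = record
  { arc→κ = λ a∈ (h , h< , s , t , l) → arc→κ a∈ (h , h< , trans (sym (same SRC tt _)) s , trans (sym (same TGT tt _)) t , trans (sym (same LBL tt _)) l)
  ; κ→arc = λ k → let h , h< , s , t , l = κ→arc k in h , h< , trans (same SRC tt _) s , trans (same TGT tt _) t , trans (same LBL tt _) l }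
  where open LinkedTo lk

module _ {n r : ℕ} {ν : Node n r} {σ τ : Memory} {H N : ℕ} (lk : LinkedTo σ H ν) where
  open Node ν

  adjacency : τ ≈[ SRC ∷ TGT ∷ LBL ∷ [] ] σ → (∀ {v} → v ∈ verts → v < N) →
              (∀ {v} → v < N → Chain (τ NEXT) (τ HEAD v) (adjTo (σ SRC) H v)) →
              Adjacency verts κ (adjTo (σ SRC) H) τ
  adjacency same verts<N chains = record
    { chain = λ v∈ → chains (verts<N v∈)
    ; arc⁺ = λ {v} v∈ h∈ → case ∈-adjTo⁻ (σ SRC) {H} {v = v} h∈ of λ
        { (h , refl , h< , eq) → arc→κ v∈ (h , h< , trans (same SRC tt _) eq , refl , refl) }
    ; arc⁻ = λ k → let h , h< , s , t , _ = κ→arc k in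
        suc h , ∈-adjTo⁺ (σ SRC) h< (trans (sym (same SRC tt _)) s) , t }
    where open LinkedTo (linked-≈ same lk)

module _ {n r : ℕ} (ν : Node n r) where
  open Node ν

  -- A search finds the vertices in an order of its own. The graph stays the same and only its
  -- enumeration is adapted to what is stored in `NODE`.
  relist : (ws : List ℕ) → Unique ws → ws ⊆ verts → verts ⊆ ws → Node n r
  relist ws un sub sup = record
    { rep = rep ; verts = ws ; κ = κ ; κ-sym = κ-sym
    ; κ-in = λ k → let a∈ , b∈ = κ-in k in sup a∈ , sup b∈
    ; uniq = un ; rep∈ = sup rep∈ ; connected = connected ∘ sub
    ; separable = λ Z Z⊆ small → let c , c∈ , bal = separable Z (sub ∘ Z⊆) small in c , sup c∈ , bal }

module Gather {n r : ℕ} (ν : Node n r) (adj : ℕ → List ℕ) (μ : Memory) (N : ℕ)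
  (μ-n     : μ SIZES 0 ≡ n)
  (adjc    : Adjacency (Node.verts ν) (Node.κ ν) adj μ)
  (μ-N     : μ names 0 ≡ N)
  (μ-rep   : μ nodeRep 0 ≡ Node.rep ν)
  (verts<N : ∀ {v} → v ∈ Node.verts ν → v < N)
  where
  open Node ν hiding (uniq)
  open Adjacency adjc
  open Search n verts κ adj μ μ-n chain arc⁺ arc⁻ κ-in public

  record Gathered (τ : Memory) : Set where
    field
      list     : List ℕ
      list-un  : Unique list
      list-sub : list ⊆ verts
      list-sup : verts ⊆ list
      stored   : Seg (τ NODE) 0 list
      len      : τ nodeLen 0 ≡ length list
      sz       : τ nodeSize 0 ≡ length (nonmetas n list)
      near     : ∀ {v} → v ∈ list → Ball κ rep (length list) v

  gatherCost : ℕ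
  gatherCost = (N * 15 + 9) + (11 + (39 + (weight verts * 71 + (6 + (8 + (length verts * 17 + 9))))))

  private
    static₀ : List ℕ
    static₀ = names ∷ nodeRep ∷ searchStatic

  gather-runs : Runs gather μ gatherCost (λ τ _ → Gathered τ)
  gather-runs = R-seq′ (R-frame static₀ tt
      (clear-runs VIS (cell names) N μ (λ ()) λ same → trans (same names (λ ()) (λ ()) 0) μ-N))
    λ { {τ} (zeros , same) → cleared zeros same }
    where
    L = length verts
    cleared : ∀ {τ} → (∀ v → v < N → τ VIS v ≡ 0) → τ ≈[ static₀ ] μ → Runs _ τ _ (λ τ _ → Gathered τ)
    cleared {τ} zeros same =
      R-then-at 0 rep refl (trans (same nodeRep tt 0) μ-rep) (R-then-at 0 N refl (trans (same names tt 0) μ-N) (R-then-at 0 1 refl refl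
      (R-seq (search-runs {σ = τ₃} {un = verts} (8 + (L * 17 + 9)) (weight verts)
          (≈-update colour searchStatic tt (≈-update limit searchStatic tt (≈-update start searchStatic tt (≈-⊆ searchStatic static₀ tt same))))
          refl refl refl (λ _ → refl) rep∈ (zeros rep (verts<N rep∈)) (λ v∈ _ → v∈) refl ≤-refl)
        λ { (qs , un , it , d , w≤ , refl) → R-≤ (m≤n+m _ (it * 71)) (searched d) })))
      where
      τ₃ = update (update (update τ start 0 rep) limit 0 N) colour 0 1
      open Run (τ VIS) rep N 1 L (λ ())
      searched : ∀ {υ qs un} → Done υ qs un →
        Runs ((nodeLen :≔ cell qtail) ⨾ (nodeSize :≔ cell count) ⨾ for cidx (cell nodeLen) (NODE [ cell cidx ]≔ (QUEUE [ cell cidx ])))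
          υ (8 + (L * 17 + 9)) (λ τ _ → Gathered τ)
      searched {υ} {qs} d = R-then-at 0 (length qs) refl F.tail (R-then-at 0 (length (nonmetas n qs)) refl F.cnt
        (R-≤ (+-monoˡ-≤ 9 (*-monoˡ-≤ 17 (length-mono-⊆ F.uniq F.inV)))
        (R-map finish (R-for′ Copied (length qs) 6 (λ { (st , _) → st nodeLen tt 0 }) copy
          (≈-update cidx kept tt (≈-refl {kept} {υ₂}) , λ _ ())))))
        where
        module F = Found d
        υ₂ = update (update υ nodeLen 0 (length qs)) nodeSize 0 (length (nonmetas n qs))
        kept : List ℕ
        kept = QUEUE ∷ nodeLen ∷ nodeSize ∷ []
        Copied : ℕ → Memory → Set
        Copied i τ = τ ≈[ kept ] υ₂ × (∀ j → j < i → τ NODE j ≡ υ QUEUE j)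
        copy : ∀ {i τ} → i < length qs → τ cidx 0 ≡ i → Copied i τ →
          Runs (NODE [ cell cidx ]≔ (QUEUE [ cell cidx ])) τ 6 (λ τ _ → τ cidx 0 ≡ i × Copied (suc i) (update τ cidx 0 (suc (τ cidx 0))))
        copy {i} {τ} i< eqi (st , cp) = R-assign-at {b = 0} i (υ QUEUE i) eqi (trans (st QUEUE tt _) (cong (υ QUEUE) eqi))
          (eqi , ≈-update cidx kept tt (≈-update NODE kept tt st) , λ j j< → value j j< (j ≟ i))
          where
          value : ∀ j → j < suc i → Dec (j ≡ i) → set (τ NODE) i (υ QUEUE i) j ≡ υ QUEUE j
          value j j< (yes refl) = set-same (τ NODE) i (υ QUEUE i) refl
          value j j< (no j≢i)   = trans (set-other (τ NODE) i (υ QUEUE i) j≢i) (cp j (≤∧≢⇒< (s≤s⁻¹ j<) j≢i))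
        finish : ∀ {τ} → Copied (length qs) τ → Gathered τ
        finish (st , cp) = record
          { list = qs ; list-un = F.uniq ; list-sub = F.inV
          ; list-sup = λ v∈ → reached F.s∈ (proj₂ (connected v∈))
          ; stored = seg-map cp F.queue
          ; len = st nodeLen tt 0 ; sz = st nodeSize tt 0
          -- Depths are below the number of vertices by `short`, which provides a valid starting
          -- radius for the choice of a disk.
          ; near = λ {v} v∈ → let k , eq = F.depth v∈ in
              k , <⇒≤ (+-cancelʳ-< (υ REM v) k (length qs) (≤-trans (s≤s (≤-reflexive eq)) (≤-trans (F.short v∈) (≤-reflexive (+-comm (υ REM v) _))))) ,
              mapPath (λ { (e , _) → _ , e }) (F.tree-path k v∈ eq) }
          where
          order≤N : length qs ≤ N
          order≤N = length-below F.uniq (All.tabulate (verts<N ∘ F.inV))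
          reached : ∀ {a b j} → a ∈ qs → Path ∥ κ ∥ a b j → b ∈ qs
          reached a∈ ε             = a∈
          reached a∈ ((_ , e) ◅ p) = reached (F.closure order≤N a∈ e (zeros _ (verts<N (proj₂ (κ-in e))))) p

-- For a mark other than 0 and 1, its predecessor is the name of the contracted vertex belonging to
-- the component. For vertices of the disk and of other nodes the predecessor is 0.
data Redirect (V : ℕ → ℕ) (a b : ℕ) : ℕ → ℕ → Set where
  other : V a ≡ 0 → Redirect V a b a b
  loop  : V a ≡ 1 → V b ∸ 1 ≡ 0 → Redirect V a b b b
  enter : V a ≡ 1 → V b ∸ 1 ≢ 0 → Redirect V a b (V b ∸ 1) b
  leave : V a ∸ 1 ≢ 0 → V b ∸ 1 ≡ 0 → Redirect V a b a (V a ∸ 1)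
  stay  : V a ∸ 1 ≢ 0 → V b ∸ 1 ≢ 0 → Redirect V a b a b

module _ {σ : Memory} {H : ℕ} (eqH : σ arcs 0 ≡ H) where
  private
    V S T′ : ℕ → ℕ
    V  = σ VIS
    S  = σ SRC
    T′ = σ TGT

    kept : List ℕ
    kept = VIS ∷ arcs ∷ []

    Moved : ℕ → Memory → Set
    Moved i τ = τ ≈[ kept ] σ ×
      (∀ {h} → h < i → Redirect V (S (suc h)) (T′ (suc h)) (τ SRC (suc h)) (τ TGT (suc h))) ×
      (∀ {h} → i ≤ h → τ SRC (suc h) ≡ S (suc h) × τ TGT (suc h) ≡ T′ (suc h))

    After : ℕ → Memory → ℕ → Set
    After i τ _ = τ ridx 0 ≡ i × Moved (suc i) (update τ ridx 0 (suc (τ ridx 0)))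

    one : ∀ x → x ≢ 0 → x ∸ 1 ≡ 0 → x ≡ 1
    one zero          nz _ = contradiction refl nz
    one (suc zero)    _  _ = refl

    move : ∀ {i τ} → i < H → τ ridx 0 ≡ i → Moved i τ → Runs redirectArc τ 33 (After i)
    move {i} {τ} i< eqi (st , done , todo) = R-if
      (λ a≢0 → R-if
        (λ a≢1 → R-if
          (λ b≢1 → R-≤ (≤ᵇ⇒≤ 1 11 tt) (R-skip {b = 0} (unchanged (stay (a≢1 ∘ trans va∸1) (b≢1 ∘ trans vb∸1)))))
          (λ b≡1 → R-assign-at {b = 0} (suc i) (V a ∸ 1) (cong suc eqi) va∸1
            (eqi , ≈-update ridx kept tt (≈-update TGT kept tt st) ,
             (λ {h} h< → new-T (h ≟ i) h< (leave (a≢1 ∘ trans va∸1) (trans (sym vb∸1) b≡1))) ,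
             λ {h} h≥ → proj₁ (todo (<⇒≤ h≥)) , trans (set-other (τ TGT) (suc i) _ (λ eq → <⇒≢ h≥ (sym (suc-injective eq)))) (proj₂ (todo (<⇒≤ h≥))))))
        (λ a≡1 → R-if
          (λ b≢1 → R-assign-at {b = 0} (suc i) (V b ∸ 1) (cong suc eqi) vb∸1
            (redirected-S (enter (one (V a) (a≢0 ∘ trans va) (trans (sym va∸1) a≡1)) (b≢1 ∘ trans vb∸1))))
          (λ b≡1 → R-≤ (≤ᵇ⇒≤ 8 11 tt) (R-assign-at {b = 0} (suc i) b (cong suc eqi) tgt
            (redirected-S (loop (one (V a) (a≢0 ∘ trans va) (trans (sym va∸1) a≡1)) (trans (sym vb∸1) b≡1)))))))
      (λ a≡0 → R-≤ (≤ᵇ⇒≤ 1 27 tt) (R-skip {b = 0} (unchanged (other (trans (sym va) a≡0)))))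
      where
      a b : ℕ
      a = S (suc i)
      b = T′ (suc i)
      src : τ SRC (suc (τ ridx 0)) ≡ a
      src = trans (cong (τ SRC ∘ suc) eqi) (proj₁ (todo ≤-refl))
      tgt : τ TGT (suc (τ ridx 0)) ≡ b
      tgt = trans (cong (τ TGT ∘ suc) eqi) (proj₂ (todo ≤-refl))
      va : τ VIS (τ SRC (suc (τ ridx 0))) ≡ V a
      va = trans (st VIS tt _) (cong V src)
      va∸1 : τ VIS (τ SRC (suc (τ ridx 0))) ∸ 1 ≡ V a ∸ 1
      va∸1 = cong (_∸ 1) va
      vb∸1 : τ VIS (τ TGT (suc (τ ridx 0))) ∸ 1 ≡ V b ∸ 1
      vb∸1 = cong (_∸ 1) (trans (st VIS tt _) (cong V tgt))
      unchanged : Redirect V a b a b → After i τ 0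
      unchanged rd = eqi , ≈-update ridx kept tt st , (λ {h} h< → value (h ≟ i) h<) , λ h≥ → todo (<⇒≤ h≥)
        where
        value : ∀ {h} → Dec (h ≡ i) → h < suc i → Redirect V (S (suc h)) (T′ (suc h)) (τ SRC (suc h)) (τ TGT (suc h))
        value (yes refl) _  = subst₂ (Redirect V a b) (sym (proj₁ (todo ≤-refl))) (sym (proj₂ (todo ≤-refl))) rd
        value (no h≢i)   h< = done (≤∧≢⇒< (s≤s⁻¹ h<) h≢i)
      new-T : ∀ {h x} → Dec (h ≡ i) → h < suc i → Redirect V a b a x →
        Redirect V (S (suc h)) (T′ (suc h)) (τ SRC (suc h)) (set (τ TGT) (suc i) x (suc h))
      new-T {x = x} (yes refl) _ rd = subst₂ (Redirect V a b) (sym (proj₁ (todo ≤-refl))) (sym (set-same (τ TGT) (suc i) x refl)) rd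
      new-T {h} {x} (no h≢i) h< _ = subst (Redirect V (S (suc h)) (T′ (suc h)) (τ SRC (suc h)))
        (sym (set-other (τ TGT) (suc i) x (h≢i ∘ suc-injective))) (done (≤∧≢⇒< (s≤s⁻¹ h<) h≢i))
      redirected-S : ∀ {x} → Redirect V a b x b → After i (update τ SRC (suc i) x) 0
      redirected-S {x} rd = eqi , ≈-update ridx kept tt (≈-update SRC kept tt st) ,
        (λ {h} h< → value (h ≟ i) h<) ,
        λ {h} h≥ → trans (set-other (τ SRC) (suc i) x (λ eq → <⇒≢ h≥ (sym (suc-injective eq)))) (proj₁ (todo (<⇒≤ h≥))) , proj₂ (todo (<⇒≤ h≥))
        where
        value : ∀ {h} → Dec (h ≡ i) → h < suc i → Redirect V (S (suc h)) (T′ (suc h)) (set (τ SRC) (suc i) x (suc h)) (τ TGT (suc h))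
        value (yes refl) _ = subst₂ (Redirect V a b) (sym (set-same (τ SRC) (suc i) x refl)) (sym (proj₂ (todo ≤-refl))) rd
        value {h} (no h≢i) h< = subst (λ y → Redirect V (S (suc h)) (T′ (suc h)) y (τ TGT (suc h)))
          (sym (set-other (τ SRC) (suc i) x (h≢i ∘ suc-injective))) (done (≤∧≢⇒< (s≤s⁻¹ h<) h≢i))

  redirect-runs : Runs redirect σ (H * 44 + 9)
    (λ τ _ → ∀ {h} → h < H → Redirect V (S (suc h)) (T′ (suc h)) (τ SRC (suc h)) (τ TGT (suc h)))
  redirect-runs = R-map (proj₁ ∘ proj₂) (R-for′ Moved H 33 (λ { (st , _) → trans (st arcs tt 0) eqH }) move
    (≈-update ridx kept tt (≈-refl {kept} {σ}) , (λ ()) , λ _ → refl , refl))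

-- The potential and the error reserve

-- Doubling raises the logarithm by one. The case k = 0, with logarithm 0, needs s ≥ 2.
lg-half : ∀ k s → 2 ≤ s → 2 * k ≤ s → suc ⌊log₂ k ⌋ ≤ ⌊log₂ s ⌋
lg-half zero      s 2≤s _  = ⌊log₂⌋-mono-≤ 2≤s
lg-half k@(suc _) s _   le = ≤-trans (≤-reflexive (sym (⌊log₂[2*b]⌋≡1+⌊log₂b⌋ k))) (⌊log₂⌋-mono-≤ le)

on : (ℕ → ℕ) → ℕ → Set
on f e = f e ≢ 0

_⊑_ : (ℕ → ℕ) → (ℕ → ℕ) → Set
f ⊑ g = ∀ {e} → f e ≢ 0 → g e ≢ 0

↾-mono : ∀ {κ f g a b} → f ⊑ g → (κ ↾ on f) a b → (κ ↾ on g) a b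
↾-mono sub (e , k , h) = e , k , sub h

Φ₁ : ∀ {n r} → Node n r → ℕ
Φ₁ ν = (length (Node.verts ν) ∸ 1) * ⌊log₂ Node.size ν ⌋

Φ : ∀ {n r} → List (Node n r) → ℕ
Φ []       = 0
Φ (ν ∷ νs) = Φ₁ ν + Φ νs

Φ-∷ʳ : ∀ {n r} (νs : List (Node n r)) ν → Φ (νs ∷ʳ ν) ≡ Φ νs + Φ₁ ν
Φ-∷ʳ []       ν = +-identityʳ (Φ₁ ν)
Φ-∷ʳ (ν′ ∷ νs) ν = trans (cong (Φ₁ ν′ +_) (Φ-∷ʳ νs ν)) (sym (+-assoc (Φ₁ ν′) _ _))

-- The representatives of the waiting nodes are the consecutive names from y on.
Reps : ∀ {n r} → ℕ → List (Node n r) → ℕ → Set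
Reps y []       N = y ≡ N
Reps y (ν ∷ νs) N = Node.rep ν ≡ y × Reps (suc y) νs N

reps-∷ʳ : ∀ {n r y N} (νs : List (Node n r)) {ν} → Reps y νs N → Node.rep ν ≡ N → Reps y (νs ∷ʳ ν) (suc N)
reps-∷ʳ []       refl       eq = eq , refl
reps-∷ʳ (_ ∷ νs) (eq′ , rs) eq = eq′ , reps-∷ʳ νs rs eq

Disjoint : ∀ {n r} → Node n r → Node n r → Set
Disjoint ν ν′ = ∀ {v} → v ∈ Node.verts ν → v ∈ Node.verts ν′ → ⊥

Below : ∀ {n r} → ℕ → Node n r → Set
Below N ν = All (_< N) (Node.verts ν)

-- The walk consists of original vertices only: it has met no disk so far, so no contraction has
-- changed it.
Alive : ∀ {n r} → ℕ → ℕ → ℕ → Node n r → Set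
Alive {n} x y k ν = x ∈ Node.verts ν × x < n × Path (λ a b → ∥ Node.κ ν ∥ a b × b < n) x y k

module Global (n r L : ℕ) (κ₀ : Arcs) where

  -- Marked walks of a node lift to walks of G at the price of an additive error;
  -- every level that remains may add another 2 r.
  Lift : (ℕ → ℕ) → Node n r → Set
  Lift g ν = ∃[ err ] err + 2 * r * ⌊log₂ Node.size ν ⌋ ≤ 2 * r * L ×
    (∀ f → g ⊑ f → ∀ {x y ℓ} → x ∈ Node.verts ν → y ∈ Node.verts ν → x < n → y < n →
       Path (Node.κ ν ↾ on f) x y ℓ → Path≤ (κ₀ ↾ on f) x y (ℓ + err))

  lift-mono : ∀ {g g′ ν} → g ⊑ g′ → Lift g ν → Lift g′ ν
  lift-mono sub (err , le , l) = err , le , λ f sub′ → l f (sub′ ∘ sub)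

  -- When no node is waiting, the second alternative is void and the first is the property of an
  -- additive spanner.
  Cover : (ℕ → ℕ) → List (Node n r) → Set₁
  Cover g νs = ∀ {x y k} → x < n → Path ∥ κ₀ ∥ x y k →
    Path≤ (κ₀ ↾ on g) x y (k + 2 * r * L) ⊎ Any (Alive x y k) νs

  -- This ends the recursion: a walk through original vertices cannot leave the only one there is,
  -- so nodes of size at most 1 are dropped without a division.
  small-alive : ∀ {ν : Node n r} {x y k} → Node.size ν ≤ 1 → Alive x y k ν → x ≡ y
  small-alive {ν} le (x∈ , x<n , p) = go x∈ x<n p
    where
    open Node ν
    single-vertex : ∀ {a b zs} → length zs ≤ 1 → a ∈ zs → b ∈ zs → a ≡ b
    single-vertex {zs = _ ∷ []} _ (here refl) (here refl) = refl
    single-vertex {zs = _ ∷ _ ∷ _} (s≤s ())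
    go : ∀ {x y k} → x ∈ verts → x < n → Path (λ a b → ∥ κ ∥ a b × b < n) x y k → x ≡ y
    go x∈ x<n ε = refl
    go x∈ x<n (((_ , e) , b<n) ◅ p) =
      trans (single-vertex le (∈-nonmetas⁺ x∈ x<n) (∈-nonmetas⁺ (proj₂ (κ-in e)) b<n)) (go (proj₂ (κ-in e)) b<n p)

-- One division and its children

module Division (L : ℕ) (κ₀ : Arcs) {n r : ℕ} (ν : Node n r) (adj : ℕ → List ℕ) (μ : Memory) (N : ℕ)
  (μ-n     : μ SIZES 0 ≡ n)
  (adjc    : Adjacency (Node.verts ν) (Node.κ ν) adj μ)
  (μ-N     : μ names 0 ≡ N)
  (μ-node  : Seg (μ NODE) 0 (Node.verts ν))
  (μ-len   : μ nodeLen 0 ≡ length (Node.verts ν))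
  (μ-size  : μ nodeSize 0 ≡ Node.size ν)
  (verts<N : ∀ {v} → v ∈ Node.verts ν → v < N)
  (n≤N     : n ≤ N)
  where
  open Node ν
  open Global n r L κ₀
  open Trial ν adj μ N μ-n adjc μ-N μ-node μ-len μ-size verts<N

  module At {o ρ : ℕ} {V : ℕ → ℕ} {cs : List (List ℕ)} (marks : Marks V o ρ cs)
    (seen : ∀ {v} → v ∈ verts → V v ≢ 0) (o∈ : o ∈ verts) where
    open Marks marks

    closed′ : ∀ {a b e} → κ a b e → V a ≢ 1 → V b ≢ 1 → V a ≡ V b
    closed′ e = closed e (seen (proj₁ (κ-in e)))

    module Ch {M : ℕ} {C : List ℕ} (N≤M : N ≤ M) (p : Part V o ρ M C) =
      Child ν o ρ V M C o∈ disk⁺ disk⁻ closed′ (Part.inside p) (Part.whole p) (Part.C-uniq p)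
        (λ M≡0 → N≢0 (n≤0⇒n≡0 (≤-trans N≤M (≤-reflexive M≡0)))) (≤-trans n≤N N≤M) (λ M∈ → <⇒≱ (verts<N M∈) N≤M)

    -- Components are listed with the latest, hence largest, name first. Appending the tail before
    -- the head restores the increasing order that `Reps` demands.
    addAll : ∀ {ds} → List (Node n r) → Parts V o ρ ds → List (Node n r)
    addAll rest []       = rest
    addAll rest (p ∷ ps) = addAll rest ps ∷ʳ Ch.child (m≤m+n N _) p

    addAll-reps : ∀ {y rest ds} (ps : Parts V o ρ ds) → Reps y rest N → Reps y (addAll rest ps) (N + length ds)
    addAll-reps {y} {rest} []       rs = subst (Reps y rest) (sym (+-identityʳ N)) rs
    addAll-reps {y} {rest} (_∷_ {cs = ds} p ps) rs = subst (Reps y (addAll rest (p ∷ ps))) (sym (+-suc N (length ds)))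
      (reps-∷ʳ (addAll rest ps) (addAll-reps ps rs) refl)

    addAll-all : ∀ {ℓ} {P : Node n r → Set ℓ} {rest ds} (ps : Parts V o ρ ds) → (∀ {C} → C ∈ ds → C ∈ cs) → All P rest →
      (∀ {M C} (N≤M : N ≤ M) (p : Part V o ρ M C) → C ∈ cs → M < N + length ds → P (Ch.child N≤M p)) → All P (addAll rest ps)
    addAll-all []       sub all h = all
    addAll-all (p ∷ ps) sub all h = All.++⁺
      (addAll-all ps (sub ∘ there) all λ le q C∈ M< → h le q C∈ (<-≤-trans M< (+-monoʳ-≤ N (n≤1+n _))))
      (h (m≤m+n N _) p (sub (here refl)) (+-monoʳ-< N ≤-refl) ∷ [])

    addAll-rest : ∀ {ℓ} {P : Node n r → Set ℓ} {rest ds} (ps : Parts V o ρ ds) → Any P rest → Any P (addAll rest ps)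
    addAll-rest []       any = any
    addAll-rest (p ∷ ps) any = Any.++⁺ˡ (addAll-rest ps any)

    addAll-child : ∀ {ℓ} {P : Node n r → Set ℓ} {rest ds C} (ps : Parts V o ρ ds) → C ∈ ds →
      (∀ {M} (N≤M : N ≤ M) (p : Part V o ρ M C) → P (Ch.child N≤M p)) → Any P (addAll rest ps)
    addAll-child {rest = rest} (p ∷ ps) (here refl) h = Any.++⁺ʳ (addAll rest ps) (here (h (m≤m+n N _) p))
    addAll-child (p ∷ ps) (there C∈)  h = Any.++⁺ˡ (addAll-child ps C∈ h)

    child-avoids : ∀ {M C v} (N≤M : N ≤ M) (p : Part V o ρ M C) → v < N → v ∉ verts → v ∉ Node.verts (Ch.child N≤M p)
    child-avoids N≤M p v<N v∉ (here refl) = <⇒≱ v<N N≤M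
    child-avoids N≤M p v<N v∉ (there v∈)  = v∉ (proj₁ (Part.inside p v∈))

    children-disjoint : ∀ {M C M′ C′} (N≤M : N ≤ M) (p : Part V o ρ M C) (N≤M′ : N ≤ M′) (p′ : Part V o ρ M′ C′) →
      M ≢ M′ → Disjoint (Ch.child N≤M p) (Ch.child N≤M′ p′)
    children-disjoint N≤M p N≤M′ p′ M≢ (here refl) (here refl) = M≢ refl
    children-disjoint N≤M p N≤M′ p′ M≢ (here refl) (there v∈)  = <⇒≱ (verts<N (proj₁ (Part.inside p′ v∈))) N≤M
    children-disjoint N≤M p N≤M′ p′ M≢ (there v∈)  (here refl) = <⇒≱ (verts<N (proj₁ (Part.inside p v∈))) N≤M′
    children-disjoint N≤M p N≤M′ p′ M≢ (there v∈)  (there v∈′) =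
      M≢ (suc-injective (trans (sym (proj₂ (Part.inside p v∈))) (proj₂ (Part.inside p′ v∈′))))

    addAll-disjoint : ∀ {rest ds} (ps : Parts V o ρ ds) → (∀ {C} → C ∈ ds → C ∈ cs) →
      All (Below N) rest → All (Disjoint ν) rest →
      AllPairs Disjoint rest → AllPairs Disjoint (addAll rest ps)
    addAll-disjoint []       sub small away dis = dis
    addAll-disjoint {rest} (_∷_ {cs = ds} p ps) sub small away dis = allPairs-∷ʳ (addAll-disjoint ps (sub ∘ there) small away dis)
      (addAll-all {P = λ ν′ → Disjoint ν′ (Ch.child (m≤m+n N _) p)} ps (sub ∘ there)
        (All.zipWith (λ { (lt , aw) v∈ → child-avoids (m≤m+n N _) p (All.lookup lt v∈) (λ v∈ν → aw v∈ν v∈) }) (small , away))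
        λ le q _ M< → children-disjoint le q (m≤m+n N _) p (<⇒≢ M<))

    addAll-length : ∀ {rest ds} (ps : Parts V o ρ ds) → length (addAll rest ps) ≡ length rest + length ds
    addAll-length {rest} []       = sym (+-identityʳ _)
    addAll-length {rest} (p ∷ ps) = trans (length-∷ʳ (addAll rest ps) _) (trans (cong suc (addAll-length ps)) (sym (+-suc (length rest) _)))

    parts-nonempty : ∀ {ds} → Parts V o ρ ds → length ds ≤ length (concat ds)
    parts-nonempty []       = z≤n
    parts-nonempty (_∷_ {C = C} p ps) = ≤-trans (+-mono-≤ (nonempty (Part.root-in p)) (parts-nonempty ps)) (≤-reflexive (sym (length-++ C)))
      where
      nonempty : ∀ {x} {xs : List ℕ} → x ∈ xs → 1 ≤ length xs
      nonempty (here _)  = s≤s z≤n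
      nonempty (there _) = s≤s z≤n

    module _ (2≤size : 2 ≤ size) (bal : Balanced κ Z o ρ) where

      child-lg : ∀ {M C} (N≤M : N ≤ M) (p : Part V o ρ M C) → suc ⌊log₂ Node.size (Ch.child N≤M p) ⌋ ≤ ⌊log₂ size ⌋
      child-lg {C = C} N≤M p = ≤-trans (≤-reflexive (cong (suc ∘ ⌊log₂_⌋) (Ch.child-size N≤M p)))
        (lg-half (length (nonmetas n C)) size 2≤size (balanced⇒half p bal))

      -- The contracted vertex is the one that the potential subtracts, so a child contributes the
      -- number of vertices in its component times at most the lowered logarithm.
      addAll-Φ : ∀ {rest ds} (ps : Parts V o ρ ds) → Φ (addAll rest ps) ≤ Φ rest + length (concat ds) * (⌊log₂ size ⌋ ∸ 1)
      addAll-Φ {rest} []       = m≤m+n (Φ rest) 0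
      addAll-Φ {rest} (_∷_ {C} {ds} p ps) = begin
        Φ (addAll rest ps ∷ʳ ν′)                       ≡⟨ Φ-∷ʳ (addAll rest ps) ν′ ⟩
        Φ (addAll rest ps) + length C * ⌊log₂ Node.size ν′ ⌋ ≤⟨ +-mono-≤ (addAll-Φ {rest} ps) (*-monoʳ-≤ (length C) (∸-monoˡ-≤ 1 (child-lg (m≤m+n N _) p))) ⟩
        Φ rest + length (concat ds) * g + length C * g ≡⟨ solve 4 (λ a b c g → a :+ b :* g :+ c :* g := a :+ (c :+ b) :* g) refl (Φ rest) (length (concat ds)) (length C) g ⟩
        Φ rest + (length C + length (concat ds)) * g   ≡⟨ cong (λ l → Φ rest + l * g) (sym (length-++ C)) ⟩
        Φ rest + length (C ++ concat ds) * g           ∎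
        where
        open ≤-Reasoning
        open +-*-Solver
        g  = ⌊log₂ size ⌋ ∸ 1
        ν′ = Ch.child (m≤m+n N (length ds)) p

      Φ-drop : ∀ {rest ds} (ps : Parts V o ρ ds) → suc (length (concat ds)) ≤ length verts →
        (length verts ∸ 1) + Φ (addAll rest ps) ≤ Φ₁ ν + Φ rest
      Φ-drop {rest} {ds} ps small = begin
        l + Φ (addAll rest ps)                    ≤⟨ +-monoʳ-≤ l (addAll-Φ {rest} ps) ⟩
        l + (Φ rest + length (concat ds) * g)     ≤⟨ +-monoʳ-≤ l (+-monoʳ-≤ (Φ rest) (*-monoˡ-≤ g (∸-monoˡ-≤ 1 small))) ⟩
        l + (Φ rest + l * g)                      ≡⟨ solve 3 (λ l p g → l :+ (p :+ l :* g) := l :* (con 1 :+ g) :+ p) refl l (Φ rest) g ⟩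
        l * suc g + Φ rest                        ≡⟨ cong (λ x → l * x + Φ rest) (m+[n∸m]≡n (⌊log₂⌋-mono-≤ 2≤size)) ⟩
        l * ⌊log₂ size ⌋ + Φ rest                 ∎
        where
        open ≤-Reasoning
        open +-*-Solver
        l = length verts ∸ 1
        g = ⌊log₂ size ⌋ ∸ 1

      module _ (ρ≤r : ρ ≤ r) {g g′ : ℕ → ℕ} (g⊑g′ : g ⊑ g′)
               (geo : ∀ {k v} → Path ∥ κ ∥ o v k → Path≤ (κ ↾ on g′) o v k) where

        geo≤ : ∀ {k v} → Path≤ ∥ κ ∥ o v k → Path≤ (κ ↾ on g′) o v k
        geo≤ (_ , le , p) = weaken le (geo p)

        -- A node that is divided has at least one level left, and this level pays for the detour
        -- through the center.
        2r≤ : 2 * r ≤ 2 * r * ⌊log₂ size ⌋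
        2r≤ = ≤-trans (≤-reflexive (sym (*-identityʳ (2 * r)))) (*-monoʳ-≤ (2 * r) (⌊log₂⌋-mono-≤ 2≤size))

        -- Undoing the contraction adds at most 2r to the error, and the child has at least one
        -- level less than its parent; so error plus reserve does not grow.
        child-lift : ∀ {M C} (N≤M : N ≤ M) (p : Part V o ρ M C) → Lift g ν → Lift g′ (Ch.child N≤M p)
        child-lift {M} {C} N≤M p (err , le , lift) = err + 2 * r , ≤-trans bound le ,
          λ f g′⊑f {ℓ = ℓ} x∈ y∈ x<n y<n path →
            let j , j≤ , q = Ch.expand≤ N≤M p (λ v∈ d → mapPath≤ (↾-mono {κ} {g′} {f} g′⊑f) (geo≤ (disk⁺ v∈ d)))
                               (in-C x∈ x<n) (in-C y∈ y<n) path
            in weaken (total {ℓ = ℓ} j≤) (lift f (g′⊑f ∘ g⊑g′)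
                 (proj₁ (Part.inside p (in-C x∈ x<n))) (proj₁ (Part.inside p (in-C y∈ y<n))) x<n y<n q)
          where
          open +-*-Solver
          in-C : ∀ {x} → x ∈ M ∷ C → x < n → x ∈ C
          in-C (here refl) x<n = contradiction (≤-trans n≤N N≤M) (<⇒≱ x<n)
          in-C (there x∈)  _   = x∈
          total : ∀ {j ℓ} → j ≤ ℓ + 2 * ρ → j + err ≤ ℓ + (err + 2 * r)
          total {j} {ℓ} j≤ = ≤-trans (+-monoˡ-≤ err (≤-trans j≤ (+-monoʳ-≤ ℓ (*-monoʳ-≤ 2 ρ≤r))))
            (≤-reflexive (solve 3 (λ l r e → l :+ con 2 :* r :+ e := l :+ (e :+ con 2 :* r)) refl ℓ r err))
          lg′ = ⌊log₂ Node.size (Ch.child N≤M p) ⌋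
          bound : err + 2 * r + 2 * r * lg′ ≤ err + 2 * r * ⌊log₂ size ⌋
          bound = ≤-trans (≤-reflexive (solve 3 (λ e r l → e :+ con 2 :* r :+ con 2 :* r :* l := e :+ con 2 :* r :* (con 1 :+ l)) refl err r lg′))
            (+-monoʳ-≤ err (*-monoʳ-≤ (2 * r) (child-lg N≤M p)))

        cover-step : ∀ {rest} → Lift g ν → (ps : Parts V o ρ cs) → Cover g (ν ∷ rest) → Cover g′ (addAll rest ps)
        cover-step {rest} (err , le , lift) ps cover {x} {y} {k} x<n walk with cover x<n walk
        ... | inj₁ p = inj₁ (mapPath≤ (↾-mono {κ₀} {g} {g′} g⊑g′) p)
        ... | inj₂ (there any) = inj₂ (addAll-rest ps any)
        ... | inj₂ (here (x∈ , _ , p)) with meets (λ v → V v ≟ 1) p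
        ...   | inj₁ (x∉D , q) with C , C∈ , x∈C ← covered x∈ (seen x∈) x∉D =
          inj₂ (addAll-child ps C∈ λ N≤M part → there x∈C , x<n , Ch.alive-child N≤M part x∈C q)
        ...   | inj₂ (w , i , j , refl , d , p₁ , p₂) = inj₁ (weaken bound (proj₂ (proj₂ lifted)))
          where
          open +-*-Solver
          plain : ∀ {a b l} → Path (λ a b → ∥ κ ∥ a b × b < n) a b l → Path ∥ κ ∥ a b l
          plain = mapPath proj₁
          end<n : ∀ {a b l} → a < n → Path (λ a b → ∥ κ ∥ a b × b < n) a b l → b < n
          end<n a<n ε               = a<n
          end<n a<n ((_ , b<n) ◅ p) = end<n b<n p
          w∈ = path-end x∈ (plain p₁)
          y∈ = path-end w∈ (plain p₂)
          o→x : Path≤ (κ ↾ on g′) o x (ρ + i)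
          o→x = geo≤ (disk⁺ w∈ d ◅◅≤ exactly (reversePath ∥κ∥-sym (plain p₁)))
          o→y : Path≤ (κ ↾ on g′) o y (ρ + j)
          o→y = geo≤ (disk⁺ w∈ d ◅◅≤ exactly (plain p₂))
          x→y : Path≤ (κ ↾ on g′) x y ((ρ + i) + (ρ + j))
          x→y = reversePath≤ ↾-sym o→x ◅◅≤ o→y
          lifted : ∃[ l ] l ≤ (ρ + i) + (ρ + j) × Path≤ (κ₀ ↾ on g′) x y (l + err)
          lifted = let l , l≤ , q = x→y in l , l≤ , lift g′ g⊑g′ x∈ y∈ x<n (end<n (end<n x<n p₁) p₂) q
          bound : proj₁ lifted + err ≤ i + j + 2 * r * L
          bound = begin
            proj₁ lifted + err           ≤⟨ +-monoˡ-≤ err (proj₁ (proj₂ lifted)) ⟩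
            (ρ + i) + (ρ + j) + err      ≡⟨ solve 4 (λ s i j e → (s :+ i) :+ (s :+ j) :+ e := i :+ j :+ (e :+ con 2 :* s)) refl ρ i j err ⟩
            i + j + (err + 2 * ρ)        ≤⟨ +-monoʳ-≤ (i + j) (+-monoʳ-≤ err (≤-trans (*-monoʳ-≤ 2 ρ≤r) 2r≤)) ⟩
            i + j + (err + 2 * r * ⌊log₂ size ⌋) ≤⟨ +-monoʳ-≤ (i + j) le ⟩
            i + j + 2 * r * L            ∎
            where open ≤-Reasoning

    module _ {H : ℕ} {σ τ : Memory} (V≡ : ∀ v → σ VIS v ≡ V v) (lk : LinkedTo σ H ν)
      (ends : ∀ {h} → h < H → σ SRC (suc h) < N × σ TGT (suc h) < N)
      (labels : ∀ h → τ LBL h ≡ σ LBL h)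
      (moved : ∀ {h} → h < H → Redirect V (σ SRC (suc h)) (σ TGT (suc h)) (τ SRC (suc h)) (τ TGT (suc h))) where
      open LinkedTo lk

      private
        S T′ : ℕ → ℕ
        S h  = σ SRC (suc h)
        T′ h = σ TGT (suc h)

        N′ = N + length cs

        here∈ : ∀ {v} → v < N → V v ≢ 0 → v ∈ verts
        here∈ {v} v<N v≢0 with Any.any? (v ≟_) verts
        ... | yes v∈ = v∈
        ... | no v∉  = contradiction (outside v∉ v<N) v≢0

        part≥ : ∀ {ds C} → Parts V o ρ ds → C ∈ ds → ∃[ M ] N ≤ M × Part V o ρ M C
        part≥ (p ∷ ps) (here refl) = _ , m≤m+n N _ , p
        part≥ (p ∷ ps) (there C∈)  = part≥ ps C∈

        pred≢0 : ∀ x → x ∸ 1 ≢ 0 → x ≢ 0 × x ≢ 1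
        pred≢0 x nz = (λ { refl → nz refl }) , λ { refl → nz refl }

        -- New names are at least `N`, so a redirected end never falls into a node that was already
        -- waiting.
        meta≥ : ∀ {v} → v ∈ verts → V v ∸ 1 ≢ 0 → N ≤ V v ∸ 1
        meta≥ v∈ nz with C , C∈ , v∈C ← covered v∈ (proj₁ (pred≢0 _ nz)) (proj₂ (pred≢0 _ nz))
                    with M , N≤M , p ← part≥ parts C∈ =
          ≤-trans N≤M (≤-reflexive (cong (_∸ 1) (sym (proj₂ (Part.inside p v∈C)))))

        meta< : ∀ {v} → v ∈ verts → V v ∸ 1 ≢ 0 → V v ∸ 1 < N′
        meta< {v} v∈ nz = ≤-trans (≤-reflexive (m+[n∸m]≡n (n≢0⇒n>0 (proj₁ (pred≢0 _ nz))))) (bounded v∈)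

        from-disk : ∀ {h} → h < H → V (S h) ≡ 1 → κ (S h) (T′ h) (σ LBL (suc h))
        from-disk {h} h< d = arc→κ (here∈ (proj₁ (ends h<)) (λ z → contradiction (trans (sym z) d) λ ())) (h , h< , refl , refl , refl)

        from-part : ∀ {h} → h < H → V (S h) ∸ 1 ≢ 0 → κ (S h) (T′ h) (σ LBL (suc h))
        from-part {h} h< nz = arc→κ (here∈ (proj₁ (ends h<)) (proj₁ (pred≢0 _ nz))) (h , h< , refl , refl , refl)

        disk-or-0 : ∀ x → x ≢ 0 → x ∸ 1 ≡ 0 → x ≡ 1
        disk-or-0 zero       nz _ = contradiction refl nz
        disk-or-0 (suc zero) _  _ = refl

      ends′ : ∀ {h} → h < H → τ SRC (suc h) < N′ × τ TGT (suc h) < N′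
      ends′ {h} h< = go (moved h<)
        where
        S< = <-≤-trans (proj₁ (ends h<)) (m≤m+n N _)
        T< = <-≤-trans (proj₂ (ends h<)) (m≤m+n N _)
        go : ∀ {a b} → Redirect V (S h) (T′ h) a b → a < N′ × b < N′
        go (other _)    = S< , T<
        go (loop _ _)   = T< , T<
        go (enter d nz) = meta< (proj₂ (κ-in (from-disk h< d))) nz , T<
        go (leave nz _) = S< , meta< (proj₁ (κ-in (from-part h< nz))) nz
        go (stay _ _)   = S< , T<

      other-linked : ∀ {ν₂ : Node n r} → (∀ {v} → v ∈ Node.verts ν₂ → v < N) → Disjoint ν ν₂ →
        LinkedTo σ H ν₂ → LinkedTo τ H ν₂
      other-linked {ν₂} small dis lk₂ = record
        { arc→κ = λ { a∈ (h , h< , s , t , l) → back h< a∈ (trans (sym (labels (suc h))) l) (moved h<) s t }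
        ; κ→arc = λ k → let h , h< , s , t , l = LinkedTo.κ→arc lk₂ k
                            zero-V = outside (λ a∈ → dis a∈ (proj₁ (Node.κ-in ν₂ k))) (small (proj₁ (Node.κ-in ν₂ k)))
                            s′ , t′ = forth (trans (cong V s) zero-V) (moved h<)
                        in h , h< , trans s′ s , trans t′ t , trans (labels (suc h)) l }
        where
        absurd : ∀ {v} → v ∈ Node.verts ν₂ → v ∈ verts → ⊥
        absurd v∈₂ v∈ = dis v∈ v∈₂
        back : ∀ {h a b e} → h < H → a ∈ Node.verts ν₂ → σ LBL (suc h) ≡ e → ∀ {a′ b′} → Redirect V (S h) (T′ h) a′ b′ → a′ ≡ a → b′ ≡ b → Node.κ ν₂ a b e
        back h< a∈ l (other _) refl refl = LinkedTo.arc→κ lk₂ a∈ (_ , h< , refl , refl , l)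
        back h< a∈ l (loop d _) refl refl = ⊥-elim (absurd a∈ (proj₂ (κ-in (from-disk h< d))))
        back h< a∈ l (enter d nz) refl refl = ⊥-elim (<⇒≱ (small a∈) (meta≥ (proj₂ (κ-in (from-disk h< d))) nz))
        back h< a∈ l (leave nz _) refl refl = ⊥-elim (absurd a∈ (proj₁ (κ-in (from-part h< nz))))
        back h< a∈ l (stay nz _) refl refl = ⊥-elim (absurd a∈ (proj₁ (κ-in (from-part h< nz))))
        forth : ∀ {s t a b} → V s ≡ 0 → Redirect V s t a b → a ≡ s × b ≡ t
        forth z (other _)    = refl , refl
        forth z (loop d _)   = contradiction (trans (sym z) d) λ ()
        forth z (enter d _)  = contradiction (trans (sym z) d) λ ()
        forth z (leave nz _) = contradiction (cong (_∸ 1) z) nz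
        forth z (stay nz _)  = contradiction (cong (_∸ 1) z) nz

      child-linked : ∀ {M C} (N≤M : N ≤ M) (p : Part V o ρ M C) → LinkedTo τ H (Ch.child N≤M p)
      child-linked {M} {C} N≤M p = record
        { arc→κ = λ { a∈ (h , h< , s , t , l) → subst₂ (λ a b → Ch.κ′ N≤M p a b _) s t
            (subst (Ch.κ′ N≤M p _ _) (trans (sym (labels (suc h))) l) (back h< (subst (_∈ M ∷ C) (sym s) a∈) (moved h<))) }
        ; κ→arc = forth }
        where
        module K = Ch N≤M p
        M≢0 : M ≢ 0
        M≢0 M≡0 = N≢0 (n≤0⇒n≡0 (≤-trans N≤M (≤-reflexive M≡0)))
        V-C : ∀ {v} → v ∈ C → V v ≡ suc M
        V-C v∈ = proj₂ (Part.inside p v∈)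
        old∈ : ∀ {v} → v < N → v ∈ M ∷ C → v ∈ C
        old∈ v<N (here refl) = contradiction N≤M (<⇒≱ v<N)
        old∈ v<N (there v∈)  = v∈
        back : ∀ {h a b} → h < H → a ∈ M ∷ C → Redirect V (S h) (T′ h) a b → Ch.κ′ N≤M p a b (σ LBL (suc h))
        back h< a∈ (other z) = contradiction (trans (sym z) (V-C (old∈ (proj₁ (ends h<)) a∈))) λ ()
        back h< a∈ (loop _ z) = contradiction (trans (sym (cong (_∸ 1) (V-C (old∈ (proj₂ (ends h<)) a∈)))) z) M≢0
        back {h} h< a∈ (enter d nz) = go a∈ refl
          where
          t∈ = proj₂ (κ-in (from-disk h< d))
          go : ∀ {a} → a ∈ M ∷ C → a ≡ V (T′ h) ∸ 1 → Ch.κ′ N≤M p (V (T′ h) ∸ 1) (T′ h) (σ LBL (suc h))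
          go (here refl) eq = subst (λ a → Ch.κ′ N≤M p a _ _) eq (K.leave (from-disk h< d) d
            (Part.whole p t∈ (trans (sym (m+[n∸m]≡n (n≢0⇒n>0 (proj₁ (pred≢0 _ nz))))) (cong suc (sym eq)))))
          go (there a∈) eq = contradiction (≤-trans (meta≥ t∈ nz) (≤-reflexive (sym eq))) (<⇒≱ (verts<N (proj₁ (Part.inside p a∈))))
        back {h} h< a∈ (leave nz z) = subst (λ b → Ch.κ′ N≤M p _ b _) (sym (cong (_∸ 1) (V-C s∈)))
          (K.enter e s∈ (disk-or-0 _ (seen (proj₂ (κ-in e))) z))
          where
          s∈ = old∈ (proj₁ (ends h<)) a∈
          e  = from-part h< nz
        back {h} h< a∈ (stay nz nz′) = K.inside e s∈ (Ch.C-next N≤M p s∈ e (proj₂ (pred≢0 _ nz′)))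
          where
          s∈ = old∈ (proj₁ (ends h<)) a∈
          e  = from-part h< nz
        V∸1 : ∀ {v} → v ∈ C → V v ∸ 1 ≡ M
        V∸1 v∈ = cong (_∸ 1) (V-C v∈)
        new-arc : ∀ {h a b e} → h < H → σ LBL (suc h) ≡ e → τ SRC (suc h) ≡ a → τ TGT (suc h) ≡ b → Arc τ H a b e
        new-arc {h} h< l s t = h , h< , s , t , trans (labels (suc h)) l
        forth : ∀ {a b e} → Ch.κ′ N≤M p a b e → Arc τ H a b e
        forth (Ch.inside k a∈ b∈) with h , h< , refl , refl , l ← κ→arc k = let s , t = go (moved h<) in new-arc h< l s t
          where
          go : ∀ {s t} → Redirect V _ _ s t → s ≡ _ × t ≡ _
          go (other z)   = contradiction (trans (sym z) (V-C a∈)) λ ()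
          go (loop _ z)  = contradiction (trans (sym (V∸1 b∈)) z) M≢0
          go (enter d _) = contradiction (suc-injective (trans (sym (V-C a∈)) d)) M≢0
          go (leave _ z) = contradiction (trans (sym (V∸1 b∈)) z) M≢0
          go (stay _ _)  = refl , refl
        forth (Ch.enter k a∈ d) with h , h< , refl , refl , l ← κ→arc k = let s , t = go (moved h<) in new-arc h< l s t
          where
          go : ∀ {s t} → Redirect V _ _ s t → s ≡ _ × t ≡ M
          go (other z)    = contradiction (trans (sym z) (V-C a∈)) λ ()
          go (loop d′ _)  = contradiction (suc-injective (trans (sym (V-C a∈)) d′)) M≢0
          go (enter _ nz) = contradiction (cong (_∸ 1) d) nz
          go (leave _ _)  = refl , V∸1 a∈
          go (stay _ nz)  = contradiction (cong (_∸ 1) d) nz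
        forth (Ch.leave k d b∈) with h , h< , refl , refl , l ← κ→arc k = let s , t = go (moved h<) in new-arc h< l s t
          where
          go : ∀ {s t} → Redirect V _ _ s t → s ≡ M × t ≡ _
          go (other z)    = contradiction (trans (sym z) d) λ ()
          go (loop _ z)   = contradiction (trans (sym (V∸1 b∈)) z) M≢0
          go (enter _ _)  = V∸1 b∈ , refl
          go (leave nz _) = contradiction (cong (_∸ 1) d) nz
          go (stay nz _)  = contradiction (cong (_∸ 1) d) nz

-- The recursive division

nextRep : ℕ
nextRep = 47

-- Waiting nodes have consecutive representatives, so two counters replace a queue: the root is
-- known by its vertex 0, all later nodes by the names from n on. Since `choose` and `addTree` leave
-- other marks behind, the chosen disk is tried once more before the contraction.
divide process mainLoop : Program
divide = choose ⨾ addTree ⨾ (center :≔ cell bestCenter) ⨾ (radius :≔ cell best) ⨾ trial ⨾ redirect ⨾ (names :≔ cell fresh)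
process = build ⨾ gather ⨾ if cell nodeSize ⊖ lit 1 run divide else skip
mainLoop = while cell names ⊖ cell nodeRep run (process ⨾ (nodeRep :≔ cell nextRep) ⨾ (nextRep :≔ inc (cell nextRep)))

mainStatic : List ℕ
mainStatic = SIZES ∷ SRC ∷ TGT ∷ LBL ∷ MARK ∷ names ∷ arcs ∷ []

module Main (n r L m H E : ℕ) (κ₀ : Arcs) where
  open Global n r L κ₀

  record Inv (σ : Memory) (νs : List (Node n r)) : Set₁ where
    field
      sizes      : σ SIZES 0 ≡ n
      arcs#      : σ arcs 0 ≡ H
      n≤N        : n ≤ σ names 0
      ends       : ∀ {h} → h < H → σ SRC (suc h) < σ names 0 × σ TGT (suc h) < σ names 0
      small      : All (Below (σ names 0)) νs
      links     : All (LinkedTo σ H) νs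
      lifts      : All (Lift (σ MARK)) νs
      disjoint   : AllPairs Disjoint νs
      cover      : Cover (σ MARK) νs
      edge-bound : marked (σ MARK) m + Φ νs ≤ E
      name-bound : σ names 0 + Φ νs ≤ n + E

  module _ {σ τ : Memory} (same : τ ≈[ mainStatic ] σ) where

    mark⊑ : σ MARK ⊑ τ MARK
    mark⊑ nz = nz ∘ trans (sym (same MARK tt _))

    marked-≈ : ∀ m → marked (τ MARK) m ≡ marked (σ MARK) m
    marked-≈ zero    = refl
    marked-≈ (suc m) = cong₂ (λ x y → (x ⊓ 1) + y) (same MARK tt m) (marked-≈ m)

    inv-≈ : ∀ {νs} → Inv σ νs → Inv τ νs
    inv-≈ {νs} inv = record
      { sizes = trans (same SIZES tt 0) sizes
      ; arcs# = trans (same arcs tt 0) arcs#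
      ; n≤N = subst (n ≤_) (sym N≡) n≤N
      ; ends = λ h< → subst₂ _<_ (sym (same SRC tt _)) (sym N≡) (proj₁ (ends h<)) , subst₂ _<_ (sym (same TGT tt _)) (sym N≡) (proj₂ (ends h<))
      ; small = All.map (All.map (subst (_ <_) (sym N≡))) small
      ; links = All.map (linked-≈ (≈-⊆ (SRC ∷ TGT ∷ LBL ∷ []) mainStatic tt same)) links
      ; lifts = All.map (λ {ν} → lift-mono {ν = ν} mark⊑) lifts
      ; disjoint = disjoint
      ; cover = λ x<n p → case cover x<n p of λ { (inj₁ q) → inj₁ (mapPath≤ (↾-mono {κ₀} mark⊑) q) ; (inj₂ a) → inj₂ a }
      ; edge-bound = subst (λ x → x + Φ νs ≤ E) (sym (marked-≈ m)) edge-bound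
      ; name-bound = subst (λ x → x + Φ νs ≤ n + E) (sym N≡) name-bound }
      where
      open Inv inv
      N≡ : τ names 0 ≡ σ names 0
      N≡ = same names tt 0

  module Relist (ν : Node n r) (ws : List ℕ) (un : Unique ws) (sub : ws ⊆ Node.verts ν) (sup : Node.verts ν ⊆ ws) where
    ν′ : Node n r
    ν′ = relist ν ws un sub sup

    length-≡ : length ws ≡ length (Node.verts ν)
    length-≡ = ≤-antisym (length-mono-⊆ un sub) (length-mono-⊆ (Node.uniq ν) sup)

    size-≡ : Node.size ν′ ≡ Node.size ν
    size-≡ = ≤-antisym
      (length-mono-⊆ (AllPairs.filter⁺ (_<? n) un) λ v∈ → let v∈w , v<n = ∈-nonmetas⁻ {vs = ws} v∈ in ∈-nonmetas⁺ (sub v∈w) v<n)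
      (length-mono-⊆ (AllPairs.filter⁺ (_<? n) (Node.uniq ν)) λ v∈ → let v∈V , v<n = ∈-nonmetas⁻ {vs = Node.verts ν} v∈ in ∈-nonmetas⁺ (sup v∈V) v<n)

    Φ-≡ : ∀ rest → Φ (ν′ ∷ rest) ≡ Φ (ν ∷ rest)
    Φ-≡ rest = cong₂ (λ l s → (l ∸ 1) * ⌊log₂ s ⌋ + Φ rest) length-≡ size-≡

    relist-linked : ∀ {σ} → LinkedTo σ H ν → LinkedTo σ H ν′
    relist-linked lk = record { arc→κ = arc→κ ∘ sub ; κ→arc = κ→arc }
      where open LinkedTo lk

    relist-inv : ∀ {σ rest} → Inv σ (ν ∷ rest) → Inv σ (ν′ ∷ rest)
    relist-inv {σ} {rest} inv = record
      { sizes = sizes ; arcs# = arcs# ; n≤N = n≤N ; ends = ends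
      ; small = All.tabulate (All.lookup (All.head small) ∘ sub) ∷ All.tail small
      ; links = relist-linked (All.head links) ∷ All.tail links
      ; lifts = relist-lift (All.head lifts) ∷ All.tail lifts
      ; disjoint = All.map (λ {ν₂} → relist-disjoint {ν₂}) (AllPairs.head disjoint) ∷ AllPairs.tail disjoint
      ; cover = λ x<n p → case cover x<n p of λ
          { (inj₁ q) → inj₁ q
          ; (inj₂ (here (x∈ , a))) → inj₂ (here (sup x∈ , a))
          ; (inj₂ (there a)) → inj₂ (there a) }
      ; edge-bound = subst (λ x → marked (σ MARK) m + x ≤ E) (sym (Φ-≡ rest)) edge-bound
      ; name-bound = subst (λ x → σ names 0 + x ≤ n + E) (sym (Φ-≡ rest)) name-bound }
      where
      open Inv inv
      relist-disjoint : ∀ {ν₂} → Disjoint ν ν₂ → Disjoint ν′ ν₂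
      relist-disjoint dis v∈ = dis (sub v∈)
      relist-lift : Lift (σ MARK) ν → Lift (σ MARK) ν′
      relist-lift (err , le , lift) = err , subst (λ s → err + 2 * r * ⌊log₂ s ⌋ ≤ 2 * r * L) (sym size-≡) le ,
        λ f g⊑f x∈ y∈ → lift f g⊑f (sub x∈) (sub y∈)

  weight-bound : ∀ {S ws κ μ} {μ-n} (adjc : Adjacency ws κ (adjTo S H) μ) (κ-in : ∀ {a b e} → κ a b e → a ∈ ws × b ∈ ws) →
    let open Adjacency adjc in
    ∀ vs → Unique vs → Search.weight n ws κ (adjTo S H) μ μ-n chain arc⁺ arc⁻ κ-in vs ≤ length vs + H
  weight-bound {S} {ws} {κ} {μ} {μ-n} adjc κ-in vs un = ≤-trans (≤-reflexive (go vs)) (+-monoʳ-≤ (length vs) (degrees≤ S H vs un))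
    where
    open +-*-Solver
    open Adjacency adjc
    go : ∀ vs → Search.weight n ws κ (adjTo S H) μ μ-n chain arc⁺ arc⁻ κ-in vs ≡ length vs + degrees S H vs
    go []       = refl
    go (v ∷ vs) = trans (cong (suc (length (adjTo S H v)) +_) (go vs))
      (solve 3 (λ a l d → con 1 :+ a :+ (l :+ d) := con 1 :+ l :+ (a :+ d)) refl (length (adjTo S H v)) (length vs) (degrees S H vs))

  -- Work is counted in units of O(`U`) steps. Dividing a node with k vertices takes k units and
  -- adds at most k - 1 children; the removed node pays one unit, and the drop of 3Φ by at least 3(k
  -- - 1) pays for the rest. Dropping a small node takes the one unit that it frees.
  measure : List (Node n r) → ℕ
  measure νs = 3 * Φ νs + length νs

  Step : ℕ → List (Node n r) → ℕ → Memory → Set₁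
  Step y νs u τ = ∃[ νs′ ] Inv τ νs′ × Reps y νs′ (τ names 0) × u + measure νs′ ≤ measure νs

  module Divide (ν : Node n r) (rest : List (Node n r)) (S : ℕ → ℕ) (μ : Memory) (y : ℕ)
    (inv     : Inv μ (ν ∷ rest))
    (reps    : Reps y rest (μ names 0))
    (adjc    : Adjacency (Node.verts ν) (Node.κ ν) (adjTo S H) μ)
    (stored  : Seg (μ NODE) 0 (Node.verts ν))
    (len     : μ nodeLen 0 ≡ length (Node.verts ν))
    (sz      : μ nodeSize 0 ≡ Node.size ν)
    (near    : ∀ {v} → v ∈ Node.verts ν → Ball (Node.κ ν) (Node.rep ν) (length (Node.verts ν)) v)
    (repOk   : μ nodeRep 0 ≡ Node.rep ν)
    (2≤size  : 2 ≤ Node.size ν)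
    where
    open Node ν
    open Inv inv

    N x : ℕ
    N = μ names 0
    x = length verts

    open Trial ν (adjTo S H) μ N sizes adjc refl stored len sz (All.lookup (All.head small))
    open Division L κ₀ ν (adjTo S H) μ N sizes adjc refl stored len sz (All.lookup (All.head small)) n≤N

    divideCost : ℕ
    divideCost = (11 + ((x + x) * attemptCost + 12)) + (treeCost + (8 + (trialCost + ((H * 44 + 9) + 4))))

    final : ∀ {c R} {μ₁ μ₂ μ₃ μ₄ : Memory} → c ∈ verts → Balanced κ Z c R → R ≤ r →
      μ₁ ≈[ mainStatic ] μ → Tree c μ₁ μ₂ → μ₃ ≈[ SRC ∷ TGT ∷ LBL ∷ SIZES ∷ names ∷ arcs ∷ [] ] μ → μ₃ ≈[ MARK ∷ [] ] μ₂ →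
      Outcome {c} {R} μ₃ →
      (∀ {h} → h < H → Redirect (μ₃ VIS) (μ₃ SRC (suc h)) (μ₃ TGT (suc h)) (μ₄ SRC (suc h)) (μ₄ TGT (suc h))) →
      μ₄ ≈[ MARK ∷ LBL ∷ SIZES ∷ arcs ∷ fresh ∷ [] ] μ₃ →
      Step y (ν ∷ rest) x (update μ₄ names 0 (μ₄ fresh 0))
    final {c} {R} {μ₁} {μ₂} {μ₃} {μ₄} c∈ bal R≤r e₁ tree e₃ m₃ oc moved e₄ = νs′ , record
      { sizes = trans (e₄ SIZES tt 0) (trans (e₃ SIZES tt 0) sizes)
      ; arcs# = trans (e₄ arcs tt 0) (trans (e₃ arcs tt 0) arcs#)
      ; n≤N = subst (n ≤_) (sym N′≡) (≤-trans n≤N N≤N′)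
      ; ends = λ {h} h< → let s< , t< = At.ends′ marks all-seen c∈ {σ = μ₃} {τ} (λ _ → refl) lk ends₃ labels moved h< in
          subst (μ₄ SRC (suc h) <_) (sym N′≡) s< , subst (μ₄ TGT (suc h) <_) (sym N′≡) t<
      ; small = addAll-all parts id (All.map (λ {ν₂} → grow {ν₂}) (All.tail small))
          λ N≤M p _ M< → subst (_ <_) (sym N′≡) M< ∷
            All.tabulate λ v∈ → subst (_ <_) (sym N′≡) (<-≤-trans (All.lookup (All.head small) (proj₁ (Part.inside p v∈))) N≤N′)
      ; links = addAll-all parts id
          (All.zipWith (λ {ν₂} → re-link {ν₂}) (All.zip (All.tail small , AllPairs.head disjoint) , All.tail links))
          λ N≤M p _ _ → At.child-linked marks all-seen c∈ {σ = μ₃} {τ} (λ _ → refl) lk ends₃ labels moved N≤M p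
      ; lifts = addAll-all parts id (All.map (λ {ν₂} → lift-mono {ν = ν₂} g⊑g′) (All.tail lifts))
          λ N≤M p _ _ → child-lift 2≤size bal R≤r g⊑g′ geo N≤M p (All.head lifts)
      ; disjoint = addAll-disjoint parts id (All.tail small) (AllPairs.head disjoint) (AllPairs.tail disjoint)
      ; cover = cover-step 2≤size bal R≤r g⊑g′ geo (All.head lifts) parts cover
      ; edge-bound = edges′
      ; name-bound = names′
      } , subst (Reps y νs′) (sym N′≡) (addAll-reps parts reps) , spent
      where
      open Outcome oc using (cs; marks; all-seen; fresh-ok)
      open At marks all-seen c∈
      open Marks marks using (parts)
      open ≤-Reasoning
      τ = update μ₄ names 0 (μ₄ fresh 0)
      N′ = N + length cs
      νs′ = addAll rest parts
      l = x ∸ 1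
      N′≡ : τ names 0 ≡ N′
      N′≡ = trans (e₄ fresh tt 0) fresh-ok
      N≤N′ : N ≤ N′
      N≤N′ = m≤m+n N _
      src₃ : μ₃ ≈[ SRC ∷ TGT ∷ LBL ∷ [] ] μ
      src₃ = ≈-⊆ (SRC ∷ TGT ∷ LBL ∷ []) (SRC ∷ TGT ∷ LBL ∷ SIZES ∷ names ∷ arcs ∷ []) tt e₃
      grow : ∀ {ν₂} → Below N ν₂ → Below (τ names 0) ν₂
      grow = All.map λ lt → subst (_ <_) (sym N′≡) (<-≤-trans lt N≤N′)
      lk : LinkedTo μ₃ H ν
      lk = linked-≈ src₃ (All.head links)
      ends₃ : ∀ {h} → h < H → μ₃ SRC (suc h) < N × μ₃ TGT (suc h) < N
      ends₃ h< = subst (_< N) (sym (e₃ SRC tt _)) (proj₁ (ends h<)) , subst (_< N) (sym (e₃ TGT tt _)) (proj₂ (ends h<))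
      labels : ∀ h → τ LBL h ≡ μ₃ LBL h
      labels h = e₄ LBL tt h
      re-link : ∀ {ν₂} → (Below N ν₂ × Disjoint ν ν₂) × LinkedTo μ H ν₂ → LinkedTo τ H ν₂
      re-link {ν₂} ((lt , dis) , lk₂) = At.other-linked marks all-seen c∈ {σ = μ₃} {τ} (λ _ → refl) lk ends₃ labels moved
        {ν₂} (All.lookup lt) dis (linked-≈ src₃ lk₂)
      mark-τ : ∀ e → τ MARK e ≡ μ₂ MARK e
      mark-τ e = trans (e₄ MARK tt e) (m₃ MARK tt e)
      g⊑g′ : μ MARK ⊑ τ MARK
      g⊑g′ {e} nz z = Tree.kept tree (mark⊑ e₁ nz) (trans (sym (mark-τ e)) z)
      geo : ∀ {k v} → Path ∥ κ ∥ c v k → Path≤ (κ ↾ on (τ MARK)) c v k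
      geo p = mapPath≤ (↾-mono {κ} {μ₂ MARK} {τ MARK} (λ {e} nz z → nz (trans (sym (mark-τ e)) z))) (Tree.geodesics tree p)
      marked-τ : ∀ m → marked (τ MARK) m ≡ marked (μ₂ MARK) m
      marked-τ zero    = refl
      marked-τ (suc m) = cong₂ (λ a b → (a ⊓ 1) + b) (mark-τ m) (marked-τ m)
      drop : l + Φ νs′ ≤ Φ (ν ∷ rest)
      drop = Φ-drop 2≤size bal {rest} parts (Outcome.small oc)
      cs≤l : length cs ≤ l
      cs≤l = ≤-trans (parts-nonempty parts) (∸-monoˡ-≤ 1 (Outcome.small oc))
      edges′ : marked (τ MARK) m + Φ νs′ ≤ E
      edges′ = begin
        marked (τ MARK) m + Φ νs′        ≡⟨ cong (_+ Φ νs′) (marked-τ m) ⟩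
        marked (μ₂ MARK) m + Φ νs′       ≤⟨ +-monoˡ-≤ (Φ νs′) (Tree.few tree m) ⟩
        marked (μ₁ MARK) m + l + Φ νs′   ≡⟨ cong (λ z → z + l + Φ νs′) (marked-≈ e₁ m) ⟩
        marked (μ MARK) m + l + Φ νs′    ≡⟨ +-assoc (marked (μ MARK) m) l (Φ νs′) ⟩
        marked (μ MARK) m + (l + Φ νs′)  ≤⟨ +-monoʳ-≤ (marked (μ MARK) m) drop ⟩
        marked (μ MARK) m + Φ (ν ∷ rest) ≤⟨ edge-bound ⟩
        E                                ∎
      names′ : τ names 0 + Φ νs′ ≤ n + E
      names′ = begin
        τ names 0 + Φ νs′       ≡⟨ cong (_+ Φ νs′) N′≡ ⟩
        N + length cs + Φ νs′   ≤⟨ +-monoˡ-≤ (Φ νs′) (+-monoʳ-≤ N cs≤l) ⟩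
        N + l + Φ νs′           ≡⟨ +-assoc N l (Φ νs′) ⟩
        N + (l + Φ νs′)         ≤⟨ +-monoʳ-≤ N drop ⟩
        N + Φ (ν ∷ rest)        ≤⟨ name-bound ⟩
        n + E                   ∎
      spent : x + measure νs′ ≤ measure (ν ∷ rest)
      spent = begin
        x + (3 * Φ νs′ + length νs′)                   ≡⟨ cong (λ z → x + (3 * Φ νs′ + z)) (addAll-length {rest} parts) ⟩
        x + (3 * Φ νs′ + (length rest + length cs))    ≤⟨ +-mono-≤ (m≤n+m∸n x 1) (+-monoʳ-≤ (3 * Φ νs′) (+-monoʳ-≤ (length rest) cs≤l)) ⟩
        suc l + (3 * Φ νs′ + (length rest + l))        ≤⟨ m≤m+n _ l ⟩
        suc l + (3 * Φ νs′ + (length rest + l)) + l    ≡⟨ solve 3 (λ l p q → con 1 :+ l :+ (con 3 :* p :+ (q :+ l)) :+ l := con 3 :* (l :+ p) :+ (con 1 :+ q)) refl l (Φ νs′) (length rest) ⟩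
        3 * (l + Φ νs′) + suc (length rest)            ≤⟨ +-monoˡ-≤ (suc (length rest)) (*-monoʳ-≤ 3 drop) ⟩
        3 * Φ (ν ∷ rest) + suc (length rest)           ∎
        where open +-*-Solver

    divide-runs : Runs divide μ divideCost (λ τ _ → Step y (ν ∷ rest) x τ)
    divide-runs = R-seq′ (R-frame (trialStatic) tt (R-frame mainStatic tt
        (choose-runs (≈-refl {trialStatic} {μ}) repOk rep∈ near)))
      λ { {μ₁} (((c , R , eqc , eqR , c∈ , bal , R≤r) , e₁) , t₁) →
        R-seq′ (R-frame (best ∷ bestCenter ∷ SRC ∷ arcs ∷ trialStatic) tt (addTree-runs t₁ eqc c∈))
        λ { {μ₂} (tree , t₂) → R-then-at 0 c refl (trans (t₂ bestCenter tt 0) eqc) (R-then-at 0 R refl (trans (t₂ best tt 0) eqR)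
          (R-seq′ (R-frame (MARK ∷ SRC ∷ arcs ∷ trialStatic) tt (trial-runs {c = c} {R}
              (keep radius tt (keep center tt (≈-trans {as = trialStatic} {τ = μ₁} (≈-⊆ trialStatic (best ∷ bestCenter ∷ SRC ∷ arcs ∷ trialStatic) tt t₂) t₁))) refl refl c∈))
          λ { {μ₃} (oc , t₃) → R-seq′ (R-frame (MARK ∷ LBL ∷ SIZES ∷ arcs ∷ fresh ∷ []) tt (redirect-runs {μ₃} {H} (eqH {c} {R} {μ₁} {μ₂} {μ₃} t₃ t₂ e₁)))
          λ { {μ₄} (moved , e₄) → R-assign {b = 0} (final c∈ bal R≤r e₁ tree (e₃ {c} {R} {μ₁} {μ₂} {μ₃} e₁ t₂ t₃) (≈-⊆ {μ₃} {μ₂} (MARK ∷ []) (MARK ∷ SRC ∷ arcs ∷ trialStatic) tt (unmoved {c} {R} {μ₁} {μ₂} {μ₃} t₃)) oc moved e₄) } })) } }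
      where
      module _ {c R : ℕ} {μ₁ μ₂ μ₃ : Memory} where
        μ₂′ : Memory
        μ₂′ = update (update μ₂ center 0 c) radius 0 R
        big : List ℕ
        big = MARK ∷ SRC ∷ arcs ∷ trialStatic
        unmoved : μ₃ ≈[ big ] μ₂′ → μ₃ ≈[ big ] μ₂
        unmoved t₃ = ≈-trans {as = big} {τ = μ₂′} t₃ (≈-update radius big tt (≈-update center big tt (≈-refl {big} {μ₂})))
        out : List ℕ
        out = SRC ∷ TGT ∷ LBL ∷ SIZES ∷ names ∷ arcs ∷ []
        e₃ : μ₁ ≈[ mainStatic ] μ → μ₂ ≈[ best ∷ bestCenter ∷ SRC ∷ arcs ∷ trialStatic ] μ₁ → μ₃ ≈[ big ] μ₂′ → μ₃ ≈[ out ] μ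
        e₃ e₁ t₂ t₃ = ≈-trans {as = out} {τ = μ₂} (≈-⊆ out big tt (unmoved t₃))
          (≈-trans {as = out} {τ = μ₁} (≈-⊆ out (best ∷ bestCenter ∷ SRC ∷ arcs ∷ trialStatic) tt t₂) (≈-⊆ out mainStatic tt e₁))
        eqH : μ₃ ≈[ big ] μ₂′ → μ₂ ≈[ best ∷ bestCenter ∷ SRC ∷ arcs ∷ trialStatic ] μ₁ → μ₁ ≈[ mainStatic ] μ → μ₃ arcs 0 ≡ H
        eqH t₃ t₂ e₁ = trans (t₃ arcs tt 0) (trans (t₂ arcs tt 0) (trans (e₁ arcs tt 0) arcs#))

-- Linear bounds on the running time

module Budget (Q : ℕ) (1≤Q : 1 ≤ Q) where

  infix 9 _⟨*⟩_
  _⟨*⟩_ : ∀ {x} → x ≤ Q → ∀ k → x * k ≤ Q * k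
  le ⟨*⟩ k = *-monoˡ-≤ k le

  unit : ∀ k → k ≤ Q * k
  unit k = ≤-trans (≤-reflexive (sym (+-identityʳ k))) (*-monoˡ-≤ k 1≤Q)

  infixr 6 _⟨+⟩_
  _⟨+⟩_ : ∀ {a b i j} → a ≤ Q * i → b ≤ Q * j → a + b ≤ Q * (i + j)
  _⟨+⟩_ {i = i} {j} p q = ≤-trans (+-mono-≤ p q) (≤-reflexive (sym (*-distribˡ-+ Q i j)))

  module _ {N H W x : ℕ} (N≤ : N ≤ Q) (H≤ : H ≤ Q) (W≤ : W ≤ Q) (x≤ : x ≤ Q) where

    trial≤ : (N * 15 + 9) + (11 + (39 + (W * 71 + (6 + (10 + ((x * 11 + 6) + x * 80)))))) ≤ Q * 258
    trial≤ = (N≤ ⟨*⟩ 15 ⟨+⟩ unit 9) ⟨+⟩ unit 11 ⟨+⟩ unit 39 ⟨+⟩ W≤ ⟨*⟩ 71 ⟨+⟩ unit 6 ⟨+⟩ unit 10 ⟨+⟩ ((x≤ ⟨*⟩ 11 ⟨+⟩ unit 6) ⟨+⟩ x≤ ⟨*⟩ 80)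

    tree≤ : (N * 15 + 9) + (11 + (39 + (W * 71 + (6 + ((x ∸ 1) * 20 + 11))))) ≤ Q * 182
    tree≤ = (N≤ ⟨*⟩ 15 ⟨+⟩ unit 9) ⟨+⟩ unit 11 ⟨+⟩ unit 39 ⟨+⟩ W≤ ⟨*⟩ 71 ⟨+⟩ unit 6 ⟨+⟩ (≤-trans (m∸n≤m x 1) x≤ ⟨*⟩ 20 ⟨+⟩ unit 11)

    build≤ : (N * 15 + 9) + (H * 28 + 9) ≤ Q * 61
    build≤ = (N≤ ⟨*⟩ 15 ⟨+⟩ unit 9) ⟨+⟩ (H≤ ⟨*⟩ 28 ⟨+⟩ unit 9)

    gather≤ : (N * 15 + 9) + (11 + (39 + (W * 71 + (6 + (8 + (x * 17 + 9)))))) ≤ Q * 185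
    gather≤ = (N≤ ⟨*⟩ 15 ⟨+⟩ unit 9) ⟨+⟩ unit 11 ⟨+⟩ unit 39 ⟨+⟩ W≤ ⟨*⟩ 71 ⟨+⟩ unit 6 ⟨+⟩ unit 8 ⟨+⟩ (x≤ ⟨*⟩ 17 ⟨+⟩ unit 9)

    -- 1116 = 11 + 2 · 294 + 12 + 505. There are at most two attempts per vertex, of 36 + 258 each;
    -- the tree, the final trial and the redirection take 505, which are charged to every vertex as
    -- there is at least one.
    divide≤ : ∀ {T R} → 1 ≤ x → T ≤ Q * 258 → R ≤ Q * 182 →
      (11 + ((x + x) * (36 + T) + 12)) + (R + (8 + (T + ((H * 44 + 9) + 4)))) ≤ x * (Q * 1116)
    divide≤ {T} {R} 1≤x T≤ R≤ = ≤-trans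
      (+-mono-≤ (+-mono-≤ (many (unit 11)) (+-mono-≤ (*-monoʳ-≤ (x + x) (unit 36 ⟨+⟩ T≤)) (many (unit 12))))
        (many (R≤ ⟨+⟩ unit 8 ⟨+⟩ T≤ ⟨+⟩ (H≤ ⟨*⟩ 44 ⟨+⟩ unit 9) ⟨+⟩ unit 4)))
      (≤-reflexive (solve 2 (λ x q →
        (x :* (q :* con 11) :+ ((x :+ x) :* (q :* con 294) :+ x :* (q :* con 12))) :+ x :* (q :* con 505)
        := x :* (q :* con 1116)) refl x Q))
      where
      open +-*-Solver
      many : ∀ {a b} → a ≤ b → a ≤ x * b
      many {b = b} le = ≤-trans le (≤-trans (≤-reflexive (sym (+-identityʳ b))) (*-monoˡ-≤ b 1≤x))

module Cycle (n r L m H E : ℕ) (κ₀ : Arcs) where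
  open Global n r L κ₀
  open Main n r L m H E κ₀

  -- `U` bounds the number of names, of arcs, and the weight of every node. In multiples of `U`, `K`
  -- covers building (61), gathering (185), the size test (5) and the division per vertex (1116);
  -- the 15 are the loop test (6) and the two assignments to the counters (9).
  U K K′ : ℕ
  U  = suc (n + E + H)
  K  = U * 1367
  K′ = K + 15

  module B = Budget U (s≤s z≤n)

  module Turn {σ : Memory} {ν : Node n r} {rest : List (Node n r)} {y : ℕ} (inv : Inv σ (ν ∷ rest))
    (repOk : σ nodeRep 0 ≡ Node.rep ν) (reps : Reps y rest (σ names 0)) where
    open Inv inv
    open Node ν using (verts; κ; κ-in; rep∈; uniq; size)

    private
      N x : ℕ
      N = σ names 0
      x = length verts
      S = σ SRC

      N≤ : N ≤ U
      N≤ = ≤-trans (≤-trans (m≤m+n N _) name-bound) (≤-trans (m≤m+n (n + E) H) (n≤1+n _))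

      N+H≤ : N + H ≤ U
      N+H≤ = ≤-trans (+-monoˡ-≤ H (≤-trans (m≤m+n N _) name-bound)) (n≤1+n _)

      H≤ : H ≤ U
      H≤ = ≤-trans (m≤n+m H N) N+H≤

      x≤N : x ≤ N
      x≤N = length-below uniq (All.head small)

      x≤ : x ≤ U
      x≤ = ≤-trans x≤N N≤

      1≤x : 1 ≤ x
      1≤x = nonempty rep∈
        where
        nonempty : ∀ {v : ℕ} {vs} → v ∈ vs → 1 ≤ length vs
        nonempty (here _)  = s≤s z≤n
        nonempty (there _) = s≤s z≤n

      weight≤ : ∀ {vs w} → Unique vs → All (_< N) vs → w ≤ length vs + H → w ≤ U
      weight≤ un lt le = ≤-trans le (≤-trans (+-monoˡ-≤ H (length-below un lt)) N+H≤)

      outer : List ℕ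
      outer = nodeRep ∷ mainStatic

    built : Runs build σ (U * 61) (λ τ _ → (∀ {v} → v < N → Chain (τ NEXT) (τ HEAD v) (adjTo S H v)) × τ ≈[ outer ] σ)
    built = R-≤ (B.build≤ {N} {H} {N} {N} N≤ H≤ N≤ N≤) (R-frame outer tt (build-runs refl arcs# (proj₁ ∘ ends)))

    module Collect {τ : Memory} (chains : ∀ {v} → v < N → Chain (τ NEXT) (τ HEAD v) (adjTo S H v)) (e₁ : τ ≈[ outer ] σ) where
      adjc : Adjacency verts κ (adjTo S H) τ
      adjc = adjacency (All.head links) (≈-⊆ (SRC ∷ TGT ∷ LBL ∷ []) outer tt e₁) (All.lookup (All.head small)) chains

      open Gather ν (adjTo S H) τ N (trans (e₁ SIZES tt 0) sizes) adjc (e₁ names tt 0) (trans (e₁ nodeRep tt 0) repOk)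
        (All.lookup (All.head small)) public

      gathered : Runs gather τ (U * 185) (λ μ _ → Gathered μ × μ ≈[ NEXT ∷ HEAD ∷ outer ] τ)
      gathered = R-≤ (B.gather≤ {N} {H} {_} {x} N≤ H≤ (weight≤ uniq (All.head small) (weight-bound {μ-n = trans (e₁ SIZES tt 0) sizes} adjc κ-in verts uniq)) x≤)
        (R-frame (NEXT ∷ HEAD ∷ outer) tt gather-runs)

      module Decide {μ : Memory} (g : Gathered μ) (e₂ : μ ≈[ NEXT ∷ HEAD ∷ outer ] τ) where
        open Gathered g
        open Relist ν list list-un list-sub list-sup

        e₀ : μ ≈[ outer ] σ
        e₀ = ≈-trans {as = outer} {τ = τ} (≈-⊆ outer (NEXT ∷ HEAD ∷ outer) tt e₂) e₁

        inv-μ : Inv μ (ν ∷ rest)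
        inv-μ = inv-≈ (≈-⊆ mainStatic outer tt e₀) inv

        inv′ : Inv μ (ν′ ∷ rest)
        inv′ = relist-inv inv-μ

        N≡ : μ names 0 ≡ N
        N≡ = e₀ names tt 0

        reps′ : Reps y rest (μ names 0)
        reps′ = subst (Reps y rest) (sym N≡) reps

        skip-step : size ≤ 1 → Step y (ν ∷ rest) 1 μ
        skip-step le = rest , record
          { sizes = I.sizes ; arcs# = I.arcs# ; n≤N = I.n≤N ; ends = I.ends
          ; small = All.tail I.small ; links = All.tail I.links ; lifts = All.tail I.lifts ; disjoint = AllPairs.tail I.disjoint
          ; cover = λ x<n p → case I.cover x<n p of λ
              { (inj₁ q) → inj₁ q
              ; (inj₂ (there a)) → inj₂ a
              ; (inj₂ (here a)) → case small-alive {ν} le a of λ { refl → inj₁ (0 , z≤n , ε) } }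
          ; edge-bound = ≤-trans (+-monoʳ-≤ (marked (μ MARK) m) (m≤n+m (Φ rest) (Φ₁ ν))) I.edge-bound
          ; name-bound = ≤-trans (+-monoʳ-≤ (μ names 0) (m≤n+m (Φ rest) (Φ₁ ν))) I.name-bound
          } , reps′ , ≤-trans (≤-reflexive (sym (+-suc (3 * Φ rest) (length rest)))) (+-monoˡ-≤ (suc (length rest)) (*-monoʳ-≤ 3 (m≤n+m (Φ rest) (Φ₁ ν))))
          where module I = Inv inv-μ

        size-μ : μ nodeSize 0 ≡ size
        size-μ = trans sz size-≡

        small-run : size ≤ 1 → Runs (if cell nodeSize ⊖ lit 1 run divide else skip) μ 6 (λ τ _ → Step y (ν ∷ rest) 1 τ)
        small-run le = R-if (λ nz → contradiction (m≤n⇒m∸n≡0 (≤-trans (≤-reflexive size-μ) le)) nz)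
          (λ _ → R-skip {b = 0} (skip-step le))

        chains′ : ∀ {v} → v < N → Chain (μ NEXT) (μ HEAD v) (adjTo S H v)
        chains′ {v} v< = subst (λ p → Chain (μ NEXT) p (adjTo S H v)) (sym (e₂ HEAD tt v)) (chain-map (λ _ → e₂ NEXT tt _) (chains v<))

        adjc′ : Adjacency (Node.verts ν′) (Node.κ ν′) (adjTo S H) μ
        adjc′ = adjacency {ν = ν′} {N = N} (relist-linked (All.head links)) (≈-⊆ (SRC ∷ TGT ∷ LBL ∷ []) outer tt e₀)
          (All.lookup (All.head small) ∘ list-sub) chains′

        weight′ : List ℕ → ℕ
        weight′ = Search.weight n list (Node.κ ν′) (adjTo S H) μ (Inv.sizes inv′) (Adjacency.chain adjc′) (Adjacency.arc⁺ adjc′) (Adjacency.arc⁻ adjc′) (Node.κ-in ν′)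

        module D (2≤ : 2 ≤ size) = Divide ν′ rest S μ y inv′ reps′ adjc′ stored len sz near
          (trans (e₀ nodeRep tt 0) repOk) (subst (2 ≤_) (sym size-≡) 2≤)

        divide-bound : ∀ 2≤ → D.divideCost 2≤ ≤ length list * (U * 1116)
        divide-bound 2≤ = B.divide≤ {μ names 0} {H} {weight′ list} {length list} (≤-trans (≤-reflexive N≡) N≤) H≤ W≤ x′≤ (≤-trans 1≤x (≤-reflexive (sym length-≡)))
          (B.trial≤ {μ names 0} {H} {weight′ list} {length list} (≤-trans (≤-reflexive N≡) N≤) H≤ W≤ x′≤)
          (B.tree≤ {μ names 0} {H} {weight′ list} {length list} (≤-trans (≤-reflexive N≡) N≤) H≤ W≤ x′≤)
          where
          list< : All (_< N) list
          list< = All.tabulate (All.lookup (All.head small) ∘ list-sub)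
          W≤ : weight′ list ≤ U
          W≤ = weight≤ list-un list< (weight-bound {μ-n = Inv.sizes inv′} adjc′ (Node.κ-in ν′) list list-un)
          x′≤ : length list ≤ U
          x′≤ = ≤-trans (length-below list-un list<) N≤

        large-run : 2 ≤ size → Runs (if cell nodeSize ⊖ lit 1 run divide else skip) μ (5 + x * (U * 1116)) (λ τ _ → Step y (ν ∷ rest) x τ)
        large-run 2≤ = R-if
          (λ _ → R-≤ (≤-trans (divide-bound 2≤) (≤-reflexive (cong (_* (U * 1116)) length-≡)))
            (R-map (λ { (νs′ , inv″ , rs , spent) → νs′ , inv″ , rs ,
                ≤-trans (≤-reflexive (cong (_+ measure νs′) (sym length-≡))) (≤-trans spent (≤-reflexive (cong (λ p → 3 * p + suc (length rest)) (Φ-≡ rest)))) })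
              (D.divide-runs 2≤)))
          (λ z → contradiction (m∸n≡0⇒m≤n z) (<⇒≱ (≤-trans 2≤ (≤-reflexive (sym size-μ)))))

    process-runs : ∃[ u ] 1 ≤ u × u ≤ measure (ν ∷ rest) × Runs process σ (u * K) (λ τ _ → Step y (ν ∷ rest) u τ)
    process-runs with size ≤? 1
    ... | yes le = 1 , ≤-refl , ≤-trans (s≤s z≤n) (m≤n+m (suc (length rest)) _) ,
      R-≤ (≤-trans (+-monoʳ-≤ (U * 61) (+-monoʳ-≤ (U * 185) (B.unit 6)))
            (≤-trans (m≤m+n _ (U * 1115)) (≤-reflexive (solve 1 (λ q → q :* con 61 :+ (q :* con 185 :+ q :* con 6) :+ q :* con 1115 := con 1 :* (q :* con 1367)) refl U))))
        (R-seq′ built λ { (chains , e₁) → R-seq′ (Collect.gathered chains e₁) λ { (g , e₂) → Collect.Decide.small-run chains e₁ g e₂ le } })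
      where open +-*-Solver
    ... | no ¬le = x , 1≤x , x≤measure ,
      R-≤ (≤-trans (≤-reflexive (solve 3 (λ a b c → a :+ (b :+ (con 5 :+ c)) := (a :+ (b :+ con 5)) :+ c) refl (U * 61) (U * 185) (x * (U * 1116))))
            (≤-trans (+-monoˡ-≤ (x * (U * 1116)) (≤-trans (+-monoʳ-≤ (U * 61) (+-monoʳ-≤ (U * 185) (B.unit 5)))
                (≤-trans (≤-reflexive (sym (+-identityʳ _))) (*-monoˡ-≤ (U * 61 + (U * 185 + U * 5)) 1≤x))))
              (≤-reflexive (solve 2 (λ x q → x :* (q :* con 61 :+ (q :* con 185 :+ q :* con 5)) :+ x :* (q :* con 1116) := x :* (q :* con 1367)) refl x U))))
        (R-seq′ built λ { (chains , e₁) → R-seq′ (Collect.gathered chains e₁) λ { (g , e₂) → Collect.Decide.large-run chains e₁ g e₂ 2≤ } })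
      where
      open +-*-Solver
      2≤ : 2 ≤ size
      2≤ = ≰⇒> ¬le
      x≤measure : x ≤ measure (ν ∷ rest)
      x≤measure = begin
        x                                   ≤⟨ m≤n+m∸n x 1 ⟩
        1 + (x ∸ 1)                         ≡⟨ cong suc (sym (*-identityʳ (x ∸ 1))) ⟩
        1 + (x ∸ 1) * 1                     ≤⟨ s≤s (*-monoʳ-≤ (x ∸ 1) (⌊log₂⌋-mono-≤ 2≤)) ⟩
        1 + Φ₁ ν                            ≤⟨ s≤s (m≤m+n (Φ₁ ν) (Φ rest)) ⟩
        1 + Φ (ν ∷ rest)                    ≡⟨ +-comm 1 _ ⟩
        Φ (ν ∷ rest) + 1                    ≤⟨ +-mono-≤ (m≤m+n (Φ (ν ∷ rest)) _) (s≤s z≤n) ⟩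
        3 * Φ (ν ∷ rest) + suc (length rest) ∎
        where open ≤-Reasoning

  Ready : Memory → List (Node n r) → Set
  Ready σ []         = σ nodeRep 0 ≡ σ names 0
  Ready σ (ν ∷ rest) = σ nodeRep 0 ≡ Node.rep ν × Reps (σ nextRep 0) rest (σ names 0)

  main-runs : ∀ {σ νs} → Inv σ νs → Ready σ νs → Runs mainLoop σ (measure νs * K′ + 6) (λ τ _ → Inv τ [])
  main-runs {σ} {νs} inv ready = R-while I round (νs , inv , ready , ≤-refl)
    where
    open +-*-Solver
    I : Memory → ℕ → Set₁
    I τ b = ∃[ νs ] Inv τ νs × Ready τ νs × measure νs * K′ + 6 ≤ b
    round : ∀ {τ b} → I τ b → ∃[ b₀ ] 6 + b₀ ≤ b ×
      (τ names 0 ∸ τ nodeRep 0 ≡ 0 → Inv τ []) ×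
      (τ names 0 ∸ τ nodeRep 0 ≢ 0 → Runs (process ⨾ (nodeRep :≔ cell nextRep) ⨾ (nextRep :≔ inc (cell nextRep))) τ b₀ I)
    round {τ} ([] , inv , rd , le) = 0 , le , (λ _ → inv) ,
      λ nz → contradiction (trans (cong (τ names 0 ∸_) rd) (n∸n≡0 (τ names 0))) nz
    round {τ} {b} (ν ∷ rest , inv , (eq , rs) , le) with Turn.process-runs inv eq rs
    ... | u , 1≤u , u≤ , ran = u * K + (9 + ((M ∸ u) * K′ + 6)) , ≤-trans fits le ,
      (λ z → contradiction (m∸n≡0⇒m≤n z) (<⇒≱ (subst (_< τ names 0) (sym eq) (All.lookup (All.head (Inv.small inv)) (Node.rep∈ ν))))) ,
      λ _ → R-seq′ (R-frame (nextRep ∷ []) tt ran) λ { {υ} ((νs′ , inv′ , rs′ , spent) , same) →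
        R-then-at 0 (τ nextRep 0) refl (same nextRep tt 0) (R-assign-at 0 (suc (τ nextRep 0)) refl (cong suc (same nextRep tt 0))
          (νs′ , inv-≈ (≈-update nextRep mainStatic tt (≈-update nodeRep mainStatic tt (≈-refl {mainStatic} {υ}))) inv′ ,
           get-ready {υ} νs′ rs′ , +-monoˡ-≤ 6 (*-monoˡ-≤ K′ (m+n≤o⇒m≤o∸n (measure νs′) (≤-trans (≤-reflexive (+-comm (measure νs′) u)) spent))))) }
      where
      M = measure (ν ∷ rest)
      get-ready : ∀ {υ} νs′ → Reps (τ nextRep 0) νs′ (υ names 0) →
        Ready (update (update υ nodeRep 0 (τ nextRep 0)) nextRep 0 (suc (τ nextRep 0))) νs′
      get-ready []       eq        = eq
      get-ready (_ ∷ _)  (eq , rs) = sym eq , rs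
      fits : 6 + (u * K + (9 + ((M ∸ u) * K′ + 6))) ≤ M * K′ + 6
      fits = begin
        6 + (u * K + (9 + ((M ∸ u) * K′ + 6))) ≡⟨ solve 2 (λ a b → con 6 :+ (a :+ (con 9 :+ (b :+ con 6))) := a :+ con 15 :+ b :+ con 6) refl (u * K) ((M ∸ u) * K′) ⟩
        u * K + 15 + (M ∸ u) * K′ + 6          ≤⟨ +-monoˡ-≤ 6 (+-monoˡ-≤ ((M ∸ u) * K′) (+-monoʳ-≤ (u * K) (*-monoˡ-≤ 15 1≤u))) ⟩
        u * K + u * 15 + (M ∸ u) * K′ + 6      ≡⟨ cong (λ z → z + (M ∸ u) * K′ + 6) (sym (*-distribˡ-+ u K 15)) ⟩
        u * K′ + (M ∸ u) * K′ + 6              ≡⟨ cong (_+ 6) (sym (*-distribʳ-+ K′ u (M ∸ u))) ⟩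
        (u + (M ∸ u)) * K′ + 6                 ≡⟨ cong (λ z → z * K′ + 6) (m+[n∸m]≡n u≤) ⟩
        M * K′ + 6                             ∎
        where open ≤-Reasoning

-- Input and output

eidx oidx outLen : ℕ
eidx   = 48
oidx   = 49
outLen = 50

-- Both orientations are labelled by the index of their edge, so a marked label keeps the edge
-- whichever of the two arcs a search tree uses.
addArc : ℕ → ℕ → Program
addArc from to = (arcs :≔ inc (cell arcs)) ⨾ (SRC [ cell arcs ]≔ (from [ cell eidx ])) ⨾
  (TGT [ cell arcs ]≔ (to [ cell eidx ])) ⨾ (LBL [ cell arcs ]≔ cell eidx)

setup select output : Program
setup = clear MARK (SIZES [ lit 1 ]) ⨾
  (names :≔ cell SIZES) ⨾ (nodeRep :≔ lit 0) ⨾ (nextRep :≔ cell SIZES) ⨾ (arcs :≔ lit 0) ⨾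
  for eidx (SIZES [ lit 1 ]) (addArc ENDS₁ ENDS₂ ⨾ addArc ENDS₂ ENDS₁)
select = if MARK [ cell oidx ] run
    ((ENDS₁ [ cell outLen ]≔ (ENDS₁ [ cell oidx ])) ⨾ (ENDS₂ [ cell outLen ]≔ (ENDS₂ [ cell oidx ])) ⨾ (outLen :≔ inc (cell outLen)))
  else skip
output = (outLen :≔ lit 0) ⨾ for oidx (SIZES [ lit 1 ]) select ⨾ (SIZES [ lit 1 ]≔ cell outLen)

edgeArcs : (ℕ → ℕ) → (ℕ → ℕ) → ℕ → Arcs
edgeArcs A B m a b e = e < m × (a ≡ A e × b ≡ B e ⊎ a ≡ B e × b ≡ A e)

module _ {n m : ℕ} {σ : Memory} (eqn : σ SIZES 0 ≡ n) (eqm : σ SIZES 1 ≡ m) where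
  private
    A B : ℕ → ℕ
    A = σ ENDS₁
    B = σ ENDS₂

    κ₀ : Arcs
    κ₀ = edgeArcs A B m

  record Loaded (τ : Memory) : Set where
    field
      sizes   : τ SIZES 0 ≡ n
      arcs#   : τ arcs 0 ≡ m + m
      names#  : τ names 0 ≡ n
      rep#    : τ nodeRep 0 ≡ 0
      next#   : τ nextRep 0 ≡ n
      blank   : ∀ e → e < m → τ MARK e ≡ 0
      sound   : ∀ {h} → h < m + m → κ₀ (τ SRC (suc h)) (τ TGT (suc h)) (τ LBL (suc h))
      present : ∀ {e} → e < m → Arc τ (m + m) (A e) (B e) e × Arc τ (m + m) (B e) (A e) e

  private
    written : Memory → ℕ → ℕ → ℕ → ℕ → Memory
    written τ c x y e = update (update (update (update τ arcs 0 (suc c)) SRC (suc c) x) TGT (suc c) y) LBL (suc c) e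

    Sound : ℕ → Memory → Set
    Sound c τ = ∀ {h} → h < c → κ₀ (τ SRC (suc h)) (τ TGT (suc h)) (τ LBL (suc h))

    cast : ∀ {a b l a′ b′ l′} → a ≡ a′ → b ≡ b′ → l ≡ l′ → κ₀ a b l → κ₀ a′ b′ l′
    cast refl refl refl k = k

    module _ {τ : Memory} {c x y e : ℕ} where

      sound-write : Sound c τ → κ₀ x y e → Sound (suc c) (written τ c x y e)
      sound-write snd k {h} h< with h ≟ c
      ... | yes refl = cast (sym (set-same (τ SRC) (suc c) x refl)) (sym (set-same (τ TGT) (suc c) y refl)) (sym (set-same (τ LBL) (suc c) e refl)) k
      ... | no h≢c   = cast (sym (set-other (τ SRC) (suc c) x (h≢c ∘ suc-injective))) (sym (set-other (τ TGT) (suc c) y (h≢c ∘ suc-injective)))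
        (sym (set-other (τ LBL) (suc c) e (h≢c ∘ suc-injective))) (snd (≤∧≢⇒< (s≤s⁻¹ h<) h≢c))

      arc-new : Arc (written τ c x y e) (suc c) x y e
      arc-new = c , ≤-refl , set-same (τ SRC) (suc c) x refl , set-same (τ TGT) (suc c) y refl , set-same (τ LBL) (suc c) e refl

      arc-old : ∀ {a b l} → Arc τ c a b l → Arc (written τ c x y e) (suc c) a b l
      arc-old (h , h< , s , t , l) = h , m≤n⇒m≤1+n h< ,
        trans (set-other (τ SRC) (suc c) x (<⇒≢ h< ∘ suc-injective)) s ,
        trans (set-other (τ TGT) (suc c) y (<⇒≢ h< ∘ suc-injective)) t ,
        trans (set-other (τ LBL) (suc c) e (<⇒≢ h< ∘ suc-injective)) l

    kept : List ℕ
    kept = SIZES ∷ ENDS₁ ∷ ENDS₂ ∷ []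

    Loading : (ℕ → ℕ) → ℕ → Memory → Set
    Loading M i τ = τ ≈[ kept ] σ × (τ names 0 ≡ n × τ nodeRep 0 ≡ 0 × τ nextRep 0 ≡ n × (∀ e → τ MARK e ≡ M e)) ×
      τ arcs 0 ≡ i + i × Sound (i + i) τ ×
      (∀ {e} → e < i → Arc τ (i + i) (A e) (B e) e × Arc τ (i + i) (B e) (A e) e)

    load : ∀ {M i τ} → i < m → τ eidx 0 ≡ i → Loading M i τ →
      Runs (addArc ENDS₁ ENDS₂ ⨾ addArc ENDS₂ ENDS₁) τ 44 (λ τ _ → τ eidx 0 ≡ i × Loading M (suc i) (update τ eidx 0 (suc (τ eidx 0))))
    load {M} {i} {τ} i< eqi (st , fixed , eqc , snd , arcs-in) =
      R-seq {P = λ υ b → υ ≡ τ₁ × b ≡ 22}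
        (R-then-at 0 (suc c) refl (cong suc eqc) (R-then-at (suc c) (A i) refl (at ENDS₁ tt) (R-then-at (suc c) (B i) refl (at ENDS₂ tt) (R-assign-at {b = 22} (suc c) i refl eqi (refl , refl)))))
        λ { (refl , refl) →
          R-then-at 0 (suc (suc c)) refl refl (R-then-at (suc (suc c)) (B i) refl (at ENDS₂ tt) (R-then-at (suc (suc c)) (A i) refl (at ENDS₁ tt) (R-assign-at {b = 0} (suc (suc c)) i refl eqi
            (eqi , ≈-update eidx kept tt (keep {τ₁} (keep {τ} st)) , fixed , sym (cong suc (+-suc i i)) ,
             subst (λ d → Sound d τ₂) (sym (cong suc (+-suc i i))) (sound-write {τ₁} (sound-write {τ} snd (i< , inj₁ (refl , refl))) (i< , inj₂ (refl , refl))) ,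
             λ {e} e< → subst (λ d → Arc τ₂ d (A e) (B e) e × Arc τ₂ d (B e) (A e) e) (sym (cong suc (+-suc i i))) (both e< (e ≟ i)))))) }
      where
      c = i + i
      at : ∀ a → T (a ∈ᵇ kept) → τ a (τ eidx 0) ≡ σ a i
      at a a∈ = trans (st a a∈ _) (cong (σ a) eqi)
      τ₁ τ₂ : Memory
      τ₁ = written τ c (A i) (B i) i
      τ₂ = written τ₁ (suc c) (B i) (A i) i
      keep : ∀ {υ c x y e} → υ ≈[ kept ] σ → written υ c x y e ≈[ kept ] σ
      keep s = ≈-update LBL kept tt (≈-update TGT kept tt (≈-update SRC kept tt (≈-update arcs kept tt s)))
      both : ∀ {e} → e < suc i → Dec (e ≡ i) → Arc τ₂ (suc (suc c)) (A e) (B e) e × Arc τ₂ (suc (suc c)) (B e) (A e) e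
      both _  (yes refl) = arc-old {τ₁} (arc-new {τ}) , arc-new {τ₁}
      both e< (no e≢i)   = let p , q = arcs-in (≤∧≢⇒< (s≤s⁻¹ e<) e≢i) in arc-old {τ₁} (arc-old {τ} p) , arc-old {τ₁} (arc-old {τ} q)

  setup-runs : Runs setup σ ((m * 15 + 9) + (14 + (m * 55 + 9))) (λ τ _ → Loaded τ)
  setup-runs = R-seq′ (R-frame kept tt (clear-runs MARK (SIZES [ lit 1 ]) m σ (λ ()) λ same → trans (same SIZES (λ ()) (λ ()) 1) eqm))
    λ { {τ} (zeros , same) → R-then-at 0 n refl (trans (same SIZES tt 0) eqn) (R-then-at 0 0 refl refl
      (R-then-at 0 n refl (trans (same SIZES tt 0) eqn) (R-then-at 0 0 refl refl
      (R-map (λ { (st , (a , b , c , d) , eqc , snd , arcs-in) → record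
          { sizes = trans (st SIZES tt 0) eqn ; arcs# = eqc ; names# = a ; rep# = b ; next# = c
          ; blank = λ e e< → trans (d e) (zeros e e<) ; sound = snd ; present = arcs-in } })
        (R-for′ (Loading (τ MARK)) m 44 (λ { (st , _) → trans (st SIZES tt 1) eqm }) load
          (≈-update eidx kept tt (≈-update arcs kept tt (≈-update nextRep kept tt (≈-update nodeRep kept tt (≈-update names kept tt same)))) ,
           (refl , refl , refl , λ _ → refl) , refl , (λ ()) , λ ())))))) }

module _ {a} {X : Set a} (g : ℕ → ℕ) where

  choosing : ℕ → X → List X
  choosing i x = if does (g i ≟ 0) then [] else x ∷ []

  selected : ℕ → List X → List X
  selected i []       = []
  selected i (x ∷ xs) = choosing i x ++ selected (suc i) xs

  choosing-0 : ∀ {i} x → g i ≡ 0 → choosing i x ≡ []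
  choosing-0 {i} x eq rewrite dec-true (g i ≟ 0) eq = refl

  choosing-1 : ∀ {i} x → g i ≢ 0 → choosing i x ≡ x ∷ []
  choosing-1 {i} x neq rewrite dec-false (g i ≟ 0) neq = refl

  selected-∷ʳ : ∀ i xs x → selected i (xs ∷ʳ x) ≡ selected i xs ++ choosing (i + length xs) x
  selected-∷ʳ i []       x = trans (++-identityʳ _) (cong (λ j → choosing j x) (sym (+-identityʳ i)))
  selected-∷ʳ i (y ∷ xs) x = trans (cong (choosing i y ++_) (trans (selected-∷ʳ (suc i) xs x) (cong (λ j → selected (suc i) xs ++ choosing j x) (sym (+-suc i (length xs))))))
    (sym (++-assoc (choosing i y) _ _))

  choosing-length : ∀ i x → length (choosing i x) ≡ g i ⊓ 1
  choosing-length i x with g i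
  ... | zero  = refl
  ... | suc k = sym (cong suc (⊓-zeroʳ k))

  selected-length : ∀ i xs → length (selected i xs) + marked g i ≡ marked g (i + length xs)
  selected-length i []       = cong (marked g) (sym (+-identityʳ i))
  selected-length i (x ∷ xs) = trans (cong (_+ marked g i) (trans (length-++ (choosing i x)) (trans (+-comm (length (choosing i x)) _) (cong (length (selected (suc i) xs) +_) (choosing-length i x)))))
    (trans (+-assoc _ (g i ⊓ 1) (marked g i)) (trans (selected-length (suc i) xs) (cong (marked g) (sym (+-suc i (length xs))))))

  selected-⊆ : ∀ i xs {x} → x ∈ selected i xs → x ∈ xs
  selected-⊆ i (y ∷ xs) x∈ with ∈.∈-++⁻ (choosing i y) x∈
  ... | inj₂ x∈′ = there (selected-⊆ (suc i) xs x∈′)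
  ... | inj₁ x∈′ with g i ≟ 0
  ...   | yes z rewrite choosing-0 {i} y z with () ← x∈′
  ...   | no nz rewrite choosing-1 {i} y nz with here eq ← x∈′ = here eq

  selected-unique : ∀ i xs → Unique xs → Unique (selected i xs)
  selected-unique i []       []         = []
  selected-unique i (x ∷ xs) (x∉ ∷ un) with g i ≟ 0
  ... | yes z rewrite choosing-0 {i} x z  = selected-unique (suc i) xs un
  ... | no nz rewrite choosing-1 {i} x nz = All.tabulate (λ y∈ → All.lookup x∉ (selected-⊆ (suc i) xs y∈)) ∷ selected-unique (suc i) xs un

  ∈-selected : ∀ i xs (j : Fin (length xs)) → g (i + toℕ j) ≢ 0 → lookup xs j ∈ selected i xs
  ∈-selected i (x ∷ xs) zero    nz rewrite choosing-1 {i} x (nz ∘ trans (cong g (+-identityʳ i))) = here refl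
  ∈-selected i (x ∷ xs) (suc j) nz = ∈.∈-++⁺ʳ (choosing i x) (∈-selected (suc i) xs j (nz ∘ trans (cong g (+-suc i (toℕ j)))))

seg-lookup : ∀ {a} {X : Set a} {f : ℕ → ℕ} (h : X → ℕ) {s} xs → Seg f s (map h xs) → ∀ i → f (s + toℕ i) ≡ h (lookup xs i)
seg-lookup {f = f} h {s} (x ∷ xs) (eq ∷ seg) zero    = trans (cong f (+-identityʳ s)) eq
seg-lookup {f = f} h {s} (x ∷ xs) (eq ∷ seg) (suc i) = trans (cong f (+-suc s (toℕ i))) (seg-lookup h xs seg i)

seg-tabulate : ∀ {a} {X : Set a} {f : ℕ → ℕ} (h : X → ℕ) {s} xs → (∀ i → f (s + toℕ i) ≡ h (lookup xs i)) → Seg f s (map h xs)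
seg-tabulate h         []       eq = []
seg-tabulate {f = f} h {s} (x ∷ xs) eq = trans (cong f (sym (+-identityʳ s))) (eq zero) ∷
  seg-tabulate h xs λ i → trans (cong f (sym (+-suc s (toℕ i)))) (eq (suc i))

module _ {a} {X : Set a} (h₁ h₂ : X → ℕ) (es : List X) {σ : Memory} (eqm : σ SIZES 1 ≡ length es)
  (seg₁ : Seg (σ ENDS₁) 0 (map h₁ es)) (seg₂ : Seg (σ ENDS₂) 0 (map h₂ es)) where
  private
    g : ℕ → ℕ
    g = σ MARK

    m = length es

    kept : List ℕ
    kept = SIZES ∷ MARK ∷ []

    Half : (ℕ → ℕ) → (X → ℕ) → ℕ → List X → List X → Set
    Half f h i dn todo = Seg f 0 (map h (selected g 0 dn)) × Seg f i (map h todo)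

    Writing : ℕ → Memory → Set a
    Writing i τ = ∃[ dn ] ∃[ todo ] es ≡ dn ++ todo × length dn ≡ i × τ ≈[ kept ] σ × τ outLen 0 ≡ length (selected g 0 dn) ×
      Half (τ ENDS₁) h₁ i dn todo × Half (τ ENDS₂) h₂ i dn todo

    move : ∀ {f h i dn x todo} → length dn ≡ i → g i ≢ 0 → Half f h i dn (x ∷ todo) →
      Half (set f (length (selected g 0 dn)) (h x)) h (suc i) (dn ∷ʳ x) todo
    move {f} {h} {i} {dn} {x} {todo} refl nz (done , _ ∷ rest) =
      subst (Seg _ 0) (sym eq) (subst (λ l → Seg (set f l (h x)) 0 (map h (selected g 0 dn) ∷ʳ h x)) (length-map h (selected g 0 dn)) (seg-push done)) ,
      seg-from rest λ j j≥ → set-other f o (h x) (λ { refl → <⇒≱ j≥ o≤i })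
      where
      o = length (selected g 0 dn)
      eq : map h (selected g 0 (dn ∷ʳ x)) ≡ map h (selected g 0 dn) ∷ʳ h x
      eq = trans (cong (map h) (trans (selected-∷ʳ g 0 dn x) (cong (selected g 0 dn ++_) (choosing-1 g x nz)))) (map-++ h (selected g 0 dn) (x ∷ []))
      -- The output overwrites the input arrays in place. Since the write position never overtakes
      -- the read position, unread entries survive.
      o≤i : o ≤ i
      o≤i = ≤-trans (m≤m+n o _) (≤-trans (≤-reflexive (selected-length g 0 dn)) (marked≤ (length dn)))
        where
        marked≤ : ∀ k → marked g k ≤ k
        marked≤ zero    = z≤n
        marked≤ (suc k) = +-mono-≤ (m⊓n≤n (g k) 1) (marked≤ k)
      seg-from : ∀ {s ys} → Seg f s ys → (∀ j → s ≤ j → set f o (h x) j ≡ f j) → Seg (set f o (h x)) s ys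
      seg-from []         same = []
      seg-from {s} (e ∷ seg) same = trans (same s ≤-refl) e ∷ seg-from seg λ j j> → same j (<⇒≤ j>)

    stay-half : ∀ {f h i dn x todo} → length dn ≡ i → g i ≡ 0 → Half f h i dn (x ∷ todo) → Half f h (suc i) (dn ∷ʳ x) todo
    stay-half {f} {h} {i} {dn} {x} refl z (done , _ ∷ rest) =
      subst (Seg f 0 ∘ map h) (sym (trans (selected-∷ʳ g 0 dn x) (trans (cong (selected g 0 dn ++_) (choosing-0 g x z)) (++-identityʳ _)))) done , rest

    write : ∀ {i τ} → i < m → τ oidx 0 ≡ i → Writing i τ → Runs select τ 21 (λ τ _ → τ oidx 0 ≡ i × Writing (suc i) (update τ oidx 0 (suc (τ oidx 0))))
    write i< eqi (dn , [] , eq , len , _) = contradiction i< (<-irrefl (trans (sym len) (cong length (sym (trans eq (++-identityʳ dn))))))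
    write {i} {τ} i< eqi (dn , x ∷ todo , eq , len , st , eqo , half₁@(_ , e₁ ∷ _) , half₂@(_ , e₂ ∷ _)) = R-if
      (λ nz → R-then-at o (h₁ x) eqo (trans (cong (τ ENDS₁) eqi) e₁) (R-then-at o (h₂ x) eqo (trans (cong (τ ENDS₂) eqi) e₂)
        (R-assign-at {b = 0} 0 (suc o) refl (cong suc eqo)
          (eqi , dn ∷ʳ x , todo , split , len′ ,
           ≈-update oidx kept tt (≈-update outLen kept tt (≈-update ENDS₂ kept tt (≈-update ENDS₁ kept tt st))) ,
           trans (+-comm 1 o) (sym (trans (cong length (trans (selected-∷ʳ g 0 dn x) (cong (selected g 0 dn ++_) (choosing-1 g x (at≢ nz))))) (length-++ (selected g 0 dn)))) ,
           move {dn = dn} len (subst (λ j → g j ≢ 0) len (at≢ nz)) half₁ , move {dn = dn} len (subst (λ j → g j ≢ 0) len (at≢ nz)) half₂))))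
      (λ z → R-≤ (≤ᵇ⇒≤ 1 17 tt) (R-skip {b = 0} (eqi , dn ∷ʳ x , todo , split , len′ , ≈-update oidx kept tt st ,
           trans eqo (cong length (sym (trans (selected-∷ʳ g 0 dn x) (trans (cong (selected g 0 dn ++_) (choosing-0 g x (at≡ z))) (++-identityʳ _))))) ,
           stay-half {dn = dn} len (subst (λ j → g j ≡ 0) len (at≡ z)) half₁ , stay-half {dn = dn} len (subst (λ j → g j ≡ 0) len (at≡ z)) half₂)))
      where
      o = length (selected g 0 dn)
      split : es ≡ (dn ∷ʳ x) ++ todo
      split = trans eq (sym (++-assoc dn (x ∷ []) todo))
      len′ : length (dn ∷ʳ x) ≡ suc i
      len′ = trans (length-∷ʳ dn x) (cong suc len)
      gi : τ MARK (τ oidx 0) ≡ g (length dn)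
      gi = trans (st MARK tt _) (cong g (trans eqi (sym len)))
      at≢ : τ MARK (τ oidx 0) ≢ 0 → g (length dn) ≢ 0
      at≢ nz = nz ∘ trans gi
      at≡ : τ MARK (τ oidx 0) ≡ 0 → g (length dn) ≡ 0
      at≡ = trans (sym gi)

  Written : Memory → Set
  Written τ = τ SIZES 0 ≡ σ SIZES 0 × τ SIZES 1 ≡ length (selected g 0 es) ×
    Seg (τ ENDS₁) 0 (map h₁ (selected g 0 es)) × Seg (τ ENDS₂) 0 (map h₂ (selected g 0 es))

  output-runs : Runs output σ (3 + ((m * 32 + 9) + 4)) (λ τ _ → Written τ)
  output-runs = R-then-at 0 0 refl refl (R-seq′
    (R-for′ Writing m 21 (λ { (_ , _ , _ , _ , st , _) → trans (st SIZES tt 1) eqm }) write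
      ([] , es , refl , refl , ≈-update oidx kept tt (≈-update outLen kept tt (≈-refl {kept} {σ})) , refl , ([] , seg₁) , ([] , seg₂)))
    λ { {τ} (dn , todo , eq , len , st , eqo , (done₁ , _) , (done₂ , _)) →
      let all = finished dn todo eq len in
      R-assign-at {b = 0} 1 (length (selected g 0 es)) refl (trans eqo (cong (length ∘ selected g 0) (sym all)))
        (st SIZES tt 0 , refl , subst (Seg (τ ENDS₁) 0 ∘ map h₁ ∘ selected g 0) (sym all) done₁ , subst (Seg (τ ENDS₂) 0 ∘ map h₂ ∘ selected g 0) (sym all) done₂) })
    where
    finished : ∀ dn todo → es ≡ dn ++ todo → length dn ≡ m → es ≡ dn
    finished dn []      eq _   = trans eq (++-identityʳ dn)
    finished dn (_ ∷ _) eq len = contradiction (trans len (trans (cong length eq) (length-++ dn))) (<⇒≢ (m<m+n (length dn) z<s))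

-- The spanner

2^log≤ : ∀ n .{{_ : NonZero n}} → 2 ^ ⌊log₂ n ⌋ ≤ n
2^log≤ n = go n n ≤-refl
  where
  go : ∀ k n .{{_ : NonZero n}} → n ≤ k → 2 ^ ⌊log₂ n ⌋ ≤ n
  go k 1 _ = ≤-refl
  go (suc k) n@(2+ n′) (s≤s n≤k) = begin
    2 ^ ⌊log₂ n ⌋             ≡⟨ cong (2 ^_) (sym (m+[n∸m]≡n (⌊log₂⌋-mono-≤ {2} {n} (s≤s (s≤s z≤n))))) ⟩
    2 * 2 ^ (⌊log₂ n ⌋ ∸ 1)   ≡⟨ cong (λ l → 2 * 2 ^ l) (sym (⌊log₂⌊n/2⌋⌋≡⌊log₂n⌋∸1 n)) ⟩
    2 * 2 ^ ⌊log₂ h ⌋         ≤⟨ *-monoʳ-≤ 2 (go k h (≤-trans (s≤s⁻¹ (⌊n/2⌋<n (suc n′))) n≤k)) ⟩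
    2 * h                     ≡⟨ cong (h +_) (+-identityʳ h) ⟩
    h + h                     ≤⟨ +-monoʳ-≤ h (⌊n/2⌋≤⌈n/2⌉ n) ⟩
    h + ⌈ n /2⌉               ≡⟨ ⌊n/2⌋+⌈n/2⌉≡n n ⟩
    n                         ∎
    where
    open ≤-Reasoning
    h = ⌊ n /2⌋

-- The invariants yield multiples of ⌊log₂ n⌋, while the theorem rounds only after multiplying. The
-- comparison takes logarithms in (2 ^ ⌊log₂ n⌋) ^ a ≤ n ^ a.
*log≤ : ∀ a n .{{_ : NonZero n}} → a * ⌊log₂ n ⌋ ≤ ⌊ a ·log₂ n ⌋
*log≤ a n = begin
  a * ⌊log₂ n ⌋                     ≡⟨ *-comm a _ ⟩
  ⌊log₂ n ⌋ * a                     ≡⟨ sym (⌊log₂[2^n]⌋≡n (⌊log₂ n ⌋ * a)) ⟩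
  ⌊log₂ (2 ^ (⌊log₂ n ⌋ * a)) ⌋     ≡⟨ cong ⌊log₂_⌋ (sym (^-*-assoc 2 ⌊log₂ n ⌋ a)) ⟩
  ⌊log₂ ((2 ^ ⌊log₂ n ⌋) ^ a) ⌋     ≤⟨ ⌊log₂⌋-mono-≤ (^-monoˡ-≤ a (2^log≤ n)) ⟩
  ⌊log₂ (n ^ a) ⌋                   ∎
  where open ≤-Reasoning

-- The ceiling of p is by definition minus the floor of -p, so the inequality for the floor is
-- negated.
≤ceiling : ∀ p → ℚ.toℚᵘ p ℚᵘ.≤ ℚᵘ.mkℚᵘ (ceiling p) 0
≤ceiling p@record{} = ℚᵘ.*≤* (begin
  ℚ.↥ p ℤ.* ℤ.1ℤ                    ≡⟨ ℤ.*-identityʳ (ℚ.↥ p) ⟩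
  ℚ.↥ p                             ≡⟨ sym (ℤ.neg-involutive (ℚ.↥ p)) ⟩
  ℤ.- (ℤ.- ℚ.↥ p)                   ≤⟨ ℤ.neg-mono-≤ (subst₂ (λ a b → f ℤ.* b ℤ.≤ a) (ℚ.↥-neg p) (ℚ.↧-neg p) floor≤) ⟩
  ℤ.- (f ℤ.* ℚ.↧ p)                 ≡⟨ ℤ.neg-distribˡ-* f (ℚ.↧ p) ⟩
  (ℤ.- f) ℤ.* ℚ.↧ p                 ∎)
  where
  open ℤ.≤-Reasoning
  f = ℚ.floor (ℚ.- p)
  floor≤′ : ∀ q → ℚ.floor q ℤ.* ℚ.↧ q ℤ.≤ ℚ.↥ q
  floor≤′ q@record{} = ℤ.[n/d]*d≤n (ℚ.↥ q) (ℚ.↧ q)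
  floor≤ : f ℤ.* ℚ.↧ (ℚ.- p) ℤ.≤ ℚ.↥ (ℚ.- p)
  floor≤ = floor≤′ (ℚ.- p)

-- For an edge, at distance 1, the stretch bound is j ≤ t, whence j/2 ≤ t/2 ≤ ⌈t/2⌉. As j is not
-- negative, neither is this ceiling, and taking its absolute value changes nothing.
stretch-bound : ∀ t j → (ℤ.+ j ℚ./ 1) ℚ.≤ t ℚ.* (ℤ.+ 1 ℚ./ 1) → j ≤ 2 * ⌈½ t ⌉
stretch-bound t j le = integers (ceiling (t ℚ.* ½)) (ℚᵘ.drop-*≤* (begin
  ℚᵘ.mkℚᵘ (ℤ.+ j) 0 ℚᵘ.* ℚ.toℚᵘ ½        ≤⟨ ℚᵘ.*-monoˡ-≤-nonNeg (ℚ.toℚᵘ ½) (ℚᵘ.≤-trans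
      (ℚᵘ.≤-reflexive (ℚᵘ.≃-sym (ℚ.toℚᵘ-fromℚᵘ (ℚᵘ.mkℚᵘ (ℤ.+ j) 0)))) (ℚ.toℚᵘ-mono-≤ (subst ((ℤ.+ j ℚ./ 1) ℚ.≤_) (ℚ.*-identityʳ t) le))) ⟩
  ℚ.toℚᵘ t ℚᵘ.* ℚ.toℚᵘ ½                 ≃⟨ ℚᵘ.≃-sym (ℚ.toℚᵘ-homo-* t ½) ⟩
  ℚ.toℚᵘ (t ℚ.* ½)                       ≤⟨ ≤ceiling (t ℚ.* ½) ⟩
  ℚᵘ.mkℚᵘ (ceiling (t ℚ.* ½)) 0          ∎))
  where
  open ℚᵘ.≤-Reasoning
  integers : ∀ c → (ℤ.+ j ℤ.* ℤ.1ℤ) ℤ.* ℤ.1ℤ ℤ.≤ c ℤ.* ℤ.+ 2 → j ≤ 2 * ℤ.∣ c ∣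
  integers (ℤ.+ k) le′ = ℤ.drop‿+≤+ (subst₂ ℤ._≤_
    (trans (ℤ.*-identityʳ (ℤ.+ j ℤ.* ℤ.1ℤ)) (ℤ.*-identityʳ (ℤ.+ j)))
    (trans (sym (ℤ.pos-* k 2)) (cong ℤ.+_ (*-comm k 2))) le′)
  integers -[1+ k ] le′ with () ← subst (ℤ._≤ -[1+ k ] ℤ.* ℤ.+ 2)
    (trans (ℤ.*-identityʳ (ℤ.+ j ℤ.* ℤ.1ℤ)) (ℤ.*-identityʳ (ℤ.+ j))) le′

unique-↭ : ∀ {a} {A : Set a} {xs ys : List A} → xs ↭ ys → Unique xs → Unique ys
unique-↭ ↭.refl         un = un
unique-↭ (↭.prep x p)   (x∉ ∷ un) = All.tabulate (λ y∈ → All.lookup x∉ (↭.∈-resp-↭ (↭-sym p) y∈)) ∷ unique-↭ p un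
unique-↭ (↭.swap x y p) ((x≢y ∷ x∉) ∷ y∉ ∷ un) =
  ((x≢y ∘ sym) ∷ All.tabulate (λ z∈ → All.lookup y∉ (↭.∈-resp-↭ (↭-sym p) z∈))) ∷
  All.tabulate (λ z∈ → All.lookup x∉ (↭.∈-resp-↭ (↭-sym p) z∈)) ∷ unique-↭ p un
unique-↭ (↭.trans p q)  un = unique-↭ q (unique-↭ p un)

same-members : ∀ {a} {A : Set a} {xs ys : List A} → Unique xs → Unique ys → xs ⊆ ys → ys ⊆ xs → xs ↭ ys
same-members {xs = xs} {ys} ux uy sub sup with complement ux sub
... | []     , p = ↭-sym (↭-trans p (subst (_↭ xs) (sym (++-identityʳ xs)) ↭-refl))
... | z ∷ zs , p = contradiction (length-mono-⊆ uy sup) (<⇒≱ (begin-strict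
  length xs                 <⟨ m<m+n (length xs) z<s ⟩
  length xs + length (z ∷ zs) ≡⟨ sym (length-++ xs) ⟩
  length (xs ++ z ∷ zs)     ≡⟨ sym (↭.↭-length p) ⟩
  length ys                 ∎))
  where open ≤-Reasoning

∈-edges⁻ : ∀ {n} (G : Graph n) {u v} → (u , v) ∈ edges G → u Fin.< v × Graph._∼_ G u v
∈-edges⁻ {n} G e∈ = proj₂ (∈.∈-filter⁻ (λ (u , v) → (u Fin.<? v) ×-dec (Graph._∼?_ G u v)) {xs = cartesianProduct (allFin n) (allFin n)} e∈)

∈-edges⁺ : ∀ {n} (G : Graph n) {u v} → u Fin.< v → Graph._∼_ G u v → (u , v) ∈ edges G
∈-edges⁺ G {u} {v} u<v e = ∈.∈-filter⁺ (λ (u , v) → (u Fin.<? v) ×-dec (Graph._∼?_ G u v))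
  (∈.∈-cartesianProduct⁺ (∈.∈-allFin u) (∈.∈-allFin v)) (u<v , e)

edges-unique : ∀ {n} (G : Graph n) → Unique (edges G)
edges-unique {n} G = Unique.filter⁺ (λ (u , v) → (u Fin.<? v) ×-dec (Graph._∼?_ G u v))
  (Unique.cartesianProduct⁺ (Unique.allFin⁺ n) (Unique.allFin⁺ n))

module _ {n : ℕ} {R : ℕ → ℕ → Set} {S : Fin n → Fin n → Set}
  (f : ∀ {a b} → R (toℕ a) b → ∃[ v ] b ≡ toℕ v × S a v) where

  path-toFin : ∀ {u b k} → Path R (toℕ u) b k → ∃[ v ] b ≡ toℕ v × Path S u v k
  path-toFin ε       = _ , refl , ε
  path-toFin (e ◅ p) with f e
  ... | w , refl , s with path-toFin p
  ...   | v , eq , q = v , eq , s ◅ q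

  path-toFin′ : ∀ {u v k} → Path R (toℕ u) (toℕ v) k → Path S u v k
  path-toFin′ {u} {k = k} p with path-toFin p
  ... | v′ , eq , q = subst (λ v → Path S u v k) (sym (Fin.toℕ-injective eq)) q

path-fromFin : ∀ {n} {R : ℕ → ℕ → Set} {S : Fin n → Fin n → Set} → (∀ {u v} → S u v → R (toℕ u) (toℕ v)) →
  ∀ {u v k} → Path S u v k → Path R (toℕ u) (toℕ v) k
path-fromFin f ε       = ε
path-fromFin f (e ◅ p) = f e ◅ path-fromFin f p

list-toFin : ∀ {n} zs → All (_< n) zs → ∃[ fs ] map (toℕ {n}) fs ≡ zs
list-toFin []       []         = [] , refl
list-toFin (z ∷ zs) (lt ∷ lts) with fs , eq ← list-toFin zs lts = fromℕ< lt ∷ fs , cong₂ _∷_ (Fin.toℕ-fromℕ< lt) eq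

module Root {n : ℕ} .{{_ : NonZero n}} (G T : Graph n) (r : ℕ) (G-conn : Connected G)
  (T-tree : Graph.IsTree T)
  (T⊆G : ∀ {u v} → Graph._∼_ T u v → Graph._∼_ G u v)
  (stretch : ∀ {u v} → Graph._∼_ G u v → Path≤ (Graph._∼_ T) u v (2 * r))
  (A B : ℕ → ℕ) (es : List (Fin n × Fin n)) (es↭ : es ↭ edges G)
  (A≡ : ∀ i → A (toℕ i) ≡ toℕ (proj₁ (lookup es i)))
  (B≡ : ∀ i → B (toℕ i) ≡ toℕ (proj₂ (lookup es i)))
  where
  open Median G T r T-tree T⊆G stretch
  private module G = Graph G

  κ₀ : Arcs
  κ₀ = edgeArcs A B (length es)

  κ₀-at : ∀ {a b} i → a ≡ A (toℕ i) × b ≡ B (toℕ i) ⊎ a ≡ B (toℕ i) × b ≡ A (toℕ i) →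
    ∃[ u ] ∃[ v ] a ≡ toℕ u × b ≡ toℕ v × u G.∼ v × ((u , v) ≡ lookup es i ⊎ (v , u) ≡ lookup es i)
  κ₀-at i ends with ∈-edges⁻ G (↭.∈-resp-↭ es↭ (∈.∈-lookup i))
  κ₀-at i (inj₁ (refl , refl)) | _ , e = _ , _ , A≡ i , B≡ i , e , inj₁ refl
  κ₀-at i (inj₂ (refl , refl)) | _ , e = _ , _ , B≡ i , A≡ i , G.∼-sym e , inj₂ refl

  κ₀-fin : ∀ {a b e} → κ₀ a b e → ∃[ u ] ∃[ v ] a ≡ toℕ u × b ≡ toℕ v × u G.∼ v ×
    ∃[ i ] toℕ i ≡ e × ((u , v) ≡ lookup es i ⊎ (v , u) ≡ lookup es i)
  κ₀-fin {a} {b} {e} (e< , ends) =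
    let u , v , eq₁ , eq₂ , uv , at = κ₀-at (fromℕ< e<) (subst (λ e → a ≡ A e × b ≡ B e ⊎ a ≡ B e × b ≡ A e) (sym (Fin.toℕ-fromℕ< e<)) ends)
    in u , v , eq₁ , eq₂ , uv , fromℕ< e< , Fin.toℕ-fromℕ< e< , at

  κ₀-sym : ∀ {a b e} → κ₀ a b e → κ₀ b a e
  κ₀-sym (e< , inj₁ (p , q)) = e< , inj₂ (q , p)
  κ₀-sym (e< , inj₂ (p , q)) = e< , inj₁ (q , p)

  κ₀< : ∀ {a b e} → κ₀ a b e → a < n × b < n
  κ₀< k with u , v , refl , refl , _ ← κ₀-fin k = Fin.toℕ<n u , Fin.toℕ<n v

  listed : ∀ {u v} → (u , v) ∈ es → ∥ κ₀ ∥ (toℕ u) (toℕ v)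
  listed uv∈ = toℕ i , Fin.toℕ<n i , inj₁ (trans (cong (toℕ ∘ proj₁) eq) (sym (A≡ i)) , trans (cong (toℕ ∘ proj₂) eq) (sym (B≡ i)))
    where
    i  = Any.index uv∈
    eq = Any.lookup-index uv∈

  edge : ∀ {u v} → u G.∼ v → ∥ κ₀ ∥ (toℕ u) (toℕ v)
  edge {u} {v} e with <-cmp (toℕ u) (toℕ v)
  ... | tri< u<v _ _ = listed (↭.∈-resp-↭ (↭-sym es↭) (∈-edges⁺ G u<v e))
  ... | tri≈ _ u≡v _ = contradiction e (G.∼-irrefl (Fin.toℕ-injective u≡v))
  ... | tri> _ _ v<u with l , k ← listed (↭.∈-resp-↭ (↭-sym es↭) (∈-edges⁺ G v<u (G.∼-sym e))) = l , κ₀-sym k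

  to-edge : ∀ {a b} → ∥ κ₀ ∥ (toℕ a) b → ∃[ v ] b ≡ toℕ v × a G.∼ v
  to-edge (_ , k) with u , v , eq , eq′ , uv , _ ← κ₀-fin k with refl ← Fin.toℕ-injective eq = v , eq′ , uv

  -- Medians live in `Fin n`, whereas nodes use natural numbers, because contracted vertices receive
  -- names from n on; lists and walks are translated in both directions.
  separates : ∀ Z → All (_< n) Z → ∃[ c ] c ∈ upTo n × Balanced κ₀ Z c r
  separates Z small with fs , refl ← list-toFin {n} Z small with c , sep ← median-separates fs =
    toℕ c , ∈.∈-upTo⁺ (Fin.toℕ<n c) , balanced
    where
    balanced : Balanced κ₀ (map toℕ fs) (toℕ c) r
    balanced []         z₀ _  _   _   _     = z≤n
    balanced zs@(_ ∷ _) z₀ un zs⊆ z₀∉ reach = go (list-toFin zs (All.tabulate (All.lookup small ∘ zs⊆))) (source< (proj₂ (reach (here refl))) (All.lookup small (zs⊆ (here refl))))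
      where
      source< : ∀ {a b k} → Path (OffBall κ₀ (toℕ c) r) a b k → b < n → a < n
      source< ε                   b< = b<
      source< (((_ , k) , _) ◅ _) _  = proj₁ (κ₀< k)
      go : ∃[ gs ] map (toℕ {n}) gs ≡ zs → z₀ < n → 2 * length zs ≤ length (map toℕ fs)
      go (gs , eq) z₀< = subst₂ (λ a b → 2 * a ≤ b) (trans (sym (length-map toℕ gs)) (cong length eq)) (sym (length-map toℕ fs))
        (sep gs (Unique.map⁻ (subst Unique (sym eq) un)) sub w
          (λ (j , le , p) → z₀∉ (subst (Ball κ₀ (toℕ c) r) w≡ (j , le , path-fromFin edge p)))
          λ {z} z∈ → let k , p = reach (subst (toℕ z ∈_) eq (∈.∈-map⁺ toℕ z∈)) in
            k , path-toFin′ off (subst (λ a → Path (OffBall κ₀ (toℕ c) r) a (toℕ z) k) (sym w≡) p))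
        where
        w = fromℕ< z₀<
        w≡ : toℕ w ≡ z₀
        w≡ = Fin.toℕ-fromℕ< z₀<
        sub : gs ⊆ fs
        sub {z} z∈ with y , y∈ , eq′ ← ∈.∈-map⁻ toℕ (zs⊆ (subst (toℕ z ∈_) eq (∈.∈-map⁺ toℕ z∈))) = subst (_∈ fs) (sym (Fin.toℕ-injective eq′)) y∈
        off : ∀ {a b} → OffBall κ₀ (toℕ c) r (toℕ a) b → ∃[ v ] b ≡ toℕ v × Outside c a v
        off (k , b∉) with v , refl , e ← to-edge k = v , refl , e , λ (j , le , p) → b∉ (j , le , path-fromFin edge p)

  0<n : 0 < n
  0<n = >-nonZero⁻¹ n

  root : Node n r
  root = record
    { rep = 0 ; verts = upTo n ; κ = κ₀ ; κ-sym = κ₀-sym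
    ; κ-in = λ k → let a< , b< = κ₀< k in ∈.∈-upTo⁺ a< , ∈.∈-upTo⁺ b<
    ; uniq = Unique.upTo⁺ n ; rep∈ = ∈.∈-upTo⁺ 0<n
    ; connected = λ v∈ → reach (∈.∈-upTo⁻ v∈)
    ; separable = λ Z _ → separates Z }
    where
    reach : ∀ {v} → v < n → ∃[ k ] Path ∥ κ₀ ∥ 0 v k
    reach v< with k , w ← G-conn (fromℕ< 0<n) (fromℕ< v<) =
      k , subst₂ (λ a b → Path ∥ κ₀ ∥ a b k) (Fin.toℕ-fromℕ< 0<n) (Fin.toℕ-fromℕ< v<) (path-fromFin edge (walk→path G w))

  size≤ : Node.size root ≤ n
  size≤ = ≤-trans (length-filter (_<? n) (upTo n)) (≤-reflexive (length-upTo n))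

  L m E : ℕ
  L = ⌊log₂ n ⌋
  m = length es
  E = (n ∸ 1) * L

  Φ-root : Φ (root ∷ []) ≤ E
  Φ-root = ≤-trans (≤-reflexive (trans (+-identityʳ _) (cong (λ l → (l ∸ 1) * ⌊log₂ Node.size root ⌋) (length-upTo n))))
    (*-monoʳ-≤ (n ∸ 1) (⌊log₂⌋-mono-≤ size≤))

  open Main n r L m (m + m) E κ₀
  open Cycle n r L m (m + m) E κ₀ hiding (module Turn)

  module _ {σ τ : Memory} (eqn : σ SIZES 0 ≡ n) (eqm : σ SIZES 1 ≡ m) (eqA : ∀ e → σ ENDS₁ e ≡ A e) (eqB : ∀ e → σ ENDS₂ e ≡ B e)
    (ld : Loaded {n} {m} {σ} eqn eqm τ) where
    open Loaded ld
    private
      sound′ : ∀ {h} → h < m + m → κ₀ (τ SRC (suc h)) (τ TGT (suc h)) (τ LBL (suc h))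
      sound′ h< with e< , ends ← sound h< = e< , cast ends
        where
        cast : ∀ {a b e} → a ≡ σ ENDS₁ e × b ≡ σ ENDS₂ e ⊎ a ≡ σ ENDS₂ e × b ≡ σ ENDS₁ e → a ≡ A e × b ≡ B e ⊎ a ≡ B e × b ≡ A e
        cast (inj₁ (p , q)) = inj₁ (trans p (eqA _) , trans q (eqB _))
        cast (inj₂ (p , q)) = inj₂ (trans p (eqB _) , trans q (eqA _))

      present′ : ∀ {a b e} → κ₀ a b e → Arc τ (m + m) a b e
      present′ {e = e} (e< , inj₁ (refl , refl)) = subst₂ (λ a b → Arc τ (m + m) a b e) (eqA e) (eqB e) (proj₁ (present e<))
      present′ {e = e} (e< , inj₂ (refl , refl)) = subst₂ (λ a b → Arc τ (m + m) a b e) (eqB e) (eqA e) (proj₂ (present e<))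

      unmarked : ∀ k → k ≤ m → marked (τ MARK) k ≡ 0
      unmarked zero    _   = refl
      unmarked (suc k) k<m = cong₂ (λ x y → (x ⊓ 1) + y) (blank k k<m) (unmarked k (<⇒≤ k<m))

    initial : Inv τ (root ∷ [])
    initial = record
      { sizes = sizes ; arcs# = arcs# ; n≤N = ≤-reflexive (sym names#)
      ; ends = λ {h} h< → let s< , t< = κ₀< (sound′ h<) in subst (τ SRC (suc h) <_) (sym names#) s< , subst (τ TGT (suc h) <_) (sym names#) t<
      ; small = All.tabulate (λ v∈ → subst (_ <_) (sym names#) (∈.∈-upTo⁻ v∈)) ∷ []
      ; links = record { arc→κ = λ { _ (h , h< , refl , refl , refl) → sound′ h< } ; κ→arc = present′ } ∷ []
      ; lifts = (0 , *-monoʳ-≤ (2 * r) (⌊log₂⌋-mono-≤ size≤) , λ f _ {ℓ = ℓ} _ _ _ _ p → weaken (m≤m+n ℓ 0) (exactly p)) ∷ []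
      ; disjoint = [] ∷ []
      ; cover = λ x<n p → inj₂ (here (∈.∈-upTo⁺ x<n , x<n , mapPath (λ { (e , k) → (e , k) , proj₂ (κ₀< k) }) p))
      ; edge-bound = ≤-trans (≤-reflexive (cong (_+ Φ (root ∷ [])) (unmarked m ≤-refl))) Φ-root
      ; name-bound = ≤-trans (≤-reflexive (cong (_+ Φ (root ∷ [])) names#)) (+-monoʳ-≤ n Φ-root) }

    ready : Ready τ (root ∷ [])
    ready = rep# , trans next# (sym names#)

module Selection {n : ℕ} (G : Graph n) (sel : List (Fin n × Fin n)) (sel⊆ : sel ⊆ edges G) (sel-un : Unique sel) where

  listed? : ∀ e → Dec (e ∈ sel)
  listed? e = Any.any? (≡-dec Fin._≟_ Fin._≟_ e) sel

  subgraph : Graph n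
  subgraph = record
    { _∼_ = λ u v → (u , v) ∈ sel ⊎ (v , u) ∈ sel
    ; ∼-sym = λ { (inj₁ e) → inj₂ e ; (inj₂ e) → inj₁ e }
    ; ∼-irrefl = λ { refl (inj₁ e) → <-irrefl refl (proj₁ (∈-edges⁻ G (sel⊆ e))) ; refl (inj₂ e) → <-irrefl refl (proj₁ (∈-edges⁻ G (sel⊆ e))) }
    ; _∼?_ = λ u v → listed? (u , v) ⊎-dec listed? (v , u) }

  spanning : IsSpanningSubgraph G subgraph
  spanning (inj₁ e) = proj₂ (∈-edges⁻ G (sel⊆ e))
  spanning (inj₂ e) = Graph.∼-sym G (proj₂ (∈-edges⁻ G (sel⊆ e)))

  sel↭edges : sel ↭ edges subgraph
  sel↭edges = same-members sel-un (edges-unique subgraph)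
    (λ e∈ → ∈-edges⁺ subgraph (proj₁ (∈-edges⁻ G (sel⊆ e∈))) (inj₁ e∈)) back
    where
    back : edges subgraph ⊆ sel
    back e∈ with ∈-edges⁻ subgraph e∈
    ... | _   , inj₁ e∈′ = e∈′
    ... | u<v , inj₂ e∈′ = contradiction (proj₁ (∈-edges⁻ G (sel⊆ e∈′))) (<-asym u<v)

-- The total running time and correctness

-- By connectedness every vertex has a neighbour and so occurs among the ends of edges. This lets
-- the running time absorb the number of names into m log n.
order≤2edges : ∀ {n} (G : Graph n) → Connected G → 2 ≤ n → n ≤ 2 * ∣E∣ G
order≤2edges {n} G conn 2≤n = begin
  n                                     ≡⟨ sym (length-tabulate {n = n} id) ⟩
  length (allFin n)                     ≤⟨ length-mono-⊆ (Unique.allFin⁺ n) (λ {u} _ → covered u) ⟩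
  length (firsts ++ seconds)            ≡⟨ length-++ firsts ⟩
  length firsts + length seconds        ≡⟨ cong₂ _+_ (length-map proj₁ (edges G)) (length-map proj₂ (edges G)) ⟩
  ∣E∣ G + ∣E∣ G                         ≡⟨ cong (∣E∣ G +_) (sym (+-identityʳ _)) ⟩
  2 * ∣E∣ G                             ∎
  where
  open ≤-Reasoning
  firsts  = map proj₁ (edges G)
  seconds = map proj₂ (edges G)
  another : ∀ {n} → 2 ≤ n → (u : Fin n) → ∃[ w ] u ≢ w
  another (s≤s (s≤s _)) zero    = suc zero , λ ()
  another (s≤s (s≤s _)) (suc u) = zero , λ ()
  neighbour : ∀ {u w k} → u ≢ w → Graph.Walk G u w k → ∃[ v ] Graph._∼_ G u v
  neighbour u≢w Graph.[]      = contradiction refl u≢w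
  neighbour u≢w (e Graph.∷ _) = _ , e
  covered : ∀ u → u ∈ firsts ++ seconds
  covered u with w , u≢w ← another 2≤n u with v , e ← neighbour u≢w (proj₂ (conn u w)) with <-cmp (toℕ u) (toℕ v)
  ... | tri< u<v _ _ = ∈.∈-++⁺ˡ (∈.∈-map⁺ proj₁ (∈-edges⁺ G u<v e))
  ... | tri≈ _ u≡v _ = contradiction e (Graph.∼-irrefl G (Fin.toℕ-injective u≡v))
  ... | tri> _ _ v<u = ∈.∈-++⁺ʳ firsts (∈.∈-map⁺ proj₂ (∈-edges⁺ G v<u (Graph.∼-sym G e)))

totalCost : ℕ → ℕ → ℕ → ℕ → ℕ
totalCost n m E M = ((m * 15 + 9) + (14 + (m * 55 + 9))) +
  ((M * (suc (n + E + (m + m)) * 1367 + 15) + 6) + (3 + ((m * 32 + 9) + 4)))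

-- With p = mL and q = nL, the bound on names and arcs is at most 7p (1 + 2 + 2 + 2 by n ≤ 2m), a
-- unit of work costs at most (7 · 1367 + 15)p = 9584p, and there are at most 4q units. Input and
-- output add 156, so 38492 = 4 · 9584 + 156.
totalCost≤ : ∀ n m L E M → 1 ≤ n → 1 ≤ L → n ≤ 2 * m → E ≤ n * L → M ≤ 3 * E + 1 →
  totalCost n m E M ≤ 38492 * (n * m * L ^ 2)
totalCost≤ n m L E M 1≤n 1≤L n≤2m E≤ M≤ = ≤-trans
  (((m≤ ⟨*⟩ 15 ⟨+⟩ unit 9) ⟨+⟩ unit 14 ⟨+⟩ (m≤ ⟨*⟩ 55 ⟨+⟩ unit 9)) ⟨+⟩ (main≤ ⟨+⟩ unit 6) ⟨+⟩ unit 3 ⟨+⟩ ((m≤ ⟨*⟩ 32 ⟨+⟩ unit 9) ⟨+⟩ unit 4))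
  (≤-reflexive (regroup 38492))
  where
  open +-*-Solver
  p q X : ℕ
  p = m * L
  q = n * L
  X = q * p
  regroup : ∀ c → X * c ≡ c * (n * m * L ^ 2)
  regroup c = trans (*-comm X c) (cong (c *_) (solve 3 (λ n m l → n :* l :* (m :* l) := n :* m :* (l :* (l :* con 1))) refl n m L))
  1≤m : 1 ≤ m
  1≤m = n≢0⇒n>0 λ m≡0 → contradiction (≤-trans 1≤n (≤-trans n≤2m (≤-reflexive (cong (2 *_) m≡0)))) λ ()
  1≤p : 1 ≤ p
  1≤p = *-mono-≤ 1≤m 1≤L
  1≤q : 1 ≤ q
  1≤q = *-mono-≤ 1≤n 1≤L
  open Budget X (*-mono-≤ 1≤q 1≤p)
  m≤p : m ≤ p
  m≤p = ≤-trans (≤-reflexive (sym (*-identityʳ m))) (*-monoʳ-≤ m 1≤L)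
  m≤ : m ≤ X
  m≤ = ≤-trans m≤p (≤-trans (≤-reflexive (sym (+-identityʳ p))) (*-monoˡ-≤ p 1≤q))
  names≤ : suc (n + E + (m + m)) ≤ 7 * p
  names≤ = ≤-trans (+-mono-≤ 1≤p (+-mono-≤ (+-mono-≤ (≤-trans n≤2m (*-monoʳ-≤ 2 m≤p))
      (≤-trans E≤ (≤-trans (*-monoˡ-≤ L n≤2m) (≤-reflexive (*-assoc 2 m L))))) (+-mono-≤ m≤p m≤p)))
    (≤-reflexive (solve 1 (λ p → p :+ ((con 2 :* p :+ con 2 :* p) :+ (p :+ p)) := con 7 :* p) refl p))
  main≤ : M * (suc (n + E + (m + m)) * 1367 + 15) ≤ X * 38336
  main≤ = begin
    M * (suc (n + E + (m + m)) * 1367 + 15) ≤⟨ *-mono-≤ (≤-trans M≤ (+-mono-≤ (*-monoʳ-≤ 3 E≤) 1≤q)) factor≤ ⟩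
    (3 * q + q) * (p * 9584)                ≡⟨ cong (_* (p * 9584)) (trans (+-comm (3 * q) q) (*-comm 4 q)) ⟩
    q * 4 * (p * 9584)                      ≡⟨ solve 4 (λ a b c d → a :* b :* (c :* d) := a :* c :* (b :* d)) refl q 4 p 9584 ⟩
    X * 38336                               ∎
    where
    open ≤-Reasoning
    factor≤ : suc (n + E + (m + m)) * 1367 + 15 ≤ p * 9584
    factor≤ = begin
      suc (n + E + (m + m)) * 1367 + 15 ≤⟨ +-mono-≤ (*-monoˡ-≤ 1367 names≤) (≤-trans (≤-reflexive (sym (+-identityʳ 15))) (*-monoˡ-≤ 15 1≤p)) ⟩
      7 * p * 1367 + p * 15             ≡⟨ cong (_+ p * 15) (trans (cong (_* 1367) (*-comm 7 p)) (*-assoc p 7 1367)) ⟩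
      p * 9569 + p * 15                 ≡⟨ sym (*-distribˡ-+ p 9569 15) ⟩
      p * 9584                          ∎

spannerProgram : Program
spannerProgram = setup ⨾ mainLoop ⨾ output

module Correct {n : ℕ} .{{_ : NonZero n}} (G : Graph n) (G-conn : Connected G) (t : ℚ) (T : Graph n)
  (T-tree : Graph.IsTree T) (T-spanner : IsMultiplicativeSpanner G T t)
  (σ : Memory) (es : List (Fin n × Fin n)) (es↭ : es ↭ edges G)
  (eqn : σ 0 0 ≡ n) (eqm : σ 0 1 ≡ length es)
  (ends : ∀ i → σ 1 (toℕ i) ≡ toℕ (proj₁ (lookup es i)) × σ 2 (toℕ i) ≡ toℕ (proj₂ (lookup es i)))
  where

  r : ℕ
  r = ⌈½ t ⌉

  stretch : ∀ {u v} → Graph._∼_ G u v → Path≤ (Graph._∼_ T) u v (2 * r)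
  stretch {u} {v} e with j , (w , _) , le ← proj₂ T-spanner {u} {v} {1} (e Graph.∷ Graph.[] , λ
    { Graph.[] → contradiction e (Graph.∼-irrefl G refl) ; (_ Graph.∷ _) → s≤s z≤n }) =
    j , stretch-bound t j le , walk→path T w

  open Root G T r G-conn T-tree (proj₁ T-spanner) stretch (σ ENDS₁) (σ ENDS₂) es es↭ (proj₁ ∘ ends) (proj₂ ∘ ends)
  open Main n r L m (m + m) E κ₀
  open Cycle n r L m (m + m) E κ₀ hiding (module Turn)

  Result : Memory → Set₁
  Result τ = Σ[ H ∈ Graph n ] IsAdditiveSpanner G H ⌊ 2 * r ·log₂ n ⌋ × ∣E∣ H ≤ ⌊ n ·log₂ n ⌋ × Stores τ H

  module _ {τ : Memory} (inv : Inv τ []) where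
    open Inv inv

    sel : List (Fin n × Fin n)
    sel = selected (τ MARK) 0 es

    open Selection G sel (λ e∈ → ↭.∈-resp-↭ es↭ (selected-⊆ (τ MARK) 0 es e∈))
      (selected-unique (τ MARK) 0 es (unique-↭ (↭-sym es↭) (edges-unique G)))

    selected-edge : ∀ {u v} i → τ MARK (toℕ i) ≢ 0 → (u , v) ≡ lookup es i ⊎ (v , u) ≡ lookup es i → Graph._∼_ subgraph u v
    selected-edge i nz (inj₁ eq) = inj₁ (subst (_∈ sel) (sym eq) (∈-selected (τ MARK) 0 es i nz))
    selected-edge i nz (inj₂ eq) = inj₂ (subst (_∈ sel) (sym eq) (∈-selected (τ MARK) 0 es i nz))

    marked-edge : ∀ {a b} → (κ₀ ↾ on (τ MARK)) (toℕ a) b → ∃[ v ] b ≡ toℕ v × Graph._∼_ subgraph a v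
    marked-edge (e , k , nz) = let u , v , eq , eq′ , _ , i , eqi , at = κ₀-fin k in
      v , eq′ , subst (λ w → Graph._∼_ subgraph w v) (sym (Fin.toℕ-injective eq))
        (selected-edge i (nz ∘ trans (cong (τ MARK) (sym eqi))) at)

    additive : IsAdditiveSpanner G subgraph ⌊ 2 * r ·log₂ n ⌋
    additive = spanning , λ {u} {v} {k} (w , _) → case cover (Fin.toℕ<n u) (path-fromFin edge (walk→path G w)) of λ
      { (inj₁ (l , l≤ , p)) → let j , j≤ , d = dist subgraph (path-toFin′ marked-edge p) in
          j , d , ≤-trans j≤ (≤-trans l≤ (+-monoʳ-≤ k (*log≤ (2 * r) n))) }

    few-edges : ∣E∣ subgraph ≤ ⌊ n ·log₂ n ⌋
    few-edges = begin
      ∣E∣ subgraph                     ≡⟨ ↭.↭-length (↭-sym sel↭edges) ⟩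
      length sel                       ≡⟨ sym (+-identityʳ _) ⟩
      length sel + 0                   ≡⟨ selected-length (τ MARK) 0 es ⟩
      marked (τ MARK) m                ≡⟨ sym (+-identityʳ _) ⟩
      marked (τ MARK) m + 0            ≤⟨ edge-bound ⟩
      (n ∸ 1) * L                      ≤⟨ *-monoˡ-≤ L (m∸n≤m n 1) ⟩
      n * L                            ≤⟨ *log≤ n n ⟩
      ⌊ n ·log₂ n ⌋                    ∎
      where open ≤-Reasoning

    result : ∀ {υ} → υ SIZES 0 ≡ n → υ SIZES 1 ≡ length sel →
      Seg (υ ENDS₁) 0 (map (toℕ ∘ proj₁) sel) → Seg (υ ENDS₂) 0 (map (toℕ ∘ proj₂) sel) → Result υ
    result eq₀ eq₁ seg₁ seg₂ = subgraph , additive , few-edges , sel , sel↭edges , eq₀ , eq₁ ,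
      λ i → seg-lookup (toℕ ∘ proj₁) sel seg₁ i , seg-lookup (toℕ ∘ proj₂) sel seg₂ i

  inputs : List ℕ
  inputs = SIZES ∷ ENDS₁ ∷ ENDS₂ ∷ []

  all-runs : Runs spannerProgram σ (totalCost n m E (measure (root ∷ []))) (λ τ _ → Result τ)
  all-runs = R-seq′ (R-frame (ENDS₁ ∷ ENDS₂ ∷ []) tt (R-frame (SIZES ∷ []) tt (setup-runs eqn eqm)))
    λ { {τ₁} ((ld , z₁) , e₁) → R-seq′ (R-frame inputs tt (main-runs (initial eqn eqm (λ _ → refl) (λ _ → refl) ld) (ready eqn eqm (λ _ → refl) (λ _ → refl) ld)))
    λ { {τ₂} (inv , e₂) → R-map (λ { {υ} (eq₀ , eq₁ , seg₁ , seg₂) → result inv {υ} (trans eq₀ (Inv.sizes inv)) eq₁ seg₁ seg₂ })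
      (output-runs (toℕ ∘ proj₁) (toℕ ∘ proj₂) es {τ₂} (trans (e₂ SIZES tt 1) (trans (z₁ SIZES tt 1) eqm))
        (seg-tabulate (toℕ ∘ proj₁) es λ i → trans (e₂ ENDS₁ tt _) (trans (e₁ ENDS₁ tt _) (proj₁ (ends i))))
        (seg-tabulate (toℕ ∘ proj₂) es λ i → trans (e₂ ENDS₂ tt _) (trans (e₁ ENDS₂ tt _) (proj₂ (ends i))))) } }

  cost≤ : 2 ≤ n → totalCost n m E (measure (root ∷ [])) ≤ 38492 * (n * ∣E∣ G * ⌊log₂ n ⌋ ^ 2)
  cost≤ 2≤n = rescale 38492 (totalCost≤ n m L E (measure (root ∷ [])) (≤-trans (s≤s z≤n) 2≤n) (⌊log₂⌋-mono-≤ 2≤n)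
      (≤-trans (order≤2edges G G-conn 2≤n) (≤-reflexive (cong (2 *_) (sym m≡))))
      (*-monoˡ-≤ L (m∸n≤m n 1)) (+-monoˡ-≤ 1 (*-monoʳ-≤ 3 Φ-root)))
    where
    m≡ : m ≡ ∣E∣ G
    m≡ = ↭.↭-length es↭
    rescale : ∀ c {k} → k ≤ c * (n * m * L ^ 2) → k ≤ c * (n * ∣E∣ G * ⌊log₂ n ⌋ ^ 2)
    rescale c {k} = subst (λ e → k ≤ c * (n * e * L ^ 2)) m≡

theorem4 : Σ[ p ∈ Program ] Σ[ c ∈ ℕ ]
    (∀ {n} .{{_ : NonZero n}} (G : Graph n) → Connected G →
    ∀ (t : ℚ) → 1ℚ ℚ.≤ t → HasTreeSpanner G t →
    ∀ (σ : Memory) → Stores σ G →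
    Σ[ H ∈ Graph n ]
    IsAdditiveSpanner G H ⌊ 2 * ⌈½ t ⌉ ·log₂ n ⌋ ×
    ∣E∣ H ≤ ⌊ n ·log₂ n ⌋ ×
    (∃[ τ ] ∃[ k ]
    ⟨ p , σ ⟩⇓⟨ τ , k ⟩ ×
    Stores τ H ×
    (2 ≤ n → k ≤ c * (n * ∣E∣ G * ⌊log₂ n ⌋ ^ 2))))
theorem4 = spannerProgram , 38492 , λ G conn t _ (T , tree , spanner) σ (es , perm , eqn , eqm , ends) →
  let module C = Correct G conn t T tree spanner σ es perm eqn eqm ends
      runs {τ} {k} {l} trace fits (H , additive , few , stores) = C.all-runs
  in H , additive , few , τ , k , trace , stores , λ 2≤n → ≤-trans (≤-trans (m≤m+n k l) fits) (C.cost≤ 2≤n)
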